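{- Let $s\ge r\ge 0$ with $s\ge 1$, and let $F$ be the $2$-regular graph whose cycles are: one cycle of length $h\ge 3$, one cycle of length $2\ell_i$ for each $1\le i\le r$, and two cycles of length $\ell_j$ for each $r+1\le j\le s$, where all $\ell_i$ ($1\le i\le s$) are odd, $3\le\ell_1<\ell_2<\dots<\ell_r$, and $\ell_j\ge 3$ for $r+1\le j\le s$. Let $v$ be the order of $F$ and $\ell=\max\{\ell_i\mid 1\le i\le s\}$. If $h>7^{s-1}(12\ell+6)$, then for every $\sigma\in\{ -1,0,1\}$ with $v-1\equiv\sigma\pmod 2$, $OP^\sigma(F)$ has a $(1-\sigma)$-pyramidal solution.
   Context: For $\sigma\in\{ -1,0,1\}$ with $v-1\equiv\sigma\pmod 2$, $(K_v)^\sigma$ denotes $K_v-I'$ if $\sigma=-1$, $K_v$ if $\sigma=0$, and $K_v+I'$ if $\sigma=1$, where $I'$ is a $1$-factor of $K_v$ and $K_v+I'$ is $K_v$ with the edges of $I'$ doubled. A solution to $OP^\sigma(F)$ is an $F$-factorization of $(K_v)^\sigma$ (for some $1$-factor $I'$): a collection of spanning subgraphs isomorphic to $F$ whose edge multisets partition the edge multiset of $(K_v)^\sigma$. A solution is $f$-pyramidal if it admits a group of automorphisms (vertex permutations mapping each factor onto a factor) fixing exactly $f$ vertices and acting sharply transitively on the remaining vertices. -}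

module Defs where

open import Data.Nat as ℕ using (ℕ; zero; suc; _+_; _*_; _∸_; _^_; _≤_; _<_; _⊔_; _<ᵇ_)
open import Data.Nat.ListAction using (sum)
open import Data.Integer as ℤ using (ℤ; +_)
open import Data.Fin as Fin using (Fin; toℕ)
open import Data.Fin.Properties using () renaming (_≟_ to _≟F_)
open import Data.List using (List; []; _∷_; _++_; map; length; zip; concat; concatMap; filter; allFin; foldr; [_])
open import Data.List.Membership.Propositional using (_∈_)
open import Data.List.Relation.Unary.All using (All; all?)
open import Data.List.Relation.Unary.Any using (Any)
open import Data.List.Relation.Binary.Permutation.Propositional using (_↭_)
open import Data.Product using (Σ; ∃; _×_; _,_)
open import Data.Sum using (_⊎_)
open import Data.Bool using (if_then_else_)
open import Relation.Binary.PropositionalEquality using (_≡_; _≢_)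
open import Relation.Nullary using (¬_; Dec; yes; no)

-- The graph F is described by its list of cycle lengths.

-- Cycle type of F:  h, then 2ℓ_i for the first r indices (i < r, i.e.
-- paper indices 1..r), then ℓ_j twice for the remaining indices.
cycleType : (h r s : ℕ) → (Fin s → ℕ) → List ℕ
cycleType h r s ℓ =
  h ∷ concatMap (λ i → if toℕ i <ᵇ r then [ 2 * ℓ i ] else (ℓ i ∷ ℓ i ∷ [])) (allFin s)

maxℓ : (s : ℕ) → (Fin s → ℕ) → ℕ
maxℓ s ℓ = foldr _⊔_ 0 (map ℓ (allFin s))

cycleEdges : ∀ {v} → List (Fin v) → List (Fin v × Fin v)
cycleEdges [] = []
cycleEdges (x ∷ xs) = zip (x ∷ xs) (xs ++ [ x ])

-- A 2-regular spanning subgraph, given as a list of cycles.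
Factor : ℕ → Set
Factor v = List (List (Fin v))

factorEdges : ∀ {v} → Factor v → List (Fin v × Fin v)
factorEdges C = concatMap cycleEdges C

pairCount : ∀ {v} → Fin v → Fin v → List (Fin v × Fin v) → ℕ
pairCount a b [] = 0
pairCount a b ((c , d) ∷ es) = hit + pairCount a b es
  where
  hit : ℕ
  hit with c ≟F a | d ≟F b | c ≟F b | d ≟F a
  ... | yes _ | yes _ | _     | _     = 1
  ... | _     | _     | yes _ | yes _ = 1
  ... | _     | _     | _     | _     = 0

edgeMult : ∀ {v} → Factor v → Fin v → Fin v → ℕ
edgeMult C a b = pairCount a b (factorEdges C)

IsCopyOf : ∀ {v} → List ℕ → Factor v → Set
IsCopyOf {v} L C = (map length C ≡ L) × (concat C ↭ allFin v)

mapFactor : ∀ {v} → (Fin v → Fin v) → Factor v → Factor v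
mapFactor g C = map (map g) C

-- a 1-factor of K_v, as a fixed-point-free involution
IsOneFactor : ∀ {v} → (Fin v → Fin v) → Set
IsOneFactor {v} μ = (∀ x → μ (μ x) ≡ x) × (∀ x → μ x ≢ x)

indicator : ∀ {v} → Fin v → Fin v → ℤ
indicator a b with a ≟F b
... | yes _ = + 1
... | no _  = + 0

-- M is the multiplicity function of (K_v)^σ for some 1-factor I'
-- (for σ = 0, M is that of K_v; otherwise M a b = 1 + σ·[ {a,b} ∈ I' ]).
IsKσ : ∀ {v} → ℤ → (Fin v → Fin v → ℤ) → Set
IsKσ {v} σ M =
  ((σ ≡ + 0) × (∀ a b → a ≢ b → M a b ≡ + 1))
  ⊎ ((σ ≢ + 0) × Σ (Fin v → Fin v) λ μ → IsOneFactor μ ×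
       (∀ a b → a ≢ b → M a b ≡ + 1 ℤ.+ σ ℤ.* indicator (μ a) b))

IsFactorization : ∀ {v} → List ℕ → (Fin v → Fin v → ℤ) → List (Factor v) → Set
IsFactorization L M Fs =
  All (IsCopyOf L) Fs ×
  (∀ a b → a ≢ b → + (sum (map (λ C → edgeMult C a b) Fs)) ≡ M a b)

FixedBy : ∀ {v} → List (Fin v → Fin v) → Fin v → Set
FixedBy G x = All (λ g → g x ≡ x) G

fixedBy? : ∀ {v} (G : List (Fin v → Fin v)) (x : Fin v) → Dec (FixedBy G x)
fixedBy? G x = all? (λ g → g x ≟F x) G

-- G (a finite list of maps, elements compared pointwise) is a group of
-- permutations of Fin v
IsPermGroup : ∀ {v} → List (Fin v → Fin v) → Set
IsPermGroup G =
  Any (λ k → ∀ x → k x ≡ x) G ×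
  (∀ {g h} → g ∈ G → h ∈ G → Any (λ k → ∀ x → k x ≡ g (h x)) G) ×
  (∀ {g} → g ∈ G → Any (λ k → ∀ x → k (g x) ≡ x) G)

IsAutGroup : ∀ {v} → List (Factor v) → List (Fin v → Fin v) → Set
IsAutGroup Fs G =
  ∀ {g C} → g ∈ G → C ∈ Fs →
    Any (λ D → ∀ a b → edgeMult (mapFactor g C) a b ≡ edgeMult D a b) Fs

IsFPyramidalGroup : ∀ {v} → ℕ → List (Factor v) → List (Fin v → Fin v) → Set
IsFPyramidalGroup {v} f Fs G =
  IsPermGroup G × IsAutGroup Fs G ×
  (length (filter (fixedBy? G) (allFin v)) ≡ f) ×
  (∀ x y → ¬ FixedBy G x → ¬ FixedBy G y →
     Any (λ g → g x ≡ y) G ×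
     (∀ {g g'} → g ∈ G → g' ∈ G → g x ≡ y → g' x ≡ y → ∀ z → g z ≡ g' z))

HasPyramidalSolution : (v : ℕ) → List ℕ → ℤ → ℕ → Set
HasPyramidalSolution v L σ f =
  Σ (Fin v → Fin v → ℤ) λ M → IsKσ σ M ×
  Σ (List (Factor v)) λ Fs → IsFactorization L M Fs ×
  Σ (List (Fin v → Fin v)) λ G → IsFPyramidalGroup f Fs G

{-# OPTIONS --safe #-}
-- Let f = 1 - σ, h = 2k + f and n = k + Σ ℓ_i.  A graceful labelling, by 0, ..., n - 1, of the disjoint union of a path P
-- with k vertices and the cycles of lengths ℓ_i is doubled in Z_2n: together with its translate by n it is a union of cycles
-- and of two paths, which fixed points or edges {x , x + n} join to a cycle of length h.  Its translates use every difference
-- other than n once, because an edge of difference d contributes ±d.  Changing the sheet along an edge replaces d by n - d;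
-- changing it simultaneously along one edge of a cycle and along the path edge of complementary difference preserves the
-- differences and merges the two copies of the cycle into a cycle of length 2ℓ_i.
--
-- The graceful labelling grows outwards, one cycle at a time and the longest cycle first.  A cycle zigzags between new low
-- and new high labels, except for one edge inside one of the two classes.  The difference of this edge is larger than all
-- earlier ones, and the rest of the new labels is covered by paths with consecutive differences; if N labels have been used
-- and the path ends at distance e from the extreme label, then the new distance is N + e + 1 and the number of labels grows
-- by a factor less than 7.  Paths with consecutive differences and prescribed first label come from Euclid's algorithm.
module Submission where

open import Defs
open import Data.Nat hiding (∣_-_∣)
open import Data.Nat.Properties
open import Data.Nat.DivMod using (_mod_; m%n<n; m<n⇒m%n≡m; m%n%n≡m%n; %-distribˡ-+; [m+n]%n≡m%n; m≡m%n+[m/n]*n; m*n%n≡0)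
open import Data.Nat.Induction using (<-wellFounded)
open import Data.Nat.ListAction using (sum)
open import Data.Nat.ListAction.Properties using (sum-++)
open import Data.Nat.Divisibility using (divides)
open import Data.Nat.Tactic.RingSolver using (solve)
open import Data.Integer as ℤ using (ℤ; +_; -[1+_]; _-_; ∣_∣)
import Data.Integer.Properties as ℤ
import Data.Integer.Tactic.RingSolver as ℤSolver
open import Data.Integer.Divisibility using (_∣_)
open import Data.Bool using (Bool; true; false; if_then_else_; not; _∧_; _∨_)
open import Data.Bool.Properties using (∨-comm; ∧-comm; not-involutive)
open import Data.Fin as Fin using (Fin; toℕ; _↑ˡ_; _↑ʳ_; splitAt)
import Data.Fin.Properties as Fin
open import Data.List using (List; []; _∷_; _++_; map; [_]; tabulate; allFin; reverse; zip; concat; concatMap; length; filter; foldr; drop)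
open import Data.List.Properties using (map-++; ++-assoc; ++-identityʳ; map-∘; map-cong; map-tabulate; tabulate-cong; unfold-reverse; length-map; length-++; length-tabulate; concatMap-cong; concatMap-map; concatMap-++; map-concatMap; concat-map; concat-++; filter-++; filter-all; filter-none; ∷-injective)
open import Data.List.Membership.Propositional using (_∈_)
open import Data.List.Membership.Propositional.Properties using (∈-map⁺; ∈-map⁻; ∈-allFin)
open import Data.List.Relation.Unary.Any as Any using (Any)
open import Data.List.Relation.Unary.All as All using (All)
import Data.List.Relation.Unary.All.Properties as All
open import Data.List.Relation.Binary.Pointwise as Pointwise using (Pointwise)
open import Data.List.Relation.Binary.Permutation.Propositional using (_↭_; ↭-refl; ↭-trans; ↭-sym; ↭-prep; ↭-swap; ↭-reflexive)
open import Data.List.Relation.Binary.Permutation.Propositional.Properties using (++⁺; ++⁺ˡ; ++⁺ʳ; ∷↭∷ʳ; shift; shifts; ++-comm; drop-∷; ↭-reverse; ↭-map-inv; ↭-length; All-resp-↭; ∈-resp-↭; ++-commutativeMonoid) renaming (map⁺ to ↭-map⁺)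
open import Data.Product using (_×_; _,_; proj₁; proj₂; ∃)
open import Data.Sum using (_⊎_; inj₁; inj₂)
open import Data.Empty using (⊥-elim)
open import Relation.Nullary using (¬_; yes; no; does)
open import Relation.Binary.PropositionalEquality hiding ([_])
open import Induction.WellFounded using (Acc; acc)
import Algebra.Solver.CommutativeMonoid as CM

-- An odd cycle is not bipartite, so one of its edges must leave the pattern of consecutive
-- differences. Let m = j + 1 and let N labels be used. The zigzag through m low and m high labels
-- takes the differences N + 1, ..., N + 2m - 1, the path on leaving its old end takes N, and the
-- far vertex is put at 2N + 2m, so that the exceptional edge takes N + 2m. The other edge at the
-- far vertex then has difference 2N + 3m, and the path must skip exactly this one. It arrives there
-- by a whole number of row-column pairs only up to the parity of N + m. Hence two forms of each
-- step, and the odd one needs m < e. Since e grows, starting with the longest cycle secures this. A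
-- path skips a difference by being continued as if it came from a shifted, fictitious column. A
-- complement n - d must lie on the path, so n has to be at least 2N; N + 5e + 3 labels suffice for
-- this and for either parity of the last stretch. After one cycle this number is at most 12m + 9,
-- which is half of 12ℓ + 6 for ℓ = 2m + 1; the other half comes from doubling the path.

module PermSolver {A : Set} = CM (++-commutativeMonoid {A = A})
open PermSolver using (_⊕_; _⊜_) renaming (solve to ↭-solve)


-- Paths with consecutive sums

range : ℕ → ℕ → List ℕ
range a zero = []
range a (suc k) = a ∷ range (suc a) k

range-++ : ∀ a {b} j {k} → b ≡ a + j → range a j ++ range b k ≡ range a (j + k)
range-++ a zero {k} e = cong (λ z → range z k) (trans e (+-identityʳ a))
range-++ a (suc j) e = cong (a ∷_) (range-++ (suc a) j (trans e (+-suc a j)))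

range-∷ʳ : ∀ a k → range a (suc k) ≡ range a k ++ [ a + k ]
range-∷ʳ a k = sym (trans (range-++ a k refl) (cong (range a) (+-comm k 1)))

-- Serves both complements of the proof: `2n - δ` among translations and `n - d` among path
-- differences.
range-reverse : ∀ s a k → range (suc s) k ↭ map (s + (a + k) ∸_) (range a k)
range-reverse s a zero = ↭-refl
range-reverse s a (suc k) = ↭-trans (↭-trans (↭-reflexive (range-∷ʳ (suc s) k)) (++-comm (range (suc s) k) [ suc s + k ]))
  (↭-trans (↭-prep _ (range-reverse s (suc a) k)) (↭-reflexive (cong₂ _∷_
    (sym (trans (cong (_∸ a) (e s a k)) (m+n∸n≡m (suc s + k) a)))
    (map-cong (λ i → cong (λ t → s + t ∸ i) (sym (+-suc a k))) (range (suc a) k)))))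
  where
  e : ∀ s a k → s + (a + suc k) ≡ suc s + k + a
  e s a k = solve (s ∷ a ∷ k ∷ [])

-- A path alternating between rows and columns, as a list of pairs (row , column).  Row r will carry the label
-- -1 - r and column c the label c, so that the edge between them has difference c + r + 1.
Pairs : Set
Pairs = List (ℕ × ℕ)

rows cols : Pairs → List ℕ
rows = map proj₁
cols = map proj₂

chain : ℕ → Pairs → List ℕ
chain p [] = []
chain p ((r , c) ∷ L) = p + r ∷ c + r ∷ chain c L

lastCol : ℕ → Pairs → ℕ
lastCol p [] = p
lastCol p ((r , c) ∷ L) = lastCol c L

chain-++ : ∀ p L M → chain p (L ++ M) ≡ chain p L ++ chain (lastCol p L) M
chain-++ p [] M = refl
chain-++ p ((r , c) ∷ L) M = cong (λ z → p + r ∷ c + r ∷ z) (chain-++ c L M)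

lastCol-++ : ∀ p L M → lastCol p (L ++ M) ≡ lastCol (lastCol p L) M
lastCol-++ p [] M = refl
lastCol-++ p ((r , c) ∷ L) M = lastCol-++ c L M

zigUp : ℕ → ℕ → ℕ → Pairs
zigUp x y zero = []
zigUp x y (suc k) = (x , y) ∷ zigUp (suc x) (suc y) k

rows-zigUp : ∀ x y k → rows (zigUp x y k) ≡ range x k
rows-zigUp x y zero = refl
rows-zigUp x y (suc k) = cong (x ∷_) (rows-zigUp (suc x) (suc y) k)

cols-zigUp : ∀ x y k → cols (zigUp x y k) ≡ range y k
cols-zigUp x y zero = refl
cols-zigUp x y (suc k) = cong (y ∷_) (cols-zigUp (suc x) (suc y) k)

chain-zigUp : ∀ p x k → chain p (zigUp x (suc p) k) ≡ range (p + x) (k * 2)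
chain-zigUp p x zero = refl
chain-zigUp p x (suc k) = cong (λ z → p + x ∷ suc (p + x) ∷ z)
  (trans (chain-zigUp (suc p) (suc x) k) (cong (λ z → range (suc z) (k * 2)) (+-suc p x)))

lastCol-zigUp : ∀ p x k → lastCol p (zigUp x (suc p) k) ≡ p + k
lastCol-zigUp p x zero = sym (+-identityʳ p)
lastCol-zigUp p x (suc k) = trans (lastCol-zigUp (suc p) (suc x) k) (sym (+-suc p k))

zigDown : ℕ → ℕ → ℕ → Pairs
zigDown x y zero = []
zigDown x y (suc k) = (x + k , y + k) ∷ zigDown x y k

range-∷ : ∀ {xs} a k → xs ↭ range a k → a + k ∷ xs ↭ range a (suc k)
range-∷ a k p = ↭-trans (↭-prep _ p) (↭-trans (∷↭∷ʳ (a + k) (range a k)) (↭-reflexive (sym (range-∷ʳ a k))))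

rows-zigDown : ∀ x y k → rows (zigDown x y k) ↭ range x k
rows-zigDown x y zero = ↭-refl
rows-zigDown x y (suc k) = range-∷ x k (rows-zigDown x y k)

cols-zigDown : ∀ x y k → cols (zigDown x y k) ↭ range y k
cols-zigDown x y zero = ↭-refl
cols-zigDown x y (suc k) = range-∷ y k (cols-zigDown x y k)

chain-zigDown : ∀ x y k → chain (y + k) (zigDown x y k) ↭ range (y + x) (k * 2)
chain-zigDown x y zero = ↭-refl
chain-zigDown x y (suc k) =
  ↭-trans (↭-reflexive (cong₂ (λ a b → a ∷ b ∷ chain (y + k) (zigDown x y k)) (e₁ x y k) (e₂ x y k)))
        (range-∷ (y + x) (suc (k * 2)) (range-∷ (y + x) (k * 2) (chain-zigDown x y k)))
  where
  e₁ : ∀ x y k → y + suc k + (x + k) ≡ y + x + suc (k * 2)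
  e₁ x y k = solve (x ∷ y ∷ k ∷ [])
  e₂ : ∀ x y k → y + k + (x + k) ≡ y + x + k * 2
  e₂ x y k = solve (x ∷ y ∷ k ∷ [])

lastCol-zigDown : ∀ x y k → lastCol (y + k) (zigDown x y k) ≡ y
lastCol-zigDown x y zero = +-identityʳ y
lastCol-zigDown x y (suc k) = lastCol-zigDown x y k

-- The path (x + w , col₀) ∷ rest is entered from column p; including the entering edge its sums are consecutive.
record AlphaPath (w w′ p x : ℕ) : Set where
  constructor alphaPath
  field
    col₀  : ℕ
    rest  : Pairs
    rows↭ : x + w ∷ rows rest ↭ range x (suc (w + w′))
    cols↭ : col₀ ∷ cols rest ↭ range (suc (p + w)) (suc (w + w′))
    sums↭ : col₀ + (x + w) ∷ chain col₀ rest ↭ range (suc (p + (x + w))) (suc ((w + w′) * 2))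
    end   : lastCol col₀ rest ≡ p + suc (w + w′)

-- Zigzagging down through the lowest `w + 1` rows and columns ends in column `p + w + 1`, at
-- distance `w` from the largest column used, just as `p` was. What remains is the same problem with
-- `w′ + 1` reduced by `w + 1`.
outerPeel : ∀ w d p x → AlphaPath w d (suc (p + w)) (suc (x + w)) → AlphaPath w (suc (w + d)) p x
outerPeel w d p x (alphaPath c L r↭ c↭ s↭ e) = alphaPath (y + w) (zigDown x y w ++ (suc (x + w) + w , c) ∷ L) rw cl sm en
  where
  y = suc (p + w)
  rw : x + w ∷ rows (zigDown x y w ++ (suc (x + w) + w , c) ∷ L) ↭ range x (suc (w + suc (w + d)))
  rw = ↭-trans (↭-reflexive (cong (x + w ∷_) (map-++ proj₁ (zigDown x y w) _)))
      (↭-trans (++⁺ (range-∷ x w (rows-zigDown x y w)) r↭)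
             (↭-reflexive (range-++ x (suc w) (sym (+-suc x w)))))
  cl : y + w ∷ cols (zigDown x y w ++ (suc (x + w) + w , c) ∷ L) ↭ range y (suc (w + suc (w + d)))
  cl = ↭-trans (↭-reflexive (cong (y + w ∷_) (map-++ proj₂ (zigDown x y w) _)))
      (↭-trans (++⁺ (range-∷ y w (cols-zigDown x y w)) c↭)
             (↭-reflexive (range-++ y (suc w) (sym (+-suc y w)))))
  e₁ : ∀ y w x → y + w + (x + w) ≡ y + x + w * 2
  e₁ y w x = solve (y ∷ w ∷ x ∷ [])
  e₂ : ∀ y w x → y + (suc (x + w) + w) ≡ y + x + suc (w * 2)
  e₂ y w x = solve (y ∷ w ∷ x ∷ [])
  e₃ : ∀ w d → suc (w * 2) + suc (suc ((w + d) * 2)) ≡ suc ((w + suc (w + d)) * 2)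
  e₃ w d = solve (w ∷ d ∷ [])
  e₄ : ∀ p w x → suc (p + w) + x ≡ suc (p + (x + w))
  e₄ p w x = solve (p ∷ w ∷ x ∷ [])
  sm : y + w + (x + w) ∷ chain (y + w) (zigDown x y w ++ (suc (x + w) + w , c) ∷ L) ↭ range (suc (p + (x + w))) (suc ((w + suc (w + d)) * 2))
  sm = ↭-trans (↭-reflexive (cong₂ _∷_ (e₁ y w x) (trans (chain-++ (y + w) (zigDown x y w) _)
                 (cong (λ z → chain (y + w) (zigDown x y w) ++ chain z ((suc (x + w) + w , c) ∷ L)) (lastCol-zigDown x y w)))))
      (↭-trans (++⁺ (range-∷ (y + x) (w * 2) (chain-zigDown x y w)) (↭-prep _ s↭))
             (↭-reflexive (trans (range-++ (y + x) (suc (w * 2)) (e₂ y w x))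
                                 (cong₂ range (e₄ p w x) (e₃ w d)))))
  en : lastCol (y + w) (zigDown x y w ++ (suc (x + w) + w , c) ∷ L) ≡ p + suc (w + suc (w + d))
  en = trans (lastCol-++ (y + w) (zigDown x y w) _) (trans e (e₅ p w d))
    where
    e₅ : ∀ p w d → suc (p + w) + suc (w + d) ≡ p + suc (w + suc (w + d))
    e₅ p w d = solve (p ∷ w ∷ d ∷ [])

-- The zigzag goes up through the highest rows and columns, and the inner path comes after it. Its
-- entry column `p + w′ + 1` is fictitious: the sum lost with that edge is `p + (x + w)`, the sum of
-- the edge entering the whole path. The edge that really enters the inner path takes the first sum
-- after those of the inner path.
innerPeel : ∀ w′ d p x → AlphaPath d w′ (suc (p + w′)) x → AlphaPath (suc (w′ + d)) w′ p x
innerPeel w′ d p x (alphaPath c L r↭ c↭ s↭ e) = alphaPath (y + w) M rw cl sm en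
  where
  w = suc (w′ + d)
  y = suc (p + w)
  M = zigUp (suc (x + w)) (suc (y + w)) w′ ++ (x + d , c) ∷ L
  f₁ : ∀ d w′ → suc (d + w′) ≡ suc (w′ + d)
  f₁ d w′ = solve (d ∷ w′ ∷ [])
  f₂ : ∀ d w′ → suc (w′ + d) + suc w′ ≡ suc (suc (w′ + d) + w′)
  f₂ d w′ = solve (d ∷ w′ ∷ [])
  f₃ : ∀ p d w′ → suc (suc (p + w′) + d) ≡ suc (p + suc (w′ + d))
  f₃ p d w′ = solve (p ∷ d ∷ w′ ∷ [])
  rw : x + w ∷ rows M ↭ range x (suc (w + w′))
  rw = ↭-trans (↭-reflexive (cong (x + w ∷_) (trans (map-++ proj₁ (zigUp (suc (x + w)) (suc (y + w)) w′) _)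
                (cong (_++ (x + d ∷ rows L)) (rows-zigUp (suc (x + w)) (suc (y + w)) w′)))))
      (↭-trans (++-comm (range (x + w) (suc w′)) _)
      (↭-trans (++⁺ʳ _ r↭)
             (↭-reflexive (trans (cong (λ z → range x z ++ range (x + w) (suc w′)) (f₁ d w′))
                          (trans (range-++ x w refl) (cong (range x) (f₂ d w′)))))))
  cl : y + w ∷ cols M ↭ range y (suc (w + w′))
  cl = ↭-trans (↭-reflexive (cong (y + w ∷_) (trans (map-++ proj₂ (zigUp (suc (x + w)) (suc (y + w)) w′) _)
                (cong (_++ (c ∷ cols L)) (cols-zigUp (suc (x + w)) (suc (y + w)) w′)))))
      (↭-trans (++-comm (range (y + w) (suc w′)) _)
      (↭-trans (++⁺ʳ _ c↭)
             (↭-reflexive (trans (cong₂ (λ z₀ z → range z₀ z ++ range (y + w) (suc w′)) (f₃ p d w′) (f₁ d w′))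
                          (trans (range-++ y w refl) (cong (range y) (f₂ d w′)))))))
  Z = range (suc (y + w + (x + w))) (w′ * 2)
  split : chain (y + w) M ≡ Z ++ y + w + w′ + (x + d) ∷ c + (x + d) ∷ chain c L
  split = trans (chain-++ (y + w) (zigUp (suc (x + w)) (suc (y + w)) w′) _)
                (cong₂ (λ a b → a ++ chain b ((x + d , c) ∷ L))
                       (trans (chain-zigUp (y + w) (suc (x + w)) w′) (cong (λ z → range z (w′ * 2)) (+-suc (y + w) (x + w))))
                       (lastCol-zigUp (y + w) (suc (x + w)) w′))
  g₁ : ∀ p x d w′ → suc (suc (p + w′) + (x + d)) ≡ suc (p + (x + suc (w′ + d)))
  g₁ p x d w′ = solve (p ∷ x ∷ d ∷ w′ ∷ [])
  g₂ : ∀ p x d w′ → suc (p + suc (w′ + d)) + suc (w′ + d) + w′ + (x + d) ≡ suc (p + (x + suc (w′ + d))) + suc ((d + w′) * 2)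
  g₂ p x d w′ = solve (p ∷ x ∷ d ∷ w′ ∷ [])
  g₃ : ∀ p x d w′ → suc (p + suc (w′ + d)) + suc (w′ + d) + (x + suc (w′ + d)) ≡ suc (p + (x + suc (w′ + d))) + suc (suc ((d + w′) * 2))
  g₃ p x d w′ = solve (p ∷ x ∷ d ∷ w′ ∷ [])
  g₄ : ∀ d w′ → suc (suc ((d + w′) * 2)) + suc (w′ * 2) ≡ suc ((suc (w′ + d) + w′) * 2)
  g₄ d w′ = solve (d ∷ w′ ∷ [])
  S₀ = suc (p + (x + w))
  k₀ = suc ((d + w′) * 2)
  sm : y + w + (x + w) ∷ chain (y + w) M ↭ range S₀ (suc ((w + w′) * 2))
  sm = ↭-trans (↭-reflexive (cong (y + w + (x + w) ∷_) split))
      (↭-trans (++-comm (range (y + w + (x + w)) (suc (w′ * 2))) _)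
      (↭-trans (++⁺ʳ _ (↭-prep _ s↭))
      (↭-trans (++⁺ʳ _ (↭-trans (↭-reflexive (cong₂ _∷_ (g₂ p x d w′) (cong (λ z → range z k₀) (g₁ p x d w′)))) (range-∷ S₀ k₀ ↭-refl)))
             (↭-reflexive (trans (range-++ S₀ (suc k₀) (g₃ p x d w′)) (cong (range S₀) (g₄ d w′)))))))
  en : lastCol (y + w) M ≡ p + suc (w + w′)
  en = trans (lastCol-++ (y + w) (zigUp (suc (x + w)) (suc (y + w)) w′) _) (trans e (h p d w′))
    where
    h : ∀ p d w′ → suc (p + w′) + suc (d + w′) ≡ p + suc (suc (w′ + d) + w′)
    h p d w′ = solve (p ∷ d ∷ w′ ∷ [])

-- Subtraction cannot go on, as `w′ + 1` must stay positive. Two rising zigzags are joined through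
-- the top row and the lowest column: the edge between these fills the gap between the sums of the
-- zigzags, and the edge before it has the largest sum.
centrePath : ∀ w p x → AlphaPath w w p x
centrePath zero p x = alphaPath (suc (p + 0)) []
  (↭-reflexive (cong [_] (+-identityʳ x))) ↭-refl
  (↭-reflexive (cong [_] (e p x)))
  (trans (cong suc (+-identityʳ p)) (sym (+-comm p 1)))
  where
  e : ∀ p x → suc (p + 0) + (x + 0) ≡ suc (p + (x + 0))
  e p x = solve (p ∷ x ∷ [])
centrePath (suc u) p x = alphaPath (suc (y + w)) M rw cl sm en
  where
  w = suc u
  y = suc (p + w)
  M₁ = zigUp (suc (x + w)) (suc (suc (y + w))) u
  M₂ = zigUp x (suc y) w
  M = M₁ ++ (x + w + w , y) ∷ M₂
  rw : x + w ∷ rows M ↭ range x (suc (w + w))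
  rw = ↭-trans (↭-reflexive (cong (x + w ∷_) (trans (map-++ proj₁ M₁ _)
                (cong₂ (λ a b → a ++ x + w + w ∷ b) (rows-zigUp (suc (x + w)) _ u) (rows-zigUp x (suc y) w)))))
      (↭-trans (++-comm (range (x + w) w) (x + w + w ∷ range x w))
      (↭-trans (↭-prep _ (↭-reflexive (range-++ x w refl)))
      (↭-trans (↭-reflexive (cong (_∷ range x (w + w)) (+-assoc x w w))) (range-∷ x (w + w) ↭-refl))))
  cl : suc (y + w) ∷ cols M ↭ range y (suc (w + w))
  cl = ↭-trans (↭-reflexive (cong (suc (y + w) ∷_) (trans (map-++ proj₂ M₁ _)
                (cong₂ (λ a b → a ++ y ∷ b) (cols-zigUp (suc (x + w)) _ u) (cols-zigUp x (suc y) w)))))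
      (↭-trans (++-comm (range (suc (y + w)) w) (range y (suc w)))
             (↭-reflexive (range-++ y (suc w) (sym (+-suc y w)))))
  lst : lastCol (suc (y + w)) M₁ ≡ suc (y + w) + u
  lst = lastCol-zigUp (suc (y + w)) (suc (x + w)) u
  split : chain (suc (y + w)) M ≡ range (suc (y + w) + suc (x + w)) (u * 2) ++ suc (y + w) + u + (x + w + w) ∷ y + (x + w + w) ∷ range (y + x) (w * 2)
  split = trans (chain-++ (suc (y + w)) M₁ _)
                (cong₂ _++_ (chain-zigUp (suc (y + w)) (suc (x + w)) u)
                   (cong₂ (λ a b → a + (x + w + w) ∷ y + (x + w + w) ∷ b) lst (chain-zigUp y x w)))
  B = y + x
  g₁ : ∀ y w x → suc (y + w) + (x + w) ≡ y + x + suc (w * 2)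
  g₁ y w x = solve (y ∷ w ∷ x ∷ [])
  g₂ : ∀ y w x → suc (y + w) + suc (x + w) ≡ suc (y + x + suc (w * 2))
  g₂ y w x = solve (y ∷ w ∷ x ∷ [])
  g₃ : ∀ y u x → suc (y + suc u) + u + (x + suc u + suc u) ≡ y + x + suc (suc u * 2) + suc (u * 2)
  g₃ y u x = solve (y ∷ u ∷ x ∷ [])
  g₄ : ∀ y w x → y + (x + w + w) ≡ y + x + w * 2
  g₄ y w x = solve (y ∷ w ∷ x ∷ [])
  g₅ : ∀ p w x → suc (p + w) + x ≡ suc (p + (x + w))
  g₅ p w x = solve (p ∷ w ∷ x ∷ [])
  g₆ : ∀ u → suc (suc u * 2) + suc (suc (u * 2)) ≡ suc ((suc u + suc u) * 2)
  g₆ u = solve (u ∷ [])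
  sm : suc (y + w) + (x + w) ∷ chain (suc (y + w)) M ↭ range (suc (p + (x + w))) (suc ((w + w) * 2))
  sm = ↭-trans (↭-reflexive (trans (cong (suc (y + w) + (x + w) ∷_) split)
              (cong₂ _++_ (cong₂ _∷_ (g₁ y w x) (cong (λ z → range z (u * 2)) (g₂ y w x)))
                          (cong₂ (λ a b → a ∷ b ∷ range B (w * 2)) (g₃ y u x) (g₄ y w x)))))
      (↭-trans (↭-solve 4 (λ a b c d → (a ⊕ (b ⊕ (c ⊕ d))) ⊜ ((c ⊕ d) ⊕ (b ⊕ a))) ↭-refl
                (range (B + suc (w * 2)) (suc (u * 2))) [ B + suc (w * 2) + suc (u * 2) ] [ B + w * 2 ] (range B (w * 2)))
      (↭-trans (++⁺ (range-∷ B (w * 2) ↭-refl) (range-∷ (B + suc (w * 2)) (suc (u * 2)) ↭-refl))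
             (↭-reflexive (trans (range-++ B (suc (w * 2)) refl) (cong₂ range (g₅ p w x) (g₆ u))))))
  en : lastCol (suc (y + w)) M ≡ p + suc (w + w)
  en = trans (lastCol-++ (suc (y + w)) M₁ _) (trans (lastCol-zigUp y x w) (h p w))
    where
    h : ∀ p w → suc (p + w) + w ≡ p + suc (w + w)
    h p w = solve (p ∷ w ∷ [])

-- Euclid's algorithm on w + 1 and w′ + 1; when these agree, centrePath is explicit.
alphaPath-exists : ∀ w w′ p x → AlphaPath w w′ p x
alphaPath-exists w w′ = go w w′ (<-wellFounded (w + w′))
  where
  go : ∀ w w′ → Acc _<_ (w + w′) → ∀ p x → AlphaPath w w′ p x
  go w w′ (acc rs) p x with compare w w′
  ... | less .w d = outerPeel w d p x (go w d (rs (lt w d)) _ _)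
    where
    lt : ∀ w d → w + d < w + suc (w + d)
    lt w d rewrite +-suc w (w + d) = s≤s (m≤n+m (w + d) w)
  ... | equal .w = centrePath w p x
  ... | greater .w′ d = innerPeel w′ d p x (go d w′ (rs (lt w′ d)) _ _)
    where
    lt : ∀ w′ d → d + w′ < suc (w′ + d) + w′
    lt w′ d rewrite +-comm d w′ = s≤s (m≤m+n (w′ + d) w′)

-- Labelled paths and cycles

-- The last part of a path once the rows below z and the columns below u are used up.  Row z is kept for its last
-- vertex, and column u + a is left out: it becomes the far vertex of a cycle.
record Tail (p o a z : ℕ) : Set where
  constructor tailPath
  u = suc (p + o)
  b = suc (o + a)
  field
    col₀  : ℕ
    rest  : Pairs
    rows↭ : z ∷ suc z + o ∷ rows rest ↭ range z (suc (a + b))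
    cols↭ : u + a ∷ col₀ ∷ cols rest ↭ range u (a + suc b)
    sums↭ : lastCol col₀ rest + z ∷ col₀ + (suc z + o) ∷ chain col₀ rest ↭ range (suc (u + z)) ((a + b) * 2)

-- For a triangle as the longest cycle: then `a = 0`, and there is no room for the first of the two
-- paths in `tail₊`.
tail₀ : ∀ p z → Tail p 0 0 z
tail₀ p z = tailPath (suc (suc (p + 0))) []
  (↭-reflexive (cong (λ t → z ∷ t ∷ []) (+-identityʳ (suc z))))
  (↭-reflexive (cong (λ t → t ∷ suc (suc (p + 0)) ∷ []) (+-identityʳ _)))
  (↭-reflexive (cong (λ t → suc (suc (p + 0)) + z ∷ t ∷ []) (e p z)))
  where
  e : ∀ p z → suc (suc (p + 0)) + (suc z + 0) ≡ suc (suc (suc (p + 0)) + z)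
  e p z = solve (p ∷ z ∷ [])

-- Two paths in succession, both with offset `o`, because the first ends at distance `o` from its
-- largest column. Leaving out column `u + a` makes the sum of the edge between them one smaller
-- than the second path presupposes. The sum freed in this way is that of the closing edge to row
-- `z`, which forces `b = o + a + 1`.
tail₊ : ∀ p o w z → Tail p o (suc (o + w)) z
tail₊ p o w z with alphaPath-exists o w p (suc z) | alphaPath-exists o (suc (o + w)) (suc (p + suc (o + w))) (suc z + suc (o + w))
... | alphaPath c L r↭ c↭ s↭ end | alphaPath c′ L′ r′↭ c′↭ s′↭ end′ =
  tailPath c (L ++ (x + o , c′) ∷ L′) rw cl sm
  where
  a = suc (o + w)
  b = suc (o + a)
  u = suc (p + o)
  x = suc z + a
  rw : z ∷ suc z + o ∷ rows (L ++ (x + o , c′) ∷ L′) ↭ range z (suc (a + b))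
  rw = ↭-prep z (↭-trans (↭-reflexive (cong (suc z + o ∷_) (map-++ proj₁ L _)))
        (↭-trans (++⁺ r↭ r′↭) (↭-reflexive (range-++ (suc z) a refl))))
  f₁ : ∀ p o w → suc (suc (p + suc (o + w)) + o) ≡ suc (p + o) + suc (suc (o + w))
  f₁ p o w = solve (p ∷ o ∷ w ∷ [])
  f₂ : ∀ o w → suc (suc (o + w)) + suc (o + suc (o + w)) ≡ suc (o + w) + suc (suc (o + suc (o + w)))
  f₂ o w = solve (o ∷ w ∷ [])
  cl : u + a ∷ c ∷ cols (L ++ (x + o , c′) ∷ L′) ↭ range u (a + suc b)
  cl = ↭-trans (↭-prep (u + a) (↭-trans (↭-reflexive (cong (c ∷_) (map-++ proj₂ L _))) (++⁺ c↭ c′↭)))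
       (↭-trans (++⁺ʳ _ (range-∷ u a ↭-refl))
       (↭-reflexive (trans (range-++ u (suc a) (f₁ p o w)) (cong (range u) (f₂ o w)))))
  s₁ : ∀ p o w z → p + suc (o + w) + (suc z + suc (o + w) + o) ≡ suc (suc (p + o) + z) + suc ((o + w) * 2)
  s₁ p o w z = solve (p ∷ o ∷ w ∷ z ∷ [])
  s₂ : ∀ p o w z → suc (p + suc (o + w)) + suc (o + suc (o + w)) + z ≡ suc (suc (p + o) + z) + suc (suc ((o + w) * 2))
  s₂ p o w z = solve (p ∷ o ∷ w ∷ z ∷ [])
  s₃ : ∀ p o w z → suc (suc (p + suc (o + w)) + (suc z + suc (o + w) + o)) ≡ suc (suc (p + o) + z) + suc (suc (suc ((o + w) * 2)))
  s₃ p o w z = solve (p ∷ o ∷ w ∷ z ∷ [])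
  s₄ : ∀ o w → suc (suc (suc ((o + w) * 2))) + suc ((o + suc (o + w)) * 2) ≡ (suc (o + w) + suc (o + suc (o + w))) * 2
  s₄ o w = solve (o ∷ w ∷ [])
  s₅ : ∀ p o z → suc (p + (suc z + o)) ≡ suc (suc (p + o) + z)
  s₅ p o z = solve (p ∷ o ∷ z ∷ [])
  C = suc (u + z)
  k = suc ((o + w) * 2)
  split : chain c (L ++ (x + o , c′) ∷ L′) ≡ chain c L ++ [ p + a + (x + o) ] ++ (c′ + (x + o) ∷ chain c′ L′)
  split = trans (chain-++ c L _) (cong (λ t → chain c L ++ t + (x + o) ∷ c′ + (x + o) ∷ chain c′ L′) end)
  sm : lastCol c (L ++ (x + o , c′) ∷ L′) + z ∷ c + (suc z + o) ∷ chain c (L ++ (x + o , c′) ∷ L′) ↭ range C ((a + b) * 2)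
  sm = ↭-trans (↭-reflexive (cong₂ (λ l t → l + z ∷ c + (suc z + o) ∷ t) (trans (lastCol-++ c L _) end′) split))
       (↭-trans (↭-solve 4 (λ l d e f → (l ⊕ (d ⊕ (e ⊕ f))) ⊜ ((l ⊕ (e ⊕ d)) ⊕ f)) ↭-refl
                  [ suc (p + a) + b + z ] (c + (suc z + o) ∷ chain c L) [ p + a + (x + o) ] (c′ + (x + o) ∷ chain c′ L′))
       (↭-trans (++⁺ (↭-prep _ (↭-prep _ s↭)) s′↭)
       (↭-trans (++⁺ʳ _ (↭-trans (↭-reflexive (cong₂ _∷_ (s₂ p o w z) (cong₂ _∷_ (s₁ p o w z) (cong (λ t → range t k) (s₅ p o z)))))
                         (range-∷ C (suc k) (range-∷ C k ↭-refl))))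
                (↭-reflexive (trans (range-++ C (suc (suc k)) (s₃ p o w z)) (cong (range C) (s₄ o w)))))))

infix 7 _gap_
_gap_ : ℤ → ℤ → ℕ
x gap y = ℤ.∣ x ℤ.- y ∣

gap-comm : ∀ x y → x gap y ≡ y gap x
gap-comm = ℤ.∣i-j∣≡∣j-i∣

steps : ℤ → List ℤ → List ℕ
steps x [] = []
steps x (y ∷ ys) = x gap y ∷ steps y ys

Cycle : Set
Cycle = ℤ × ℤ × List ℤ

verts : Cycle → List ℤ
verts (x , y , r) = x ∷ y ∷ r

cycleSteps : Cycle → List ℕ
cycleSteps (x , y , r) = steps x (y ∷ r ++ [ x ])

-- A graceful labelling of a path and odd cycles with labels 0..N-1.  The path ends in the vertex q, which is
-- at distance e from the largest label; a cycle of length 2j+3 is recorded as j.  The extra 0 in steps↭ stands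
-- for the missing difference.
record Layout (js : List ℕ) (N e : ℕ) : Set where
  field
    q       : ℕ
    q+e     : q + suc e ≡ N
    path    : List ℤ
    cycles  : List Cycle
    lengths : map (λ c → length (proj₂ (proj₂ c))) cycles ≡ map (λ j → suc (j * 2)) js
    verts↭  : + q ∷ path ++ concatMap verts cycles ↭ map +_ (range 0 N)
    steps↭  : 0 ∷ steps (+ q) path ++ concatMap cycleSteps cycles ↭ range 0 N

-- Row `r`, labelled `-1 - r`, goes to `B + r`, and `B` columns go to `0, ..., B - 1` in reverse.
reflect : ℕ → ℤ → ℤ
reflect B x = + B ℤ.- (+ 1 ℤ.+ x)

gap-reflect : ∀ B x y → reflect B x gap reflect B y ≡ x gap y
gap-reflect B x y = trans (cong ℤ.∣_∣ (e (+ B) x y)) (gap-comm y x)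
  where
  e : ∀ b x y → (b ℤ.- (+ 1 ℤ.+ x)) ℤ.- (b ℤ.- (+ 1 ℤ.+ y)) ≡ y ℤ.- x
  e = ℤSolver.solve-∀

steps-reflect : ∀ B x ys → steps (reflect B x) (map (reflect B) ys) ≡ steps x ys
steps-reflect B x [] = refl
steps-reflect B x (y ∷ ys) = cong₂ _∷_ (gap-reflect B x y) (steps-reflect B y ys)

reflectCycle : ℕ → Cycle → Cycle
reflectCycle B (x , y , r) = reflect B x , reflect B y , map (reflect B) r

cycleSteps-reflect : ∀ B c → cycleSteps (reflectCycle B c) ≡ cycleSteps c
cycleSteps-reflect B (x , y , r) = trans (cong (λ t → steps (reflect B x) (reflect B y ∷ t)) (sym (map-++ (reflect B) r [ x ])))
                                         (steps-reflect B x (y ∷ r ++ [ x ]))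

reflect-row : ∀ B r → reflect B -[1+ r ] ≡ + (B + r)
reflect-row B r = e (+ B) (+ r)
  where
  e : ∀ b r → b ℤ.- (+ 1 ℤ.+ ℤ.- (+ 1 ℤ.+ r)) ≡ b ℤ.+ r
  e = ℤSolver.solve-∀

reflect-rows : ∀ B r k → map (reflect B) (map -[1+_] (range r k)) ≡ map +_ (range (B + r) k)
reflect-rows B r zero = refl
reflect-rows B r (suc k) = cong₂ _∷_ (reflect-row B r) (trans (reflect-rows B (suc r) k) (cong (λ t → map +_ (range t k)) (+-suc B r)))

reflect-cols : ∀ B a k → a + k ≡ B → map (reflect B) (map +_ (range a k)) ↭ map +_ (range 0 k)
reflect-cols B a zero _ = ↭-refl
reflect-cols B a (suc k) e = ↭-trans (↭-reflexive (cong (_∷ map (reflect B) (map +_ (range (suc a) k))) (trans (cong (λ t → reflect t (+ a)) (sym e)) (h (+ a) (+ k)))))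
  (↭-trans (↭-prep _ (reflect-cols B (suc a) k (trans (sym (+-suc a k)) e)))
           (↭-map⁺ +_ (range-∷ 0 k ↭-refl)))
  where
  h : ∀ a k → (a ℤ.+ (+ 1 ℤ.+ k)) ℤ.- (+ 1 ℤ.+ a) ≡ k
  h = ℤSolver.solve-∀

-- The path now ends in a row. Turning the labelling upside down puts the rows on top, so that the
-- next cycle again finds a path ending near the largest label.
reflectLayout : ∀ {js} B R z e → z + suc e ≡ R → (path : List ℤ) (cycles : List Cycle) →
  map (λ c → length (proj₂ (proj₂ c))) cycles ≡ map (λ j → suc (j * 2)) js →
  -[1+ z ] ∷ path ++ concatMap verts cycles ↭ map -[1+_] (range 0 R) ++ map +_ (range 0 B) →
  0 ∷ steps -[1+ z ] path ++ concatMap cycleSteps cycles ↭ range 0 (B + R) →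
  Layout js (B + R) e
reflectLayout B R z e eq path cycles len v↭ s↭ = record
  { q = B + z
  ; q+e = trans (+-assoc B z (suc e)) (cong (λ t → B + t) eq)
  ; path = map (reflect B) path
  ; cycles = map (reflectCycle B) cycles
  ; lengths = trans (sym (map-∘ cycles)) (trans (map-cong (λ c → length-map (reflect B) (proj₂ (proj₂ c))) cycles) len)
  ; verts↭ = ↭-trans (↭-reflexive (trans (cong₂ (λ a b → a ∷ map (reflect B) path ++ b) (sym (reflect-row B z)) (vs cycles))
                                          (sym (map-++ (reflect B) (-[1+ z ] ∷ path) (concatMap verts cycles)))))
            (↭-trans (↭-map⁺ (reflect B) v↭)
            (↭-trans (↭-reflexive (map-++ (reflect B) (map -[1+_] (range 0 R)) _))
            (↭-trans (++-comm (map (reflect B) (map -[1+_] (range 0 R))) _)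
            (↭-trans (++⁺ (reflect-cols B 0 B refl) (↭-reflexive (reflect-rows B 0 R)))
                     (↭-reflexive (trans (sym (map-++ +_ (range 0 B) _)) (cong (λ t → map +_ t) (range-++ 0 B (+-identityʳ B)))))))))
  ; steps↭ = ↭-trans (↭-reflexive (cong (0 ∷_) (cong₂ _++_
                (trans (cong (λ t → steps t (map (reflect B) path)) (sym (reflect-row B z))) (steps-reflect B -[1+ z ] path))
                (trans (concatMap-map cycleSteps (reflectCycle B) cycles) (concatMap-cong (cycleSteps-reflect B) cycles))))) s↭
  }
  where
  vs : ∀ cs → concatMap verts (map (reflectCycle B) cs) ≡ map (reflect B) (concatMap verts cs)
  vs cs = trans (concatMap-map verts (reflectCycle B) cs) (sym (map-concatMap (reflect B) verts cs))

-- A layout lists its path from the free end inwards, so the part added at `q` is prepended in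
-- reverse order.
unroll : ℕ → Pairs → List ℤ → List ℤ
unroll q [] P = P
unroll q ((r , c) ∷ L) P = unroll c L (-[1+ r ] ∷ + q ∷ P)

col-gap-row : ∀ c r → (+ c) gap -[1+ r ] ≡ suc (c + r)
col-gap-row c r = +-suc c r

row-gap-col : ∀ r c → -[1+ r ] gap (+ c) ≡ suc (c + r)
row-gap-col r c = trans (gap-comm -[1+ r ] (+ c)) (col-gap-row c r)

steps-unroll : ∀ q L P → steps (+ lastCol q L) (unroll q L P) ↭ map suc (chain q L) ++ steps (+ q) P
steps-unroll q [] P = ↭-refl
steps-unroll q ((r , c) ∷ L) P = ↭-trans (steps-unroll c L (-[1+ r ] ∷ + q ∷ P))
  (↭-trans (↭-reflexive (cong₂ (λ a b → map suc (chain c L) ++ a ∷ b ∷ steps (+ q) P) (col-gap-row c r) (row-gap-col r q)))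
           (↭-solve 4 (λ l a b s → (l ⊕ (a ⊕ (b ⊕ s))) ⊜ (b ⊕ (a ⊕ (l ⊕ s)))) ↭-refl (map suc (chain c L)) [ suc (c + r) ] [ suc (q + r) ] (steps (+ q) P)))

verts-unroll : ∀ q L P → + lastCol q L ∷ unroll q L P ↭ map -[1+_] (rows L) ++ map +_ (cols L) ++ + q ∷ P
verts-unroll q [] P = ↭-refl
verts-unroll q ((r , c) ∷ L) P = ↭-trans (verts-unroll c L (-[1+ r ] ∷ + q ∷ P))
  (↭-solve 5 (λ rs cs c r s → (rs ⊕ (cs ⊕ (c ⊕ (r ⊕ s)))) ⊜ (r ⊕ (rs ⊕ (c ⊕ (cs ⊕ s))))) ↭-refl
     (map -[1+_] (rows L)) (map +_ (cols L)) [ + c ] [ -[1+ r ] ] (+ q ∷ P))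

-- A cycle zigzags through equally many columns and rows and is closed by the far vertex F.
zigzag : ℕ → ℕ → ℕ → ℤ → List ℤ
zigzag c r zero F = [ F ]
zigzag c r (suc k) F = + c ∷ -[1+ r ] ∷ zigzag (suc c) (suc r) k F

length-zigzag : ∀ c r k F → length (zigzag c r k F) ≡ suc (k * 2)
length-zigzag c r zero F = refl
length-zigzag c r (suc k) F = cong (λ t → suc (suc t)) (length-zigzag (suc c) (suc r) k F)

verts-zigzag : ∀ c r k F → zigzag c r k F ↭ map -[1+_] (range r k) ++ map +_ (range c k) ++ [ F ]
verts-zigzag c r zero F = ↭-refl
verts-zigzag c r (suc k) F = ↭-trans (↭-prep _ (↭-prep _ (verts-zigzag (suc c) (suc r) k F)))
  (↭-solve 5 (λ rs cs c r s → (c ⊕ (r ⊕ (rs ⊕ (cs ⊕ s)))) ⊜ (r ⊕ (rs ⊕ (c ⊕ (cs ⊕ s))))) ↭-refl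
     (map -[1+_] (range (suc r) k)) (map +_ (range (suc c) k)) [ + c ] [ -[1+ r ] ] [ F ])

steps-zigzag : ∀ c r k F G → steps -[1+ r ] (zigzag (suc c) (suc r) k (+ F) ++ [ G ]) ≡ range (suc (suc (c + r))) (k * 2) ++ suc (F + (r + k)) ∷ (+ F) gap G ∷ []
steps-zigzag c r zero F G = cong (_∷ (+ F) gap G ∷ []) (trans (row-gap-col r F) (cong (λ t → suc (F + t)) (sym (+-identityʳ r))))
steps-zigzag c r (suc k) F G = cong₂ _∷_ (row-gap-col r (suc c)) (cong₂ _∷_ (trans (col-gap-row (suc c) (suc r)) (cong suc (cong suc (+-suc c r))))
  (trans (steps-zigzag (suc c) (suc r) k F G) (cong₂ (λ a b → range (suc (suc (suc a))) (k * 2) ++ suc (F + b) ∷ (+ F) gap G ∷ []) (+-suc c r) (sym (+-suc r k)))))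

-- Adding a cycle

map-suc-range : ∀ a k → map suc (range a k) ≡ range (suc a) k
map-suc-range a zero = refl
map-suc-range a (suc k) = cong (suc a ∷_) (map-suc-range (suc a) k)

+-gap : ∀ F N k → F ≡ N + k → (+ F) gap (+ N) ≡ k
+-gap .(N + k) N k refl = cong ℤ.∣_∣ (e (+ N) (+ k))
  where
  e : ∀ n k → (n ℤ.+ k) ℤ.- n ≡ k
  e = ℤSolver.solve-∀

-- The edge to the far vertex and the first edge of the tail share the differences u + z and u + z + 1.
attachTail : ∀ {js} j N p o a z (T : Tail p o a z) (κ : ℕ) (P : List ℤ) (cs : List Cycle) →
  let u = suc (p + o); F = u + a; b = suc (o + a) in
  map (λ c → length (proj₂ (proj₂ c))) cs ≡ map (λ j → suc (j * 2)) js →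
  + κ ∷ P ++ concatMap verts cs ++ map -[1+_] (range 0 (suc j)) ++ map +_ (range N (suc j))
    ↭ map -[1+_] (range 0 z) ++ map +_ (range 0 u) →
  0 ∷ steps (+ κ) P ++ concatMap cycleSteps cs ++ range (suc N) (suc (j * 2)) ++ [ (+ F) gap (+ N) ] ↭ range 0 (u + z) →
  suc (F + j) ∷ suc (κ + (suc z + o)) ∷ [] ↭ range (u + z) 2 →
  Layout (j ∷ js) ((u + (a + suc b)) + (z + suc (a + b))) (a + b)
attachTail j N p o a z (tailPath c L r↭ c↭ t↭) κ P cs len v↭ s↭ two↭ =
  reflectLayout (u + (a + suc b)) (z + suc (a + b)) z (a + b) refl (+ lastCol κ M ∷ unroll κ M P) (C ∷ cs)
    (cong₂ _∷_ (length-zigzag (suc N) 1 j (+ F)) len) vs ss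
  where
  u = suc (p + o)
  F = u + a
  b = suc (o + a)
  M = (suc z + o , c) ∷ L
  C : Cycle
  C = + N , -[1+ 0 ] , zigzag (suc N) 1 j (+ F)
  vs : -[1+ z ] ∷ (+ lastCol κ M ∷ unroll κ M P) ++ concatMap verts (C ∷ cs)
       ↭ map -[1+_] (range 0 (z + suc (a + b))) ++ map +_ (range 0 (u + (a + suc b)))
  vs = ↭-trans (↭-prep _ (++⁺ (verts-unroll κ M P) (++⁺ʳ (concatMap verts cs) (↭-prep (+ N) (↭-prep -[1+ 0 ] (verts-zigzag (suc N) 1 j (+ F)))))))
      (↭-trans (↭-solve 10 (λ z rL cL κP N0 r0 Rj Cj F csv →
          (z ⊕ ((rL ⊕ (cL ⊕ κP)) ⊕ ((N0 ⊕ (r0 ⊕ (Rj ⊕ (Cj ⊕ F)))) ⊕ csv)))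
          ⊜ ((κP ⊕ (csv ⊕ ((r0 ⊕ Rj) ⊕ (N0 ⊕ Cj)))) ⊕ ((z ⊕ rL) ⊕ (F ⊕ cL)))) ↭-refl
          [ -[1+ z ] ] (map -[1+_] (rows M)) (map +_ (cols M)) (+ κ ∷ P) [ + N ] [ -[1+ 0 ] ]
          (map -[1+_] (range 1 j)) (map +_ (range (suc N) j)) [ + F ] (concatMap verts cs))
      (↭-trans (++⁺ v↭′ (++⁺ (↭-map⁺ -[1+_] r↭) (↭-map⁺ +_ c↭)))
      (↭-trans (↭-solve 4 (λ a b c d → ((a ⊕ b) ⊕ (c ⊕ d)) ⊜ ((a ⊕ c) ⊕ (b ⊕ d))) ↭-refl
          (map -[1+_] (range 0 z)) (map +_ (range 0 u)) (map -[1+_] (range z (suc (a + b)))) (map +_ (range u (a + suc b))))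
      (↭-reflexive (cong₂ _++_
          (trans (sym (map-++ -[1+_] (range 0 z) _)) (cong (map -[1+_]) (range-++ 0 z refl)))
          (trans (sym (map-++ +_ (range 0 u) _)) (cong (λ t → map +_ t) (range-++ 0 u refl))))))))
    where
    v↭′ : (+ κ ∷ P) ++ concatMap verts cs ++ (-[1+ 0 ] ∷ map -[1+_] (range 1 j)) ++ (+ N ∷ map +_ (range (suc N) j))
          ↭ map -[1+_] (range 0 z) ++ map +_ (range 0 u)
    v↭′ = v↭
  cyc : cycleSteps C ≡ range (suc N) (suc (j * 2)) ++ suc (F + j) ∷ (+ F) gap (+ N) ∷ []
  cyc = trans (cong₂ _∷_ (col-gap-row N 0) (steps-zigzag N 0 j F (+ N)))
              (cong (λ t → range (suc t) (suc (j * 2)) ++ suc (F + j) ∷ (+ F) gap (+ N) ∷ []) (+-identityʳ N))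
  e₁ : ∀ u z a b → u + z + (2 + (a + b) * 2) ≡ u + (a + suc b) + (z + suc (a + b))
  e₁ u z a b = solve (u ∷ z ∷ a ∷ b ∷ [])
  ss : 0 ∷ steps -[1+ z ] (+ lastCol κ M ∷ unroll κ M P) ++ concatMap cycleSteps (C ∷ cs)
       ↭ range 0 ((u + (a + suc b)) + (z + suc (a + b)))
  ss = ↭-trans (↭-prep 0 (++⁺ (↭-trans (↭-reflexive (cong (_∷ steps (+ lastCol κ M) (unroll κ M P)) (row-gap-col z (lastCol κ M))))
                                        (↭-prep _ (steps-unroll κ M P)))
                              (↭-reflexive (cong (_++ concatMap cycleSteps cs) cyc))))
      (↭-trans (↭-solve 9 (λ O x en t s r l f cc →
          (O ⊕ ((x ⊕ ((en ⊕ t) ⊕ s)) ⊕ ((r ⊕ (l ⊕ f)) ⊕ cc)))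
          ⊜ ((O ⊕ (s ⊕ (cc ⊕ (r ⊕ f)))) ⊕ ((l ⊕ en) ⊕ (x ⊕ t)))) ↭-refl
          [ 0 ] [ suc (lastCol κ M + z) ] [ suc (κ + (suc z + o)) ] (map suc (c + (suc z + o) ∷ chain c L)) (steps (+ κ) P)
          (range (suc N) (suc (j * 2))) [ suc (F + j) ] [ (+ F) gap (+ N) ] (concatMap cycleSteps cs))
      (↭-trans (++⁺ s↭ (++⁺ two↭ (↭-trans (↭-map⁺ suc t↭) (↭-reflexive (map-suc-range (suc (u + z)) ((a + b) * 2))))))
      (↭-reflexive (trans (cong (range 0 (u + z) ++_) (range-++ (u + z) 2 (+-comm 2 (u + z))))
                   (trans (range-++ 0 (u + z) refl) (cong (range 0) (e₁ u z a b)))))))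

module _ (j k : ℕ) where
  private
    m = suc j

  -- Nothing has been used yet: the cycle takes 1, ..., 2m - 1, its exceptional edge 2m because
  -- `F = 2m`, and the other edge at `F` takes 3m. Before that the path must supply 2m + 1, ..., 3m
  -- - 1. For odd m these are `2k` edges, so it starts in column m.
  baseOdd : j ≡ k * 2 → (T : Tail (m + k) 0 k (m + k)) → Layout (j ∷ []) (5 * m + 2) m
  baseOdd eq T = subst₂ (Layout (j ∷ [])) (e₁ j k eq) (e₂ j k eq)
    (attachTail {[]} j 0 (m + k) 0 k (m + k) T (m + k) (unroll m L []) [] refl
      (↭-trans (++⁺ʳ _ (↭-trans (↭-reflexive (cong (λ t → + t ∷ unroll m L []) (sym (lastCol-zigUp m m k)))) (verts-unroll m L [])))
      (↭-trans (↭-reflexive (cong₂ (λ a b → (map -[1+_] a ++ map +_ b ++ [ + m ]) ++ map -[1+_] (range 0 m) ++ map +_ (range 0 m)) (rows-zigUp m (suc m) k) (cols-zigUp m (suc m) k)))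
      (↭-trans (↭-solve 5 (λ a b c d e → ((a ⊕ (b ⊕ c)) ⊕ (d ⊕ e)) ⊜ ((d ⊕ a) ⊕ (e ⊕ (c ⊕ b)))) ↭-refl
          (map -[1+_] (range m k)) (map +_ (range (suc m) k)) [ + m ] (map -[1+_] (range 0 m)) (map +_ (range 0 m)))
      (↭-reflexive (cong₂ _++_
          (trans (sym (map-++ -[1+_] (range 0 m) _)) (cong (map -[1+_]) (range-++ 0 m refl)))
          (trans (sym (map-++ +_ (range 0 m) _)) (cong (λ t → map +_ t) (trans (range-++ 0 m {suc k} refl) (cong (range 0) (e₃ j k))))))))))
      (↭-trans (↭-prep 0 (++⁺ʳ _ (↭-trans (↭-reflexive (cong (λ t → steps (+ t) (unroll m L [])) (sym (lastCol-zigUp m m k)))) (steps-unroll m L []))))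
      (↭-trans (↭-reflexive (cong₂ (λ a b → 0 ∷ (a ++ []) ++ range 1 (suc (j * 2)) ++ [ b ])
            (trans (cong (map suc) (chain-zigUp m m k)) (map-suc-range (m + m) (k * 2))) (+-gap (suc (m + k + 0) + k) 0 (suc (suc (j * 2))) (e₄ j k eq))))
      (↭-trans (↭-solve 4 (λ a b c d → (a ⊕ ((b ⊕ PermSolver.id) ⊕ (c ⊕ d))) ⊜ ((a ⊕ (c ⊕ d)) ⊕ b)) ↭-refl
            [ 0 ] (range (suc (m + m)) (k * 2)) (range 1 (suc (j * 2))) [ suc (suc (j * 2)) ])
      (↭-reflexive (trans (cong (_++ range (suc (m + m)) (k * 2)) (cong (0 ∷_) (sym (range-∷ʳ 1 (suc (j * 2))))))
          (trans (range-++ 0 (suc (suc (suc (j * 2)))) (e₅ j)) (cong (range 0) (e₆ j k))))))))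
      (↭-reflexive (cong₂ (λ a b → a ∷ b ∷ []) (e₇ j k eq) (e₈ j k))))
    where
    L = zigUp m (suc m) k
    e₁ : ∀ j k → j ≡ k * 2 → suc (suc j + k + 0) + (k + suc (suc k)) + (suc j + k + suc (k + suc k)) ≡ 5 * suc j + 2
    e₁ .(k * 2) k refl = solve (k ∷ [])
    e₂ : ∀ j k → j ≡ k * 2 → k + suc k ≡ suc j
    e₂ .(k * 2) k refl = solve (k ∷ [])
    e₃ : ∀ j k → suc j + suc k ≡ suc (suc j + k + 0)
    e₃ j k = solve (j ∷ k ∷ [])
    e₄ : ∀ j k → j ≡ k * 2 → suc (suc j + k + 0) + k ≡ suc (suc (j * 2))
    e₄ .(k * 2) k refl = solve (k ∷ [])
    e₅ : ∀ j → suc (suc j + suc j) ≡ suc (suc (suc (j * 2)))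
    e₅ j = solve (j ∷ [])
    e₆ : ∀ j k → suc (suc (suc (j * 2))) + k * 2 ≡ suc (suc j + k + 0) + (suc j + k)
    e₆ j k = solve (j ∷ k ∷ [])
    e₇ : ∀ j k → j ≡ k * 2 → suc (suc (suc j + k + 0) + k + j) ≡ suc (suc j + k + 0) + (suc j + k)
    e₇ .(k * 2) k refl = solve (k ∷ [])
    e₈ : ∀ j k → suc (suc j + k + (suc (suc j + k) + 0)) ≡ suc (suc (suc j + k + 0) + (suc j + k))
    e₈ j k = solve (j ∷ k ∷ [])

  -- For even m the differences 2m + 1, ..., 3m - 1 are `2k + 1` in number, and the path starts in
  -- row m instead.
  baseEven : j ≡ suc (k * 2) → (T : Tail (m + k) 0 (suc k) (m + suc k)) → Layout (j ∷ []) (5 * m + 4) (suc m)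
  baseEven eq T = subst₂ (Layout (j ∷ [])) (e₁ j k eq) (e₂ j k eq)
    (attachTail {[]} j 0 (m + k) 0 (suc k) (m + suc k) T (m + k) (unroll m L [ -[1+ m ] ]) [] refl
      (↭-trans (++⁺ʳ _ (↭-trans (↭-reflexive (cong (λ t → + t ∷ unroll m L [ -[1+ m ] ]) (sym (lastCol-zigUp m (suc m) k)))) (verts-unroll m L [ -[1+ m ] ])))
      (↭-trans (↭-reflexive (cong₂ (λ a b → (map -[1+_] a ++ map +_ b ++ + m ∷ [ -[1+ m ] ]) ++ map -[1+_] (range 0 m) ++ map +_ (range 0 m)) (rows-zigUp (suc m) (suc m) k) (cols-zigUp (suc m) (suc m) k)))
      (↭-trans (↭-solve 6 (λ a b c f d e → ((a ⊕ (b ⊕ (c ⊕ f))) ⊕ (d ⊕ e)) ⊜ ((d ⊕ (f ⊕ a)) ⊕ (e ⊕ (c ⊕ b)))) ↭-refl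
          (map -[1+_] (range (suc m) k)) (map +_ (range (suc m) k)) [ + m ] [ -[1+ m ] ] (map -[1+_] (range 0 m)) (map +_ (range 0 m)))
      (↭-reflexive (cong₂ _++_
          (trans (sym (map-++ -[1+_] (range 0 m) _)) (cong (map -[1+_]) (range-++ 0 m {suc k} refl)))
          (trans (sym (map-++ +_ (range 0 m) _)) (cong (λ t → map +_ t) (trans (range-++ 0 m {suc k} refl) (cong (range 0) (e₃ j k))))))))))
      (↭-trans (↭-prep 0 (++⁺ʳ _ (↭-trans (↭-reflexive (cong (λ t → steps (+ t) (unroll m L [ -[1+ m ] ])) (sym (lastCol-zigUp m (suc m) k)))) (steps-unroll m L [ -[1+ m ] ]))))
      (↭-trans (↭-reflexive (trans (cong₂ (λ a b → 0 ∷ (a ++ [ (+ m) gap -[1+ m ] ]) ++ range 1 (suc (j * 2)) ++ [ b ])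
            (trans (cong (map suc) (chain-zigUp m (suc m) k)) (map-suc-range (m + suc m) (k * 2))) (+-gap (suc (m + k + 0) + suc k) 0 (suc (suc (j * 2))) (e₄ j k eq)))
            (cong (λ t → 0 ∷ (range (suc (m + suc m)) (k * 2) ++ [ t ]) ++ range 1 (suc (j * 2)) ++ [ suc (suc (j * 2)) ]) (col-gap-row m m))))
      (↭-trans (↭-solve 5 (λ a b f c d → (a ⊕ ((b ⊕ f) ⊕ (c ⊕ d))) ⊜ ((a ⊕ (c ⊕ d)) ⊕ (f ⊕ b))) ↭-refl
            [ 0 ] (range (suc (m + suc m)) (k * 2)) [ suc (m + m) ] (range 1 (suc (j * 2))) [ suc (suc (j * 2)) ])
      (↭-reflexive (trans (cong₂ (λ a b → a ++ suc (m + m) ∷ range b (k * 2)) (cong (0 ∷_) (sym (range-∷ʳ 1 (suc (j * 2))))) (cong suc (+-suc m m)))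
          (trans (range-++ 0 (suc (suc (suc (j * 2)))) (e₅ j)) (cong (range 0) (e₆ j k))))))))
      (↭-reflexive (cong₂ (λ a b → a ∷ b ∷ []) (e₇ j k eq) (e₈ j k))))
    where
    L = zigUp (suc m) (suc m) k
    e₁ : ∀ j k → j ≡ suc (k * 2) → suc (suc j + k + 0) + (suc k + suc (suc (suc k))) + (suc j + suc k + suc (suc k + suc (suc k))) ≡ 5 * suc j + 4
    e₁ .(suc (k * 2)) k refl = solve (k ∷ [])
    e₂ : ∀ j k → j ≡ suc (k * 2) → suc k + suc (suc k) ≡ suc (suc j)
    e₂ .(suc (k * 2)) k refl = solve (k ∷ [])
    e₃ : ∀ j k → suc j + suc k ≡ suc (suc j + k + 0)
    e₃ j k = solve (j ∷ k ∷ [])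
    e₄ : ∀ j k → j ≡ suc (k * 2) → suc (suc j + k + 0) + suc k ≡ suc (suc (j * 2))
    e₄ .(suc (k * 2)) k refl = solve (k ∷ [])
    e₅ : ∀ j → suc (suc j + suc j) ≡ suc (suc (suc (j * 2)))
    e₅ j = solve (j ∷ [])
    e₆ : ∀ j k → suc (suc (suc (j * 2))) + suc (k * 2) ≡ suc (suc j + k + 0) + (suc j + suc k)
    e₆ j k = solve (j ∷ k ∷ [])
    e₇ : ∀ j k → j ≡ suc (k * 2) → suc (suc (suc j + k + 0) + suc k + j) ≡ suc (suc j + k + 0) + (suc j + suc k)
    e₇ .(suc (k * 2)) k refl = solve (k ∷ [])
    e₈ : ∀ j k → suc (suc j + k + (suc (suc j + suc k) + 0)) ≡ suc (suc (suc j + k + 0) + (suc j + suc k))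
    e₈ j k = solve (j ∷ k ∷ [])

-- The new path edges enter at distance e ≥ m from the end, which leaves out the difference N + 2m; the far vertex
-- is chosen so that the closing edge of the cycle has this difference.
surround : ∀ {js N e} → Layout js N e → ∀ j o w o₂ a (p : ℕ → ℕ) →
  let m = suc j; Z = suc (o + w); z = m + Z; b = suc (o₂ + a) in
  e ≡ m + o →
  (∀ q → q + suc e ≡ N → p q + o₂ ≡ q + m * 2 + Z + o) →
  N + m ≡ Z + a →
  (∀ q → q + suc e ≡ N → suc (suc (p q + o₂) + a + j) ∷ suc (q + m * 2 + Z + (suc z + o₂)) ∷ [] ↭ range (suc (p q + o₂) + z) 2) →
  (∀ p → Tail p o₂ a z) →
  Layout (j ∷ js) ((N + m + Z + (a + suc b)) + (z + suc (a + b))) (a + b)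
surround {js} {N} {e} Γ j o w o₂ a p refl pq N+m two T = subst (λ t → Layout (j ∷ js) ((t + (a + suc b)) + (z + suc (a + b))) (a + b)) u≡
  (attachTail j N (p q) o₂ a z (T (p q)) κ (unroll q M path) cycles lengths
    (↭-trans (++⁺ʳ _ (↭-trans (↭-reflexive (cong (λ t → + t ∷ unroll q M path) (sym A.end))) (verts-unroll q M path)))
    (↭-trans (↭-solve 6 (λ r c P v x y → ((r ⊕ (c ⊕ P)) ⊕ (v ⊕ (x ⊕ y))) ⊜ ((x ⊕ r) ⊕ ((P ⊕ v) ⊕ (y ⊕ c)))) ↭-refl
        (map -[1+_] (rows M)) (map +_ (cols M)) (+ q ∷ path) (concatMap verts cycles) (map -[1+_] (range 0 m)) (map +_ (range N m)))
    (↭-trans (++⁺ (++⁺ˡ (map -[1+_] (range 0 m)) (↭-map⁺ -[1+_] A.rows↭)) (++⁺ verts↭ (++⁺ˡ (map +_ (range N m)) (↭-map⁺ +_ A.cols↭))))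
    (↭-reflexive (cong₂ _++_
        (trans (sym (map-++ -[1+_] (range 0 m) _)) (cong (map -[1+_]) (range-++ 0 m refl)))
        (trans (cong (λ t → map +_ (range 0 N) ++ t) (trans (sym (map-++ +_ (range N m) _)) (cong (λ t → map +_ t) (range-++ N m (trans (h₁ q j o) (cong (_+ m) q+e))))))
        (trans (sym (map-++ +_ (range 0 N) _)) (cong (λ t → map +_ t) (trans (range-++ 0 N refl) (cong (range 0) (trans (sym (+-assoc N m Z)) (sym u≡))))))))))))
    (↭-trans (↭-prep 0 (++⁺ʳ _ (↭-trans (↭-reflexive (cong (λ t → steps (+ t) (unroll q M path)) (sym A.end))) (steps-unroll q M path))))
    (↭-trans (↭-solve 7 (λ O x t s c r f → (O ⊕ (((x ⊕ t) ⊕ s) ⊕ (c ⊕ (r ⊕ f)))) ⊜ ((O ⊕ (s ⊕ c)) ⊕ ((x ⊕ r) ⊕ (f ⊕ t)))) ↭-refl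
        [ 0 ] [ suc (q + (m + o)) ] (map suc (A.col₀ + (m + o) ∷ chain A.col₀ A.rest)) (steps (+ q) path) (concatMap cycleSteps cycles)
        (range (suc N) (suc (j * 2))) [ (+ (suc (p q + o₂) + a)) gap (+ N) ])
    (↭-trans (++⁺ steps↭ (++⁺ (↭-reflexive (cong (_∷ range (suc N) (suc (j * 2))) (trans (sym (+-suc q (m + o))) q+e)))
                (++⁺ (↭-reflexive (cong [_] (+-gap (suc (p q + o₂) + a) N (N + m * 2) F≡)))
                     (↭-trans (↭-map⁺ suc A.sums↭) (↭-reflexive (trans (map-suc-range (suc (q + m * 2 + (m + o))) _)
                          (cong (λ t → range (suc t) (suc ((o + w) * 2))) (trans (h₂ q j o) (cong (_+ m * 2) q+e)))))))))
    (↭-reflexive (trans (cong (range 0 N ++_) (range-++ N (suc (suc (j * 2))) refl))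
                 (trans (range-++ 0 N refl) (cong (range 0) (trans (h₃ N j o w) (cong (_+ z) (sym u≡)))))))))) 
    (two q q+e))
  where
  open Layout Γ
  m = suc j
  Z = suc (o + w)
  z = m + Z
  b = suc (o₂ + a)
  κ = q + m * 2 + Z
  -- The path really leaves `q`, for row `m + o`, with difference `N`. Pretending that it comes from
  -- column `q + 2m` moves its columns past those of the cycle, to `N + m`, and its differences past
  -- the `N + 2m` reserved for the cycle.
  module A = AlphaPath (alphaPath-exists o w (q + m * 2) m)
  M = (m + o , A.col₀) ∷ A.rest
  h₀ : ∀ q j o w → suc (q + suc j * 2 + suc (o + w) + o) ≡ q + suc (suc j + o) + suc j + suc (o + w)
  h₀ q j o w = solve (q ∷ j ∷ o ∷ w ∷ [])
  h₁ : ∀ q j o → suc (q + suc j * 2 + o) ≡ q + suc (suc j + o) + suc j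
  h₁ q j o = solve (q ∷ j ∷ o ∷ [])
  h₂ : ∀ q j o → suc (q + suc j * 2 + (suc j + o)) ≡ q + suc (suc j + o) + suc j * 2
  h₂ q j o = solve (q ∷ j ∷ o ∷ [])
  h₃ : ∀ N j o w → N + (suc (suc (j * 2)) + suc (suc ((o + w) * 2))) ≡ N + suc j + suc (o + w) + (suc j + suc (o + w))
  h₃ N j o w = solve (N ∷ j ∷ o ∷ w ∷ [])
  h₄ : ∀ N m Z a → N + m + Z + a ≡ N + m + (Z + a)
  h₄ N m Z a = solve (N ∷ m ∷ Z ∷ a ∷ [])
  h₅ : ∀ N m → N + m + (N + m) ≡ N + (N + m * 2)
  h₅ N m = solve (N ∷ m ∷ [])
  u≡ : suc (p q + o₂) ≡ N + m + Z
  u≡ = trans (cong suc (pq q q+e)) (trans (h₀ q j o w) (cong (λ t → t + m + Z) q+e))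
  F≡ : suc (p q + o₂) + a ≡ N + (N + m * 2)
  F≡ = trans (cong (_+ a) u≡) (trans (h₄ N m Z a) (trans (cong (λ t → N + m + t) (sym N+m)) (h₅ N m)))

-- With `m = j + 1`, `Z = o + w + 1` and `N + m = 2Z` the edge from the far vertex to row `j` has
-- difference `2N + 3m = u + z`. The tail begins with `u + z + 1`, which keeps its offset `o`.
surroundEven : ∀ {js N e} → Layout js N e → ∀ j o w → e ≡ suc j + o → N + suc j ≡ suc (o + w) * 2 →
  Layout (j ∷ js) (4 * N + 3 * suc j + 2 * e + 4) (suc (N + e))
surroundEven {js} {N} Γ j o w refl eq = subst₂ (Layout (j ∷ js))
  (trans (e₁ N j o w) (trans (cong (λ t → N + 2 * suc j + t * 3 + 2 * o + 4) (sym eq)) (e₂ N j o)))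
  (trans (e₃ o w) (trans (cong (λ t → t + suc o) (sym eq)) (e₄ N j o)))
  (surround Γ j o w o (suc (o + w)) (λ q → q + suc j * 2 + suc (o + w)) refl (λ _ _ → refl)
    (trans eq (e₅ o w))
    (λ q _ → ↭-reflexive (cong₂ (λ a b → a ∷ b ∷ []) (e₆ (q + suc j * 2 + suc (o + w)) j o (suc (o + w))) (e₇ (q + suc j * 2 + suc (o + w)) (suc j + suc (o + w)) o)))
    (λ p → tail₊ p o w _))
  where
  e₁ : ∀ N j o w → N + suc j + suc (o + w) + (suc (o + w) + suc (suc (o + suc (o + w)))) + (suc j + suc (o + w) + suc (suc (o + w) + suc (o + suc (o + w)))) ≡ N + 2 * suc j + (suc (o + w) * 2) * 3 + 2 * o + 4
  e₁ N j o w = solve (N ∷ j ∷ o ∷ w ∷ [])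
  e₂ : ∀ N j o → N + 2 * suc j + (N + suc j) * 3 + 2 * o + 4 ≡ 4 * N + 3 * suc j + 2 * (suc j + o) + 4
  e₂ N j o = solve (N ∷ j ∷ o ∷ [])
  e₃ : ∀ o w → suc (o + w) + suc (o + suc (o + w)) ≡ suc (o + w) * 2 + suc o
  e₃ o w = solve (o ∷ w ∷ [])
  e₄ : ∀ N j o → N + suc j + suc o ≡ suc (N + (suc j + o))
  e₄ N j o = solve (N ∷ j ∷ o ∷ [])
  e₅ : ∀ o w → suc (o + w) * 2 ≡ suc (o + w) + suc (o + w)
  e₅ o w = solve (o ∷ w ∷ [])
  e₆ : ∀ p j o Z → suc (suc (p + o) + Z + j) ≡ suc (p + o) + (suc j + Z)
  e₆ p j o Z = solve (p ∷ j ∷ o ∷ Z ∷ [])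
  e₇ : ∀ p z o → suc (p + (suc z + o)) ≡ suc (suc (p + o) + z)
  e₇ p z o = solve (p ∷ z ∷ o ∷ [])

-- Now `2N + 3m` is `u + z + 1`, and the tail must begin with `u + z`. It is entered as if from one
-- column further on and with offset one less, hence the distance `e - m` has to be positive.
surroundOdd : ∀ {js N e} → Layout js N e → ∀ j o w → e ≡ suc j + suc o → N + suc j ≡ suc (suc (suc o + w) * 2) →
  Layout (j ∷ js) (4 * N + 3 * suc j + 2 * e + 3) (suc (N + e))
surroundOdd {js} {N} Γ j o w refl eq = subst₂ (Layout (j ∷ js))
  (trans (e₁ N j o w) (trans (cong (λ t → N + 2 * suc j + t * 3 + 2 * suc o + 3) (sym eq)) (e₂ N j o)))
  (trans (e₃ o w) (trans (cong (λ t → t + suc (suc o)) (sym eq)) (e₄ N j o)))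
  (surround Γ j (suc o) w o (suc (o + suc (suc w))) (λ q → suc (q + suc j * 2 + suc (suc o + w))) refl
    (λ q _ → sym (+-suc _ o))
    (trans eq (e₅ o w))
    (λ q _ → ↭-trans (↭-reflexive (cong₂ (λ a b → a ∷ b ∷ []) (e₆ (q + suc j * 2 + suc (suc o + w)) j o w) (e₇ (q + suc j * 2 + suc (suc o + w)) (suc j + suc (suc o + w)) o)))
                    (↭-swap _ _ ↭-refl))
    (λ p → tail₊ p o (suc (suc w)) _))
  where
  e₁ : ∀ N j o w → N + suc j + suc (suc o + w) + (suc (o + suc (suc w)) + suc (suc (o + suc (o + suc (suc w))))) + (suc j + suc (suc o + w) + suc (suc (o + suc (suc w)) + suc (o + suc (o + suc (suc w))))) ≡ N + 2 * suc j + (suc (suc (suc o + w) * 2)) * 3 + 2 * suc o + 3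
  e₁ N j o w = solve (N ∷ j ∷ o ∷ w ∷ [])
  e₂ : ∀ N j o → N + 2 * suc j + (N + suc j) * 3 + 2 * suc o + 3 ≡ 4 * N + 3 * suc j + 2 * (suc j + suc o) + 3
  e₂ N j o = solve (N ∷ j ∷ o ∷ [])
  e₃ : ∀ o w → suc (o + suc (suc w)) + suc (o + suc (o + suc (suc w))) ≡ suc (suc (suc o + w) * 2) + suc (suc o)
  e₃ o w = solve (o ∷ w ∷ [])
  e₄ : ∀ N j o → N + suc j + suc (suc o) ≡ suc (N + (suc j + suc o))
  e₄ N j o = solve (N ∷ j ∷ o ∷ [])
  e₅ : ∀ o w → suc (suc (suc o + w) * 2) ≡ suc (suc o + w) + suc (o + suc (suc w))
  e₅ o w = solve (o ∷ w ∷ [])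
  e₆ : ∀ p j o w → suc (suc (suc p + o) + suc (o + suc (suc w)) + j) ≡ suc (suc (suc p + o) + (suc j + suc (suc o + w)))
  e₆ p j o w = solve (p ∷ j ∷ o ∷ w ∷ [])
  e₇ : ∀ p z o → suc (p + (suc z + o)) ≡ suc (suc p + o) + z
  e₇ p z o = solve (p ∷ z ∷ o ∷ [])

*2≢odd : ∀ a b → a * 2 ≢ suc (b * 2)
*2≢odd a b p = even≢odd a b (trans (*-comm 2 a) (trans p (cong suc (*-comm b 2))))

data EvenOrOdd : ℕ → Set where
  even : ∀ k → EvenOrOdd (k * 2)
  odd  : ∀ k → EvenOrOdd (suc (k * 2))

evenOrOdd : ∀ n → EvenOrOdd n
evenOrOdd zero = even 0
evenOrOdd (suc n) with evenOrOdd n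
... | even k = odd k
... | odd k = even (suc k)

-- `M` bounds `j + 1` for the cycles still to be added. Their offset is `e - (j + 1)`; by `M≤e` it
-- vanishes only when `N + (j + 1)` is even. `2e≤N` keeps this offset below the number of new rows
-- that the path visits before the tail, `N≤5e` makes the differences missing at the end outnumber
-- those used, and `size` bounds the number of labels from which the labelling can be finished.
record Grown (M : ℕ) (js : List ℕ) (bound : ℕ) : Set where
  field
    N e    : ℕ
    layout : Layout js N e
    M≤e    : M < e ⊎ (M ≡ e × ∃ λ Z → N + M ≡ Z * 2)
    2e≤N   : 2 * e ≤ N
    N≤5e   : N ≤ 5 * e + 2
    size   : N + 5 * e + 3 ≤ bound

≤-by : ∀ {a b} d → a + d ≡ b → a ≤ b
≤-by d refl = m≤m+n _ d

-- With `m = J + 1` the construction needs `10m + 12` for even `m` and `10m + 5` for odd `m`; both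
-- are at most `12m + 9`.
grownBase : ∀ J → Grown (suc J) (J ∷ []) (12 * suc J + 9)
grownBase J with evenOrOdd J
... | odd k = record
  { layout = baseEven (suc (k * 2)) k refl (tail₊ _ 0 k _)
  ; M≤e = inj₁ ≤-refl
  ; 2e≤N = ≤-by (3 * (2 + k * 2) + 2) (e₁ k)
  ; N≤5e = ≤-by 3 (e₂ k)
  ; size = ≤-by (k * 4 + 1) (e₃ k)
  }
  where
  e₁ : ∀ k → 2 * suc (2 + k * 2) + (3 * (2 + k * 2) + 2) ≡ 5 * (2 + k * 2) + 4
  e₁ k = solve (k ∷ [])
  e₂ : ∀ k → 5 * (2 + k * 2) + 4 + 3 ≡ 5 * suc (2 + k * 2) + 2
  e₂ k = solve (k ∷ [])
  e₃ : ∀ k → (5 * (2 + k * 2) + 4) + 5 * suc (2 + k * 2) + 3 + (k * 4 + 1) ≡ 12 * (2 + k * 2) + 9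
  e₃ k = solve (k ∷ [])
... | even k = record
  { layout = baseOdd (k * 2) k refl (t k)
  -- For odd `m` the distance is exactly `m`, and a second cycle of the same length is possible only
  -- because `N + m = 6m + 2` is even.
  ; M≤e = inj₂ (refl , 3 * suc (k * 2) + 1 , e₀ k)
  ; 2e≤N = ≤-by (3 * suc (k * 2) + 2) (e₁ k)
  ; N≤5e = ≤-refl
  ; size = ≤-by (k * 4 + 6) (e₃ k)
  }
  where
  t : ∀ k → Tail (suc (k * 2) + k) 0 k (suc (k * 2) + k)
  t zero = tail₀ _ _
  t (suc k) = tail₊ _ 0 k _
  e₀ : ∀ k → 5 * suc (k * 2) + 2 + suc (k * 2) ≡ (3 * suc (k * 2) + 1) * 2
  e₀ k = solve (k ∷ [])
  e₁ : ∀ k → 2 * suc (k * 2) + (3 * suc (k * 2) + 2) ≡ 5 * suc (k * 2) + 2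
  e₁ k = solve (k ∷ [])
  e₃ : ∀ k → (5 * suc (k * 2) + 2) + 5 * suc (k * 2) + 3 + (k * 4 + 6) ≡ 12 * suc (k * 2) + 9
  e₃ k = solve (k ∷ [])

-- Up to constants `N` becomes at most `4N + 5e` and `e` becomes `N + e`, so `N + 5e` becomes at
-- most `9N + 10e`. Trading `2N` for `10e` leaves `7N + 20e`, which is below `7(N + 5e)`.
grow : ∀ {M js bound} j → suc j ≤ M → Grown M js bound → Grown M (j ∷ js) (7 * bound)
grow {M} {js} {bound} j j<M G = main (evenOrOdd (N + m)) refl
  where
  open Grown G
  m = suc j
  m≤e : m ≤ e
  m≤e with M≤e
  ... | inj₁ M<e = ≤-trans j<M (<⇒≤ M<e)
  ... | inj₂ (refl , _) = j<M
  M< : M < suc (N + e)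
  M< with M≤e
  ... | inj₁ M<e = s≤s (≤-trans (<⇒≤ M<e) (m≤n+m e N))
  ... | inj₂ (refl , _) = s≤s (m≤n+m e N)
  2e≤ : ∀ r → 2 * suc (N + e) ≤ 4 * N + 3 * m + 2 * e + (3 + r)
  2e≤ r = ≤-by (2 * N + 3 * m + 1 + r) (h N m e r)
    where
    h : ∀ N m e r → 2 * suc (N + e) + (2 * N + 3 * m + 1 + r) ≡ 4 * N + 3 * m + 2 * e + (3 + r)
    h N m e r = solve (N ∷ m ∷ e ∷ r ∷ [])
  5e≥ : ∀ r → r ≤ 1 → 4 * N + 3 * m + 2 * e + (3 + r) ≤ 5 * suc (N + e) + 2
  5e≥ r r≤1 = ≤-trans (+-mono-≤ (+-monoˡ-≤ (2 * e) (+-monoʳ-≤ (4 * N) (*-monoʳ-≤ 3 m≤e))) (+-monoʳ-≤ 3 r≤1)) (≤-by (N + 3) (h N e))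
    where
    h : ∀ N e → 4 * N + 3 * e + 2 * e + 4 + (N + 3) ≡ 5 * suc (N + e) + 2
    h N e = solve (N ∷ e ∷ [])
  size≤ : ∀ r → r ≤ 1 → 4 * N + 3 * m + 2 * e + (3 + r) + 5 * suc (N + e) + 3 ≤ 7 * bound
  size≤ r r≤1 = begin
    4 * N + 3 * m + 2 * e + (3 + r) + 5 * suc (N + e) + 3
      ≤⟨ +-monoˡ-≤ 3 (+-monoˡ-≤ (5 * suc (N + e)) (+-mono-≤ (+-monoˡ-≤ (2 * e) (+-monoʳ-≤ (4 * N) (*-monoʳ-≤ 3 m≤e))) (+-monoʳ-≤ 3 r≤1))) ⟩
    4 * N + 3 * e + 2 * e + 4 + 5 * suc (N + e) + 3 ≡⟨ h₁ N e ⟩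
    7 * N + 10 * e + 12 + 2 * N ≤⟨ +-monoʳ-≤ (7 * N + 10 * e + 12) (*-monoʳ-≤ 2 N≤5e) ⟩
    7 * N + 10 * e + 12 + 2 * (5 * e + 2) ≤⟨ ≤-by (15 * e + 5) (h₂ N e) ⟩
    7 * (N + 5 * e + 3) ≤⟨ *-monoʳ-≤ 7 size ⟩
    7 * bound ∎
    where
    open ≤-Reasoning
    h₁ : ∀ N e → 4 * N + 3 * e + 2 * e + 4 + 5 * suc (N + e) + 3 ≡ 7 * N + 10 * e + 12 + 2 * N
    h₁ N e = solve (N ∷ e ∷ [])
    h₂ : ∀ N e → 7 * N + 10 * e + 12 + 2 * (5 * e + 2) + (15 * e + 5) ≡ 7 * (N + 5 * e + 3)
    h₂ N e = solve (N ∷ e ∷ [])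
  result : ∀ r → r ≤ 1 → Layout (j ∷ js) (4 * N + 3 * m + 2 * e + (3 + r)) (suc (N + e)) → Grown M (j ∷ js) (7 * bound)
  result r r≤1 Γ = record
    { layout = Γ
    ; M≤e = inj₁ M<
    ; 2e≤N = 2e≤ r
    ; N≤5e = 5e≥ r r≤1
    ; size = size≤ r r≤1
    }
  main : ∀ {t} → EvenOrOdd t → t ≡ N + m → Grown M (j ∷ js) (7 * bound)
  main (even Z) eq = result 1 ≤-refl (go (m≤n⇒∃[o]m+o≡n m≤e))
    where
    go : (∃ λ o → m + o ≡ e) → Layout (j ∷ js) (4 * N + 3 * m + 2 * e + 4) (suc (N + e))
    go (o , em) with m≤n⇒∃[o]m+o≡n (*-cancelʳ-< 2 o Z lt)
      where
      lt : o * 2 < Z * 2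
      lt = begin-strict
        o * 2 <⟨ m<m+n (o * 2) {3 * m} (s≤s z≤n) ⟩
        o * 2 + 3 * m ≡⟨ h o m ⟩
        2 * (m + o) + m ≡⟨ cong (λ t → 2 * t + m) em ⟩
        2 * e + m ≤⟨ +-monoˡ-≤ m 2e≤N ⟩
        N + m ≡⟨ sym eq ⟩
        Z * 2 ∎
        where
        open ≤-Reasoning
        h : ∀ o m → o * 2 + 3 * m ≡ 2 * (m + o) + m
        h o m = solve (o ∷ m ∷ [])
    ... | w , refl = surroundEven layout j o w (sym em) (sym eq)
  main (odd Z) eq = result 0 z≤n (go (m≤n⇒∃[o]m+o≡n m<e))
    where
    m<e : m < e
    -- If `m = M = e`, the invariant makes `N + m` even, contrary to the case at hand.
    m<e with M≤e
    ... | inj₁ M<e = ≤-<-trans j<M M<e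
    ... | inj₂ (refl , Z′ , eq′) with m≤n⇒m<n∨m≡n j<M
    ... | inj₁ m<M = m<M
    ... | inj₂ refl with trans (sym eq′) (sym eq)
    ... | q = ⊥-elim (*2≢odd Z′ Z q)
    go : (∃ λ o → suc m + o ≡ e) → Layout (j ∷ js) (4 * N + 3 * m + 2 * e + (3 + 0)) (suc (N + e))
    go (o , em) with m≤n⇒∃[o]m+o≡n (*-cancelʳ-< 2 (suc o) Z lt)
      where
      lt : suc o * 2 < Z * 2
      lt = s≤s⁻¹ (begin-strict
        suc (suc o * 2) <⟨ m<m+n (suc (suc o * 2)) {j * 3 + 2} (subst (1 ≤_) (+-comm 2 (j * 3)) (s≤s z≤n)) ⟩
        suc (suc o * 2) + (j * 3 + 2) ≡⟨ h o j ⟩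
        2 * (suc (suc j) + o) + suc j ≡⟨ cong (λ t → 2 * t + m) em ⟩
        2 * e + m ≤⟨ +-monoˡ-≤ m 2e≤N ⟩
        N + m ≡⟨ sym eq ⟩
        suc (Z * 2) ∎)
        where
        open ≤-Reasoning
        h : ∀ o j → suc (suc o * 2) + (j * 3 + 2) ≡ 2 * (suc (suc j) + o) + suc j
        h o j = solve (o ∷ j ∷ [])
    ... | w , refl = surroundOdd layout j o w (trans (sym em) (sym (+-suc m o))) (sym eq)

grown : ∀ J js → All (_≤ J) js → Grown (suc J) (js ++ [ J ]) (7 ^ length js * (12 * suc J + 9))
grown J [] All.[] = subst (Grown (suc J) (J ∷ [])) (sym (+-identityʳ _)) (grownBase J)
grown J (j ∷ js) (j≤J All.∷ js≤J) = subst (Grown (suc J) (j ∷ js ++ [ J ])) (sym (*-assoc 7 (7 ^ length js) _)) (grow j (s≤s j≤J) (grown J js js≤J))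

-- Completing the labelling

-- As n = 2N + c, the complement n - d of the difference d of a cycle edge is the difference of a path edge.
record Graceful (js : List ℕ) (n : ℕ) : Set where
  field
    start   : ℤ
    path    : List ℤ
    cycles  : List Cycle
    lengths : map (λ c → length (proj₂ (proj₂ c))) cycles ≡ map (λ j → suc (j * 2)) js
    verts↭  : start ∷ path ++ concatMap verts cycles ↭ map +_ (range 0 n)
    N c     : ℕ
    n≡      : N + (N + c) ≡ n
    inner   : List ℕ
    steps↭  : steps start path ↭ inner ++ range N (N + c)
    inner↭  : 0 ∷ inner ++ concatMap cycleSteps cycles ↭ range 0 N

module _ {js N e} (Γ : Layout js N e) where
  open Layout Γ

  finishWith : ∀ B R c start V → B + R ≡ N + (N + c) →
    start ∷ V ++ concatMap verts cycles ↭ map -[1+_] (range 0 R) ++ map +_ (range 0 B) →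
    steps start V ↭ steps (+ q) path ++ range N (N + c) →
    Graceful js (N + (N + c))
  finishWith B R c s V B+R v↭ s↭ = record
    { start = reflect B s
    ; path = map (reflect B) V
    ; cycles = map (reflectCycle B) cycles
    ; lengths = trans (sym (map-∘ cycles)) (trans (map-cong (λ c → length-map (reflect B) (proj₂ (proj₂ c))) cycles) lengths)
    ; verts↭ = ↭-trans (↭-reflexive (trans (cong (λ b → reflect B s ∷ map (reflect B) V ++ b) vs)
                                            (sym (map-++ (reflect B) (s ∷ V) (concatMap verts cycles)))))
              (↭-trans (↭-map⁺ (reflect B) v↭)
              (↭-trans (↭-reflexive (map-++ (reflect B) (map -[1+_] (range 0 R)) _))
              (↭-trans (++-comm (map (reflect B) (map -[1+_] (range 0 R))) _)
              (↭-trans (++⁺ (reflect-cols B 0 B refl) (↭-reflexive (reflect-rows B 0 R)))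
                       (↭-reflexive (trans (sym (map-++ +_ (range 0 B) _)) (cong (λ t → map +_ t) (trans (range-++ 0 B (+-identityʳ B)) (cong (range 0) B+R)))))))))
    ; N = N
    ; c = c
    ; n≡ = refl
    ; inner = steps (+ q) path
    ; steps↭ = ↭-trans (↭-reflexive (steps-reflect B s V)) s↭
    ; inner↭ = ↭-trans (↭-reflexive (cong (λ t → 0 ∷ steps (+ q) path ++ t)
                 (trans (concatMap-map cycleSteps (reflectCycle B) cycles) (concatMap-cong (cycleSteps-reflect B) cycles)))) steps↭
    }
    where
    vs : concatMap verts (map (reflectCycle B) cycles) ≡ map (reflect B) (concatMap verts cycles)
    vs = trans (concatMap-map verts (reflectCycle B) cycles) (sym (map-concatMap (reflect B) verts cycles))

  module _ (w : ℕ) where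
    private
      A = suc (e + w)
      module P = AlphaPath (alphaPath-exists e w q 0)
      L = (e , P.col₀) ∷ P.rest
      end : lastCol q L ≡ q + A
      end = P.end
      cs↭ : cols L ↭ range N A
      cs↭ = ↭-trans P.cols↭ (↭-reflexive (cong (λ t → range t A) (trans (sym (+-suc q e)) q+e)))
      ch↭ : map suc (chain q L) ↭ range N (A * 2)
      ch↭ = ↭-trans (↭-prep _ (↭-trans (↭-map⁺ suc P.sums↭) (↭-reflexive (map-suc-range _ _))))
                    (↭-reflexive (cong (λ t → range t (A * 2)) (trans (sym (+-suc q e)) q+e)))

    -- The path is entered from the true `q`: offset `e` makes the first difference `q + e + 1 = N`.
    -- It ends in a column, hence has an even number of new edges.
    finishEven : ∀ c → N + c ≡ suc (e + w) * 2 → Graceful js (N + (N + c))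
    finishEven c eq = finishWith (N + A) A c (+ lastCol q L) (unroll q L path)
      (trans (h N A) (cong (λ t → N + t) (sym eq)))
      (↭-trans (++⁺ʳ (concatMap verts cycles) (verts-unroll q L path))
      (↭-trans (↭-solve 4 (λ r c p v → ((r ⊕ (c ⊕ p)) ⊕ v) ⊜ (r ⊕ ((p ⊕ v) ⊕ c))) ↭-refl
           (map -[1+_] (rows L)) (map +_ (cols L)) (+ q ∷ path) (concatMap verts cycles))
      (↭-trans (++⁺ (↭-map⁺ -[1+_] P.rows↭) (++⁺ verts↭ (↭-map⁺ +_ cs↭)))
      (↭-reflexive (cong (λ t → map -[1+_] (range 0 A) ++ t) (trans (sym (map-++ +_ (range 0 N) _)) (cong (λ t → map +_ t) (range-++ 0 N refl))))))))
      (↭-trans (steps-unroll q L path)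
      (↭-trans (++-comm (map suc (chain q L)) (steps (+ q) path))
               (++⁺ˡ (steps (+ q) path) (↭-trans ch↭ (↭-reflexive (cong (range N) (sym eq)))))))
      where
      h : ∀ N A → N + A + A ≡ N + A * 2
      h N A = solve (N ∷ A ∷ [])

    -- An odd number of edges ends in a row. Row `A` is reserved for the end, after column `N + A`,
    -- which gives difference `N + 2A + 1`. The difference `N + 2A` then sends the path from column
    -- `q + A` to row `A + e`, whence it zigzags down through `e` rows and columns.
    finishOdd : ∀ c f → e ≡ suc f → N + c ≡ suc ((suc (e + w) + e) * 2) → Graceful js (N + (N + c))
    finishOdd c f refl eq = finishWith (N + A + e) (suc (A + e)) c -[1+ A ] (+ lastCol q (L ++ M) ∷ unroll q (L ++ M) path)
      (trans (h N A e) (cong (λ t → N + t) (sym eq)))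
      (↭-trans (↭-prep _ (++⁺ʳ (concatMap verts cycles) (verts-unroll q (L ++ M) path)))
      (↭-trans (↭-reflexive (cong₂ (λ a b → -[1+ A ] ∷ (a ++ b ++ + q ∷ path) ++ concatMap verts cycles)
           (trans (cong (map -[1+_]) (map-++ proj₁ L M)) (map-++ -[1+_] (rows L) (rows M)))
           (trans (cong (λ t → map +_ t) (map-++ proj₂ L M)) (map-++ +_ (cols L) (cols M)))))
      (↭-trans (↭-solve 7 (λ x r s c d p v → (x ⊕ (((r ⊕ s) ⊕ ((c ⊕ d) ⊕ p)) ⊕ v)) ⊜ ((r ⊕ (x ⊕ s)) ⊕ ((p ⊕ v) ⊕ (c ⊕ d)))) ↭-refl
           [ -[1+ A ] ] (map -[1+_] (rows L)) (map -[1+_] (rows M)) (map +_ (cols L)) (map +_ (cols M)) (+ q ∷ path) (concatMap verts cycles))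
      (↭-trans (++⁺ (++⁺ (↭-map⁺ -[1+_] P.rows↭) (↭-prep -[1+ A ] (↭-map⁺ -[1+_] (rows-zigDown (suc A) (N + A) e))))
                    (++⁺ verts↭ (++⁺ (↭-map⁺ +_ cs↭) (↭-map⁺ +_ (cols-zigDown (suc A) (N + A) e)))))
      (↭-reflexive (cong₂ _++_
           (trans (sym (map-++ -[1+_] (range 0 A) (range A (suc e)))) (cong (map -[1+_]) (trans (range-++ 0 A refl) (cong (range 0) (+-suc A e)))))
           (trans (cong (λ t → map +_ (range 0 N) ++ t) (trans (sym (map-++ +_ (range N A) _)) (cong (λ t → map +_ t) (range-++ N A refl))))
             (trans (sym (map-++ +_ (range 0 N) _)) (cong (λ t → map +_ t) (trans (range-++ 0 N refl) (cong (range 0) (sym (+-assoc N A e)))))))))))))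
      (↭-trans (↭-prep _ (steps-unroll q (L ++ M) path))
      (↭-trans (↭-reflexive (cong₂ (λ a b → a ∷ map suc b ++ steps (+ q) path) (trans (row-gap-col A (lastCol q (L ++ M))) (cong (λ t → suc (t + A)) lst)) spl))
      (↭-trans (↭-reflexive (cong (λ t → suc (N + A + A) ∷ t ++ steps (+ q) path) (map-++ suc (chain q L) _)))
      (↭-trans (↭-solve 5 (λ x c y z s → (x ⊕ ((c ⊕ (y ⊕ z)) ⊕ s)) ⊜ (s ⊕ (c ⊕ (y ⊕ (x ⊕ z))))) ↭-refl
           [ suc (N + A + A) ] (map suc (chain q L)) [ suc (q + A + (suc A + f)) ] (map suc (N + A + f + (suc A + f) ∷ chain (N + A + f) (zigDown (suc A) (N + A) f))) (steps (+ q) path))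
      (++⁺ˡ (steps (+ q) path) (↭-trans (++⁺ ch↭ (↭-trans (↭-reflexive (cong₂ (λ a b → a ∷ b ∷ map suc (N + A + f + (suc A + f) ∷ chain (N + A + f) (zigDown (suc A) (N + A) f))) k₁ (k₂ N A)))
           (↭-prep _ (↭-prep _ (↭-trans (↭-map⁺ suc (↭-trans (↭-reflexive (cong (_∷ chain (N + A + f) (zigDown (suc A) (N + A) f)) (k₃ N A f)))
                (range-∷ (N + A + suc A) (f * 2) (chain-zigDown (suc A) (N + A) f)))) (↭-reflexive (trans (map-suc-range (N + A + suc A) (suc (f * 2))) (cong (λ t → range t (suc (f * 2))) (k₄ N A))))))) ))
           (↭-reflexive (trans (range-++ N (A * 2) refl) (cong (range N) (trans (k₅ A f) (sym eq)))))))))))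
      where
      M = zigDown (suc A) (N + A) e
      h : ∀ N A e → N + A + e + suc (A + e) ≡ N + suc ((A + e) * 2)
      h N A e = solve (N ∷ A ∷ e ∷ [])
      lst : lastCol q (L ++ M) ≡ N + A
      lst = trans (lastCol-++ q L M) (lastCol-zigDown (suc A) (N + A) f)
      spl : chain q (L ++ M) ≡ chain q L ++ q + A + (suc A + f) ∷ N + A + f + (suc A + f) ∷ chain (N + A + f) (zigDown (suc A) (N + A) f)
      spl = trans (chain-++ q L M) (cong (λ t → chain q L ++ t + (suc A + f) ∷ N + A + f + (suc A + f) ∷ chain (N + A + f) (zigDown (suc A) (N + A) f)) end)
      k₁ : suc (q + A + (suc A + f)) ≡ N + A * 2
      k₁ = trans (g q A f) (cong (_+ A * 2) q+e)
        where
        g : ∀ q A f → suc (q + A + (suc A + f)) ≡ q + suc (suc f) + A * 2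
        g q A f = solve (q ∷ A ∷ f ∷ [])
      k₂ : ∀ N A → suc (N + A + A) ≡ suc (N + A * 2)
      k₂ N A = solve (N ∷ A ∷ [])
      k₃ : ∀ N A f → N + A + f + (suc A + f) ≡ N + A + suc A + f * 2
      k₃ N A f = solve (N ∷ A ∷ f ∷ [])
      k₄ : ∀ N A → suc (N + A + suc A) ≡ suc (suc (N + A * 2))
      k₄ N A = solve (N ∷ A ∷ [])
      k₅ : ∀ A f → A * 2 + suc (suc (suc (f * 2))) ≡ suc ((A + suc f) * 2)
      k₅ A f = solve (A ∷ f ∷ [])

  -- At least `5e + 3` differences are missing. This exceeds `N`, and it exceeds `4e + 1`, which is
  -- enough for either parity.
  finish : ∀ n → 1 ≤ e → N ≤ 5 * e + 2 → N + 5 * e + 3 ≤ n → Graceful js n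
  finish n 1≤e N≤ ≤n with m≤n⇒∃[o]m+o≡n ≤n | m≤n⇒∃[o]m+o≡n 1≤e | m≤n⇒∃[o]m+o≡n N≤
  ... | d , refl | f , e≡ | g , N+g = subst (Graceful js) (trans (cong (λ t → N + t) N+c) (h₀ N e d)) (go (evenOrOdd t) refl)
    where
    t = 5 * e + 3 + d
    c = suc (g + d)
    h₀ : ∀ N e d → N + (5 * e + 3 + d) ≡ N + 5 * e + 3 + d
    h₀ N e d = solve (N ∷ e ∷ d ∷ [])
    N+c : N + c ≡ t
    N+c = trans (h N g d) (trans (cong (λ z → suc (z + d)) N+g) (h′ e d))
      where
      h : ∀ N g d → N + suc (g + d) ≡ suc (N + g + d)
      h N g d = solve (N ∷ g ∷ d ∷ [])
      h′ : ∀ e d → suc (5 * e + 2 + d) ≡ 5 * e + 3 + d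
      h′ e d = solve (e ∷ d ∷ [])
    go : ∀ {s} → EvenOrOdd s → s ≡ t → Graceful js (N + (N + c))
    go (even k) eq with m≤n⇒∃[o]m+o≡n (*-cancelʳ-< 2 e k (subst (e * 2 <_) (sym eq) (≤-by (3 * e + 2 + d) (h e d))))
      where
      h : ∀ e d → suc (e * 2) + (3 * e + 2 + d) ≡ 5 * e + 3 + d
      h e d = solve (e ∷ d ∷ [])
    ... | w , refl = finishEven w c (trans N+c (sym eq))
    go (odd k) eq with m≤n⇒∃[o]m+o≡n (*-cancelʳ-< 2 (e + e) k (s≤s⁻¹ (subst (suc ((e + e) * 2) <_) (sym eq) (≤-by (e + 1 + d) (h e d)))))
      where
      h : ∀ e d → suc (suc ((e + e) * 2)) + (e + 1 + d) ≡ 5 * e + 3 + d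
      h e d = solve (e ∷ d ∷ [])
    ... | w , refl = finishOdd w c f (sym e≡) (trans N+c (trans (sym eq) (cong (λ z → suc (z * 2)) (h e w))))
      where
      h : ∀ e w → suc (e + e + w) ≡ suc (e + w) + e
      h e w = solve (e ∷ w ∷ [])

concatMap⁺ : ∀ {A B : Set} (f : A → List B) {xs ys} → xs ↭ ys → concatMap f xs ↭ concatMap f ys
concatMap⁺ f _↭_.refl = ↭-refl
concatMap⁺ f (_↭_.prep x p) = ++⁺ˡ (f x) (concatMap⁺ f p)
concatMap⁺ f (_↭_.swap x y p) = ↭-trans (shifts (f x) (f y)) (++⁺ˡ (f y) (++⁺ˡ (f x) (concatMap⁺ f p)))
concatMap⁺ f (_↭_.trans p q) = ↭-trans (concatMap⁺ f p) (concatMap⁺ f q)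

-- The construction fixes the order of the cycles, whereas the decision to double or to copy is
-- attached along the given list.
reorder : ∀ {js ks n} → js ↭ ks → Graceful js n → Graceful ks n
reorder {js} {ks} js↭ks G with ↭-map-inv (λ c → length (proj₂ (proj₂ c))) (↭-trans (↭-reflexive (Graceful.lengths G)) (↭-map⁺ (λ j → suc (j * 2)) js↭ks))
... | cs , eq , p = record
  { start = start ; path = path ; cycles = cs ; lengths = sym eq
  ; verts↭ = ↭-trans (++⁺ˡ (start ∷ path) (concatMap⁺ verts (↭-sym p))) verts↭
  ; N = N ; c = c ; n≡ = n≡ ; inner = inner ; steps↭ = steps↭
  ; inner↭ = ↭-trans (++⁺ˡ (0 ∷ inner) (concatMap⁺ cycleSteps (↭-sym p))) inner↭
  }
  where open Graceful G

-- Translations and orbits of edges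

∑ : ∀ {A : Set} → (A → ℕ) → List A → ℕ
∑ f [] = 0
∑ f (x ∷ xs) = f x + ∑ f xs

module _ {A : Set} where
  ∑-++ : ∀ (f : A → ℕ) xs ys → ∑ f (xs ++ ys) ≡ ∑ f xs + ∑ f ys
  ∑-++ f [] ys = refl
  ∑-++ f (x ∷ xs) ys = trans (cong (λ z → f x + z) (∑-++ f xs ys)) (sym (+-assoc (f x) _ _))

  ∑-↭ : ∀ (f : A → ℕ) {xs ys} → xs ↭ ys → ∑ f xs ≡ ∑ f ys
  ∑-↭ f _↭_.refl = refl
  ∑-↭ f (_↭_.prep x p) = cong (λ z → f x + z) (∑-↭ f p)
  ∑-↭ f (_↭_.swap x y p) = trans (cong (λ z → f x + (f y + z)) (∑-↭ f p)) (e (f x) (f y) _)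
    where
    e : ∀ a b c → a + (b + c) ≡ b + (a + c)
    e a b c = solve (a ∷ b ∷ c ∷ [])
  ∑-↭ f (_↭_.trans p q) = trans (∑-↭ f p) (∑-↭ f q)

  ∑-cong : ∀ {f g : A → ℕ} → (∀ x → f x ≡ g x) → ∀ xs → ∑ f xs ≡ ∑ g xs
  ∑-cong e [] = refl
  ∑-cong e (x ∷ xs) = cong₂ _+_ (e x) (∑-cong e xs)

  ∑-0 : ∀ (xs : List A) → ∑ (λ _ → 0) xs ≡ 0
  ∑-0 [] = refl
  ∑-0 (x ∷ xs) = ∑-0 xs

  ∑-+ : ∀ (f g : A → ℕ) xs → ∑ (λ x → f x + g x) xs ≡ ∑ f xs + ∑ g xs
  ∑-+ f g [] = refl
  ∑-+ f g (x ∷ xs) = trans (cong (λ z → f x + g x + z) (∑-+ f g xs)) (e (f x) (g x) _ _)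
    where
    e : ∀ a b c d → a + b + (c + d) ≡ a + c + (b + d)
    e a b c d = solve (a ∷ b ∷ c ∷ d ∷ [])

  ∑-*ʳ : ∀ (f : A → ℕ) k xs → ∑ (λ x → f x * k) xs ≡ ∑ f xs * k
  ∑-*ʳ f k [] = refl
  ∑-*ʳ f k (x ∷ xs) = trans (cong (λ z → f x * k + z) (∑-*ʳ f k xs)) (sym (*-distribʳ-+ k (f x) (∑ f xs)))

∑-map : ∀ {A B : Set} (f : B → ℕ) (g : A → B) xs → ∑ f (map g xs) ≡ ∑ (λ x → f (g x)) xs
∑-map f g [] = refl
∑-map f g (x ∷ xs) = cong (λ z → f (g x) + z) (∑-map f g xs)

∑-swap : ∀ {A B : Set} (f : A → B → ℕ) xs ys → ∑ (λ x → ∑ (f x) ys) xs ≡ ∑ (λ y → ∑ (λ x → f x y) xs) ys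
∑-swap f [] ys = sym (∑-0 ys)
∑-swap f (x ∷ xs) ys = trans (cong (λ z → ∑ (f x) ys + z) (∑-swap f xs ys)) (sym (∑-+ (f x) _ ys))

∑-range-cong : ∀ {f g : ℕ → ℕ} a k → (∀ i → a ≤ i → i < a + k → f i ≡ g i) → ∑ f (range a k) ≡ ∑ g (range a k)
∑-range-cong a zero e = refl
∑-range-cong a (suc k) e = cong₂ _+_ (e a ≤-refl (m<m+n a (s≤s z≤n)))
  (∑-range-cong (suc a) k (λ i a<i i< → e i (<⇒≤ a<i) (subst (i <_) (sym (+-suc a k)) i<)))

∑-range-+ : ∀ (f : ℕ → ℕ) a b k → ∑ f (range (a + b) k) ≡ ∑ (λ i → f (i + b)) (range a k)
∑-range-+ f a b zero = refl
∑-range-+ f a b (suc k) = cong (λ z → f (a + b) + z) (∑-range-+ f (suc a) b k)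

module _ {v : ℕ} where
  ι : Fin v → Fin v → ℕ
  ι a b = if does (a Fin.≟ b) then 1 else 0

  ι-≡ : ∀ {a b} → a ≡ b → ι a b ≡ 1
  ι-≡ {a} {b} e with a Fin.≟ b
  ... | yes _ = refl
  ... | no ne = ⊥-elim (ne e)

  ι-≢ : ∀ {a b} → a ≢ b → ι a b ≡ 0
  ι-≢ {a} {b} ne with a Fin.≟ b
  ... | yes e = ⊥-elim (ne e)
  ... | no _ = refl

  ι-⇔ : ∀ {a b c d} → (a ≡ b → c ≡ d) → (c ≡ d → a ≡ b) → ι a b ≡ ι c d
  ι-⇔ {a} {b} {c} {d} f g with a Fin.≟ b
  ... | yes e = sym (ι-≡ (f e))
  ... | no ne = sym (ι-≢ (λ e → ne (g e)))

  -- Evaluating the second factor at `a` makes it independent of `x`, so it can leave a sum over an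
  -- orbit.
  ι-subst : ∀ (f : Fin v → Fin v) x a b → ι x a * ι (f x) b ≡ ι x a * ι (f a) b
  ι-subst f x a b with x Fin.≟ a
  ... | yes refl = refl
  ... | no _ = refl

  -- Kept as a disjunction because automorphisms are compared at all `a` and `b`, equal ones
  -- included; it splits into a sum of two products only for `a ≢ b`.
  hits : Fin v → Fin v → Fin v × Fin v → ℕ
  hits a b (c , d) = if (does (c Fin.≟ a) ∧ does (d Fin.≟ b)) ∨ (does (c Fin.≟ b) ∧ does (d Fin.≟ a)) then 1 else 0

  hits-flip : ∀ a b c d → hits a b (c , d) ≡ hits a b (d , c)
  hits-flip a b c d = cong (λ t → if t then 1 else 0)
    (trans (∨-comm (does (c Fin.≟ a) ∧ does (d Fin.≟ b)) (does (c Fin.≟ b) ∧ does (d Fin.≟ a)))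
           (cong₂ _∨_ (∧-comm (does (c Fin.≟ b)) (does (d Fin.≟ a))) (∧-comm (does (c Fin.≟ a)) (does (d Fin.≟ b)))))

  hits-≢ : ∀ {a b} → a ≢ b → ∀ c d → hits a b (c , d) ≡ ι c a * ι d b + ι c b * ι d a
  hits-≢ {a} {b} ne c d with c Fin.≟ a | d Fin.≟ b | c Fin.≟ b | d Fin.≟ a
  ... | yes refl | _ | yes refl | _ = ⊥-elim (ne refl)
  ... | yes _ | yes _ | no _ | yes _ = refl
  ... | yes _ | yes _ | no _ | no _ = refl
  ... | yes _ | no _ | no _ | yes _ = refl
  ... | yes _ | no _ | no _ | no _ = refl
  ... | no _ | yes _ | yes _ | yes _ = refl
  ... | no _ | yes _ | yes _ | no _ = refl
  ... | no _ | no _ | yes _ | yes _ = refl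
  ... | no _ | no _ | yes _ | no _ = refl
  ... | no _ | yes _ | no _ | yes _ = refl
  ... | no _ | yes _ | no _ | no _ = refl
  ... | no _ | no _ | no _ | yes _ = refl
  ... | no _ | no _ | no _ | no _ = refl

  pairCount-∷ : ∀ a b c d es → pairCount a b ((c , d) ∷ es) ≡ hits a b (c , d) + pairCount a b es
  pairCount-∷ a b c d es with c Fin.≟ a | d Fin.≟ b | c Fin.≟ b | d Fin.≟ a
  ... | yes _ | yes _ | yes _ | yes _ = refl
  ... | yes _ | yes _ | yes _ | no _ = refl
  ... | yes _ | yes _ | no _ | yes _ = refl
  ... | yes _ | yes _ | no _ | no _ = refl
  ... | yes _ | no _ | yes _ | yes _ = refl
  ... | yes _ | no _ | yes _ | no _ = refl
  ... | yes _ | no _ | no _ | yes _ = refl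
  ... | yes _ | no _ | no _ | no _ = refl
  ... | no _ | yes _ | yes _ | yes _ = refl
  ... | no _ | yes _ | yes _ | no _ = refl
  ... | no _ | no _ | yes _ | yes _ = refl
  ... | no _ | no _ | yes _ | no _ = refl
  ... | no _ | yes _ | no _ | yes _ = refl
  ... | no _ | yes _ | no _ | no _ = refl
  ... | no _ | no _ | no _ | yes _ = refl
  ... | no _ | no _ | no _ | no _ = refl

  pairCount-∑ : ∀ a b es → pairCount a b es ≡ ∑ (hits a b) es
  pairCount-∑ a b [] = refl
  pairCount-∑ a b ((c , d) ∷ es) = trans (pairCount-∷ a b c d es) (cong (λ z → hits a b (c , d) + z) (pairCount-∑ a b es))

tabulate-+ : ∀ {A : Set} m {n} (g : Fin (m + n) → A) → tabulate g ≡ tabulate (λ i → g (i ↑ˡ n)) ++ tabulate (λ i → g (m ↑ʳ i))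
tabulate-+ zero g = refl
tabulate-+ (suc m) g = cong (g Fin.zero ∷_) (tabulate-+ m (λ i → g (Fin.suc i)))

tabulate-toℕ : ∀ {A : Set} k a (h : ℕ → A) → tabulate {n = k} (λ i → h (a + toℕ i)) ≡ map h (range a k)
tabulate-toℕ zero a h = refl
tabulate-toℕ (suc k) a h = cong₂ _∷_ (cong h (+-identityʳ a)) (trans (tabulate-cong (λ i → cong h (+-suc a (toℕ i)))) (tabulate-toℕ k (suc a) h))

-- The vertices are Z_L, L = 2n, and f fixed points.
module Vertices (n₀ f : ℕ) where
  n L : ℕ
  n = suc n₀
  L = n + n

  V : Set
  V = Fin (L + f)

  pt : ℕ → V
  pt x = (x mod L) ↑ˡ f

  ∞ : Fin f → V
  ∞ j = L ↑ʳ j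

  translate : ℕ → Fin L ⊎ Fin f → V
  translate g (inj₁ x) = pt (toℕ x + g)
  translate g (inj₂ j) = ∞ j

  -- Defined for every natural `g`, so that composition is plain addition; it depends on `g` only
  -- modulo `L`.
  τ : ℕ → V → V
  τ g x = translate g (splitAt L x)

  mod-≡ : ∀ x y → x % L ≡ y % L → x mod L ≡ y mod L
  mod-≡ x y e = Fin.toℕ-injective (trans (Fin.toℕ-fromℕ< _) (trans e (sym (Fin.toℕ-fromℕ< _))))

  pt-≡ : ∀ x y → x % L ≡ y % L → pt x ≡ pt y
  pt-≡ x y e = cong (_↑ˡ f) (mod-≡ x y e)

  toℕ-mod : ∀ x → toℕ (x mod L) ≡ x % L
  toℕ-mod x = Fin.toℕ-fromℕ< _

  τ-pt : ∀ g x → τ g (pt x) ≡ pt (x + g)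
  τ-pt g x = trans (cong (translate g) (Fin.splitAt-↑ˡ L (x mod L) f))
    (pt-≡ (toℕ (x mod L) + g) (x + g) (trans (cong (λ t → (t + g) % L) (toℕ-mod x))
      (trans (%-distribˡ-+ (x % L) g L) (trans (cong (λ t → (t + g % L) % L) (m%n%n≡m%n x L)) (sym (%-distribˡ-+ x g L))))))

  τ-∞ : ∀ g j → τ g (∞ j) ≡ ∞ j
  τ-∞ g j = cong (translate g) (Fin.splitAt-↑ʳ L f j)

  pt-+L : ∀ x → pt (x + L) ≡ pt x
  pt-+L x = pt-≡ (x + L) x ([m+n]%n≡m%n x L)

  pt-injective : ∀ {x y} → x < L → y < L → pt x ≡ pt y → x ≡ y
  pt-injective {x} {y} x<L y<L e = trans (sym (m<n⇒m%n≡m x<L)) (trans (sym (toℕ-mod x))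
    (trans (cong toℕ (Fin.↑ˡ-injective f (x mod L) (y mod L) e)) (trans (toℕ-mod y) (m<n⇒m%n≡m y<L))))

  pt≢∞ : ∀ {x j} → pt x ≢ ∞ j
  pt≢∞ {x} {j} e with trans (sym (Fin.splitAt-↑ˡ L (x mod L) f)) (trans (cong (splitAt L) e) (Fin.splitAt-↑ʳ L f j))
  ... | ()

  data View : V → Set where
    point : ∀ x → x < L → View (pt x)
    fixed : ∀ j → View (∞ j)

  pt-toℕ : ∀ i → pt (toℕ i) ≡ i ↑ˡ f
  pt-toℕ i = cong (_↑ˡ f) (Fin.toℕ-injective (trans (toℕ-mod (toℕ i)) (m<n⇒m%n≡m (Fin.toℕ<n i))))

  view : ∀ x → View x
  view x with splitAt L x in eq
  ... | inj₁ i = subst View (trans (pt-toℕ i) (Fin.splitAt⁻¹-↑ˡ eq)) (point (toℕ i) (Fin.toℕ<n i))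
  ... | inj₂ j = subst View (Fin.splitAt⁻¹-↑ʳ eq) (fixed j)

  allVertices : allFin (L + f) ≡ map pt (range 0 L) ++ map ∞ (allFin f)
  allVertices = trans (tabulate-+ L {f} (λ i → i)) (cong₂ _++_
    (trans (tabulate-cong (λ i → sym (pt-toℕ i))) (tabulate-toℕ L 0 pt))
    (sym (map-tabulate (λ i → i) ∞)))

  τ-τ : ∀ g h x → τ g (τ h x) ≡ τ (h + g) x
  τ-τ g h x with view x
  ... | point y _ = trans (cong (τ g) (τ-pt h y)) (trans (τ-pt g (y + h)) (trans (cong pt (+-assoc y h g)) (sym (τ-pt (h + g) y))))
  ... | fixed j = trans (cong (τ g) (τ-∞ h j)) (trans (τ-∞ g j) (sym (τ-∞ (h + g) j)))

  τ-comm : ∀ g h x → τ g (τ h x) ≡ τ h (τ g x)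
  τ-comm g h x = trans (τ-τ g h x) (trans (cong (λ t → τ t x) (+-comm h g)) (sym (τ-τ h g x)))

  τ-0 : ∀ x → τ 0 x ≡ x
  τ-0 x with view x
  ... | point y _ = trans (τ-pt 0 y) (cong pt (+-identityʳ y))
  ... | fixed j = τ-∞ 0 j

  τ-L+ : ∀ g x → τ (g + L) x ≡ τ g x
  τ-L+ g x with view x
  ... | point y _ = trans (τ-pt (g + L) y) (trans (cong pt (sym (+-assoc y g L))) (trans (pt-+L (y + g)) (sym (τ-pt g y))))
  ... | fixed j = trans (τ-∞ (g + L) j) (sym (τ-∞ g j))

  τ-inverse : ∀ g h → g + h ≡ L → ∀ x → τ h (τ g x) ≡ x
  τ-inverse g h e x = trans (τ-τ h g x) (trans (cong (λ t → τ t x) e) (trans (τ-L+ 0 x) (τ-0 x)))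

  τ-% : ∀ g x → τ (g % L) x ≡ τ g x
  τ-% g x with view x
  ... | point y _ = trans (τ-pt (g % L) y) (trans (pt-≡ (y + g % L) (y + g) (trans (%-distribˡ-+ y (g % L) L) (trans (cong (λ t → (y % L + t) % L) (m%n%n≡m%n g L)) (sym (%-distribˡ-+ y g L))))) (sym (τ-pt g y)))
  ... | fixed j = trans (τ-∞ (g % L) j) (sym (τ-∞ g j))

  rotate : ∀ x → map pt (range x L) ↭ map pt (range 0 L)
  rotate zero = ↭-refl
  rotate (suc x) = ↭-trans (↭-reflexive (trans (cong (map pt) (range-∷ʳ (suc x) (n₀ + n))) (trans (map-++ pt (range (suc x) (n₀ + n)) _)
      (cong (λ t → map pt (range (suc x) (n₀ + n)) ++ [ t ]) (trans (cong pt (sym (+-suc x (n₀ + n)))) (pt-+L x))))))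
    (↭-trans (↭-sym (∷↭∷ʳ (pt x) (map pt (range (suc x) (n₀ + n))))) (rotate x))

  map-τ-pt : ∀ g a k → map (τ g) (map pt (range a k)) ≡ map pt (range (a + g) k)
  map-τ-pt g a zero = refl
  map-τ-pt g a (suc k) = cong₂ _∷_ (τ-pt g a) (map-τ-pt g (suc a) k)

  orbit-pt : ∀ x k → map (λ g → τ g (pt x)) (range k L) ≡ map pt (range (x + k) L)
  orbit-pt x k = go k L
    where
    go : ∀ k m → map (λ g → τ g (pt x)) (range k m) ≡ map pt (range (x + k) m)
    go k zero = refl
    go k (suc m) = cong₂ _∷_ (τ-pt k x) (trans (go (suc k) m) (cong (λ t → map pt (range t m)) (+-suc x k)))

  τ-allVertices : ∀ g → map (τ g) (allFin (L + f)) ↭ allFin (L + f)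
  τ-allVertices g = ↭-trans (↭-reflexive (trans (cong (map (τ g)) allVertices) (trans (map-++ (τ g) (map pt (range 0 L)) _)
      (cong₂ _++_ (map-τ-pt g 0 L) (trans (sym (map-∘ (allFin f))) (map-cong (τ-∞ g) (allFin f)))))))
    (↭-trans (++⁺ʳ (map ∞ (allFin f)) (rotate g)) (↭-reflexive (sym allVertices)))

  finite : V → ℕ
  finite a with splitAt L a
  ... | inj₁ _ = 1
  ... | inj₂ _ = 0

  finite-pt : ∀ x → finite (pt x) ≡ 1
  finite-pt x rewrite Fin.splitAt-↑ˡ L (x mod L) f = refl

  finite-∞ : ∀ j → finite (∞ j) ≡ 0
  finite-∞ j rewrite Fin.splitAt-↑ʳ L f j = refl

  count-pt : ∀ a → a < L → ∑ (λ g → ι (pt g) (pt a)) (range 0 L) ≡ 1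
  count-pt a a<L with m≤n⇒∃[o]m+o≡n a<L
  ... | d , e = trans (cong (∑ F) (trans (cong (range 0) (trans (sym e) (sym (+-suc a d)))) (sym (range-++ 0 a refl))))
    (trans (∑-++ F (range 0 a) (range a (suc d)))
      (cong₂ _+_ (trans (∑-range-cong {F} {λ _ → 0} 0 a (λ i _ i<a → ι-≢ (λ q → <⇒≢ i<a (pt-injective (<-trans i<a a<L) a<L q)))) (∑-0 (range 0 a)))
        (cong₂ _+_ (ι-≡ {a = pt a} refl) (trans (∑-range-cong {F} {λ _ → 0} (suc a) d (λ i a<i i< → ι-≢ (λ q → <⇒≢ a<i (sym (pt-injective (subst (i <_) e i<) a<L q))))) (∑-0 (range (suc a) d))))))
    where
    F : ℕ → ℕ
    F g = ι (pt g) (pt a)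

  -- `L` consecutive numbers meet every residue once, wherever they start.
  orbit : ∀ x a → ∑ (λ g → ι (τ g (pt x)) a) (range 0 L) ≡ finite a
  orbit x a = trans (sym (∑-map (λ u → ι u a) (λ g → τ g (pt x)) (range 0 L)))
    (trans (cong (∑ (λ u → ι u a)) (trans (orbit-pt x 0) (cong (λ t → map pt (range t L)) (+-identityʳ x))))
    (trans (∑-↭ (λ u → ι u a) (rotate x)) (trans (∑-map (λ u → ι u a) pt (range 0 L)) (go (view a)))))
    where
    go : ∀ {a} → View a → ∑ (λ g → ι (pt g) a) (range 0 L) ≡ finite a
    go (point y y<L) = trans (count-pt y y<L) (sym (finite-pt y))
    go (fixed j) = trans (∑-cong {f = λ g → ι (pt g) (∞ j)} {λ _ → 0} (λ g → ι-≢ (pt≢∞ {g} {j})) (range 0 L)) (trans (∑-0 (range 0 L)) (sym (finite-∞ j)))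

-- Equality of multisets of unordered edges: order and orientation disappear in sums of symmetric
-- weights. With `hits a b` after a translation as weight it becomes an equality of multiplicities.
SameEdges : ∀ {A : Set} → List (A × A) → List (A × A) → Set
SameEdges {A} es es′ = ∀ (W : A × A → ℕ) → (∀ c d → W (c , d) ≡ W (d , c)) → ∑ W es ≡ ∑ W es′

∈-range : ∀ a k i → a ≤ i → i < a + k → i ∈ range a k
∈-range a zero i a≤i i<a = ⊥-elim (<⇒≱ i<a (subst (_≤ i) (sym (+-identityʳ a)) a≤i))
∈-range a (suc k) i a≤i i< with m≤n⇒m<n∨m≡n a≤i
... | inj₁ a<i = Any.there (∈-range (suc a) k i a<i (subst (i <_) (+-suc a k) i<))
... | inj₂ refl = Any.here refl

both : ∀ {A B : Set} → (A → B) → A × A → B × B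
both h (x , y) = h x , h y

zip-map : ∀ {A B : Set} (h : A → B) xs ys → zip (map h xs) (map h ys) ≡ map (both h) (zip xs ys)
zip-map h [] ys = refl
zip-map h (x ∷ xs) [] = refl
zip-map h (x ∷ xs) (y ∷ ys) = cong (_ ∷_) (zip-map h xs ys)

cycleEdges-map : ∀ {v} (h : Fin v → Fin v) c → cycleEdges (map h c) ≡ map (both h) (cycleEdges c)
cycleEdges-map h [] = refl
cycleEdges-map h (x ∷ xs) = trans (cong (zip (h x ∷ map h xs)) (sym (map-++ h xs [ x ]))) (zip-map h (x ∷ xs) (xs ++ [ x ]))

factorEdges-map : ∀ {v} (h : Fin v → Fin v) C → factorEdges (mapFactor h C) ≡ map (both h) (factorEdges C)
factorEdges-map h C = trans (concatMap-map cycleEdges (map h) C) (trans (concatMap-cong (cycleEdges-map h) C) (sym (map-concatMap (both h) cycleEdges C)))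

∑-sum : ∀ {A : Set} (f : A → ℕ) xs → sum (map f xs) ≡ ∑ f xs
∑-sum f [] = refl
∑-sum f (x ∷ xs) = cong (λ z → f x + z) (∑-sum f xs)

-- Multiplicities in the union of the translates

module Counting (n₀ f : ℕ) where
  open Vertices n₀ f public

  shiftEdge : ℕ → V × V → V × V
  shiftEdge g = both (τ g)

  ι-∞-pt : ∀ j x → ι (∞ j) (pt x) ≡ 0
  ι-∞-pt j x = ι-≢ (λ q → pt≢∞ {x} {j} (sym q))

  ι-pt-∞ : ∀ δ x j → ι (τ δ (pt x)) (∞ j) ≡ 0
  ι-pt-∞ δ x j = ι-≢ (λ q → pt≢∞ {x + δ} {j} (trans (sym (τ-pt δ x)) q))

  antipode≢ : ∀ x → τ n (pt x) ≢ pt x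
  antipode≢ x q = go (view (pt x)) refl
    where
    go : ∀ {y} → View y → y ≢ pt x
    go (fixed j) e = pt≢∞ {x} {j} (sym e)
    go (point y y<L) e with y <? n
    ... | yes y<n = <⇒≢ (m<m+n y (s≤s z≤n)) (sym (pt-injective (+-monoˡ-< n y<n) y<L (trans (sym (τ-pt n y)) (trans (cong (τ n) e) (trans q (sym e))))))
    ... | no y≮n with m≤n⇒∃[o]m+o≡n (≮⇒≥ y≮n)
    ... | z , refl = <⇒≢ (m<n+m z {n} (s≤s z≤n)) (pt-injective (≤-<-trans (m≤n+m z n) y<L) y<L
            (trans (sym (pt-+L z)) (trans (cong pt (h z n)) (trans (sym (τ-pt n (n + z))) (trans (cong (τ n) e) (trans q (sym e)))))))
      where
      h : ∀ z n → z + (n + n) ≡ n + z + n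
      h z n = solve (z ∷ n ∷ [])

  data Class : V × V → ℕ → Set where
    forward  : ∀ x δ → Class (pt x , pt (x + δ)) δ
    backward : ∀ x δ → Class (pt (x + δ) , pt x) δ

  module _ {a b : V} (a≢b : a ≢ b) where

    orbitCount : V × V → ℕ
    orbitCount e = ∑ (λ g → hits a b (shiftEdge g e)) (range 0 L)

    private
      pairSum : ∀ x h → ∑ (λ g → ι (τ g (pt x)) a * ι (τ h (τ g (pt x))) b + ι (τ g (pt x)) b * ι (τ h (τ g (pt x))) a) (range 0 L)
                ≡ finite a * ι (τ h a) b + finite b * ι (τ h b) a
      pairSum x h = trans (∑-cong (λ g → cong₂ _+_ (ι-subst (τ h) (τ g (pt x)) a b) (ι-subst (τ h) (τ g (pt x)) b a)) (range 0 L))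
        (trans (∑-+ (λ g → ι (τ g (pt x)) a * ι (τ h a) b) (λ g → ι (τ g (pt x)) b * ι (τ h b) a) (range 0 L))
          (cong₂ _+_ (trans (∑-*ʳ (λ g → ι (τ g (pt x)) a) (ι (τ h a) b) (range 0 L)) (cong (_* ι (τ h a) b) (orbit x a)))
                     (trans (∑-*ʳ (λ g → ι (τ g (pt x)) b) (ι (τ h b) a) (range 0 L)) (cong (_* ι (τ h b) a) (orbit x b)))))

      move : ∀ g x δ → τ g (pt (x + δ)) ≡ τ δ (τ g (pt x))
      move g x δ = trans (cong (τ g) (sym (τ-pt δ x))) (τ-comm g δ (pt x))

      forwardCount : ∀ x δ → orbitCount (pt x , pt (x + δ)) ≡ finite a * ι (τ δ a) b + finite b * ι (τ δ b) a
      forwardCount x δ = trans (∑-cong (λ g → trans (hits-≢ a≢b (τ g (pt x)) (τ g (pt (x + δ))))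
          (cong (λ t → ι (τ g (pt x)) a * ι t b + ι (τ g (pt x)) b * ι t a) (move g x δ))) (range 0 L)) (pairSum x δ)

    -- As `g` runs through the group, the edge lands on `{a, b}` once if `a + δ = b` and once if
    -- `b + δ = a`; a fixed point is never met.
    classCount : ∀ {e δ} → Class e δ → orbitCount e ≡ finite a * ι (τ δ a) b + finite b * ι (τ δ b) a
    classCount (forward x δ) = forwardCount x δ
    classCount (backward x δ) = trans (∑-cong (λ g → hits-flip a b (τ g (pt (x + δ))) (τ g (pt x))) (range 0 L)) (forwardCount x δ)

    fixedCount : ∀ j x → orbitCount (∞ j , pt x) ≡ ι (∞ j) a * finite b + ι (∞ j) b * finite a
    fixedCount j x = trans (∑-cong (λ g → trans (hits-≢ a≢b (τ g (∞ j)) (τ g (pt x)))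
        (trans (cong (λ t → ι t a * ι (τ g (pt x)) b + ι t b * ι (τ g (pt x)) a) (τ-∞ g j))
               (cong₂ _+_ (*-comm (ι (∞ j) a) _) (*-comm (ι (∞ j) b) _)))) (range 0 L))
      (trans (∑-+ (λ g → ι (τ g (pt x)) b * ι (∞ j) a) (λ g → ι (τ g (pt x)) a * ι (∞ j) b) (range 0 L))
        (cong₂ _+_ (trans (∑-*ʳ (λ g → ι (τ g (pt x)) b) (ι (∞ j) a) (range 0 L)) (trans (cong (_* ι (∞ j) a) (orbit x b)) (*-comm (finite b) _)))
                   (trans (∑-*ʳ (λ g → ι (τ g (pt x)) a) (ι (∞ j) b) (range 0 L)) (trans (cong (_* ι (∞ j) b) (orbit x a)) (*-comm (finite a) _)))))

    -- An edge `{x, x + n}` has only `n` translates. The reversed match at `g` is the direct match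
    -- at `g + n`, so counting both over half the range amounts to counting one over the full orbit.
    diameterCount : ∀ x → ∑ (λ g → hits a b (shiftEdge g (pt x , τ n (pt x)))) (range 0 n) ≡ finite a * ι (τ n a) b
    diameterCount x = trans (∑-cong (λ g → trans (hits-≢ a≢b (τ g (pt x)) (τ g (τ n (pt x))))
        (cong₂ (λ s t → ι (τ g (pt x)) a * ι s b + t) (τ-comm g n (pt x)) (second g))) (range 0 n))
      (trans (∑-+ F (λ g → F (g + n)) (range 0 n))
      (trans (cong (λ z → ∑ F (range 0 n) + z) (sym (∑-range-+ F 0 n n)))
      (trans (sym (∑-++ F (range 0 n) (range n n)))
      (trans (cong (∑ F) (range-++ 0 n refl))
      (trans (∑-cong (λ g → ι-subst (τ n) (τ g (pt x)) a b) (range 0 L))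
      (trans (∑-*ʳ (λ g → ι (τ g (pt x)) a) (ι (τ n a) b) (range 0 L)) (cong (_* ι (τ n a) b) (orbit x a))))))))
      where
      F : ℕ → ℕ
      F g = ι (τ g (pt x)) a * ι (τ n (τ g (pt x))) b
      back : ∀ g → τ n (τ (g + n) (pt x)) ≡ τ g (pt x)
      back g = trans (cong (τ n) (sym (τ-τ n g (pt x)))) (τ-inverse n n refl (τ g (pt x)))
      second : ∀ g → ι (τ g (pt x)) b * ι (τ g (τ n (pt x))) a ≡ F (g + n)
      second g = trans (*-comm (ι (τ g (pt x)) b) _) (cong₂ (λ s t → ι s a * ι t b)
        (trans (τ-comm g n (pt x)) (τ-τ n g (pt x))) (sym (back g)))

  -- `b + δ = a` means `a + (2n - δ) = b`. The terms therefore run through all differences 1, ...,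
  -- 2n - 1, and exactly one of these leads from `a` to `b`.
  differences : ∀ {a b} → a ≢ b → finite a ≡ 1 → finite b ≡ 1 →
    ∑ (λ δ → finite a * ι (τ δ a) b + finite b * ι (τ δ b) a) (range 1 n₀) + ι (τ n a) b ≡ 1
  differences {a} {b} a≢b fa fb = trans (cong (_+ ι (τ n a) b) (trans (∑-cong (λ δ → cong₂ (λ s t → s * ι (τ δ a) b + t * ι (τ δ b) a) fa fb) (range 1 n₀))
      (trans (∑-+ (λ δ → 1 * ι (τ δ a) b) (λ δ → 1 * ι (τ δ b) a) (range 1 n₀))
        (cong₂ _+_ (∑-cong (λ δ → *-identityˡ (ι (τ δ a) b)) (range 1 n₀))
          (trans (∑-range-cong {λ δ → 1 * ι (τ δ b) a} {λ δ → G (n + n ∸ δ)} 1 n₀ (λ δ _ δ< → trans (*-identityˡ _) (opposite δ (≤-trans (<⇒≤ δ<) (m≤m+n n n)))))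
                 (sym (trans (∑-↭ G (range-reverse n 1 n₀)) (∑-map G (n + n ∸_) (range 1 n₀)))))))))
    (trans (e (∑ G (range 1 n₀)) (∑ G (range (suc n) n₀)) (ι (τ n a) b)) whole)
    where
    G : ℕ → ℕ
    G δ = ι (τ δ a) b
    e : ∀ x y z → x + y + z ≡ x + (z + y)
    e x y z = solve (x ∷ y ∷ z ∷ [])
    opposite : ∀ δ → δ ≤ L → ι (τ δ b) a ≡ G (L ∸ δ)
    opposite δ δ≤ = ι-⇔ (λ q → trans (cong (τ (L ∸ δ)) (sym q)) (τ-inverse δ (L ∸ δ) (m+[n∸m]≡n δ≤) b))
                        (λ q → trans (cong (τ δ) (sym q)) (τ-inverse (L ∸ δ) δ (m∸n+n≡m δ≤) a))
    point-orbit : ∀ {x} → View x → finite x ≡ 1 → ∑ (λ g → ι (τ g x) b) (range 0 L) ≡ 1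
    point-orbit (point y _) _ = trans (orbit y b) fb
    point-orbit (fixed j) q with trans (sym (finite-∞ j)) q
    ... | ()
    whole : ∑ G (range 1 n₀) + ∑ G (range n n) ≡ 1
    whole = trans (sym (∑-++ G (range 1 n₀) (range n n))) (trans (cong (∑ G) (range-++ 1 n₀ {n} refl))
      (trans (cong (_+ ∑ G (range 1 (n₀ + n))) (sym (ι-≢ (λ q → a≢b (trans (sym (τ-0 a)) q))))) (point-orbit (view a) fa)))

  -- A factor consisting of half, its translate by n, and some edges {x , x + n}, which are fixed by that translation.
  record BaseFactor (lens : List ℕ) : Set where
    field
      factor    : Factor (L + f)
      edges     : List (V × V)
      classes   : List ℕ
      spokes    : List (Fin f × ℕ)
      diameters : List ℕ
      isCopy    : IsCopyOf lens factor
      class     : Pointwise Class edges classes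
      classes↭  : classes ↭ range 1 n₀
      hub       : ∀ i → ∑ (λ s → ι (∞ (proj₁ s)) (∞ i)) spokes ≡ 1
    half : List (V × V)
    half = edges ++ map (λ s → ∞ (proj₁ s) , pt (proj₂ s)) spokes
    field
      factorEdges≈ : SameEdges (factorEdges factor) (half ++ map (shiftEdge n) half ++ map (λ x → pt x , τ n (pt x)) diameters)

  module _ {lens} (B : BaseFactor lens) where
    open BaseFactor B

    -- Only `n` of the `2n` translations occur: by `shifted-+n` the others repeat the same factors.
    -- Hence the remainder modulo `n` rather than `L` in `isAutGroup`.
    translates : List (Factor (L + f))
    translates = map (λ g → mapFactor (τ g) factor) (range 0 n)

    group : List (V → V)
    group = map τ (range 0 L)

    shifted : (V × V → ℕ) → ℕ → ℕ
    shifted W g = ∑ (λ e → W (shiftEdge g e)) (factorEdges factor)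

    module _ (W : V × V → ℕ) (sym-W : ∀ c d → W (c , d) ≡ W (d , c)) where
      shifted-split : ∀ g → shifted W g ≡ ∑ (λ e → W (shiftEdge g e)) half + ∑ (λ e → W (shiftEdge (g + n) e)) half
                                           + ∑ (λ x → W (shiftEdge g (pt x , τ n (pt x)))) diameters
      shifted-split g = trans (factorEdges≈ (λ e → W (shiftEdge g e)) (λ c d → sym-W (τ g c) (τ g d)))
        (trans (∑-++ W′ half _) (trans (cong (λ z → ∑ W′ half + z) (trans (∑-++ W′ (map (shiftEdge n) half) _)
            (cong₂ _+_ (trans (∑-map W′ (shiftEdge n) half) (∑-cong (λ e → cong W (twice e)) half)) (∑-map W′ (λ x → pt x , τ n (pt x)) diameters))))
          (sym (+-assoc (∑ W′ half) _ _))))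
        where
        W′ : V × V → ℕ
        W′ e = W (shiftEdge g e)
        twice : ∀ e → shiftEdge g (shiftEdge n e) ≡ shiftEdge (g + n) e
        twice (c , d) = cong₂ _,_ (trans (τ-comm g n c) (τ-τ n g c)) (trans (τ-comm g n d) (τ-τ n g d))

      -- Translation by `n` exchanges the two halves and reverses the diameters; the reversal is
      -- where symmetry of `W` enters.
      shifted-+n : ∀ g → shifted W (g + n) ≡ shifted W g
      shifted-+n g = trans (shifted-split (g + n)) (trans (cong₂ _+_
          (trans (cong (λ z → ∑ (λ e → W (shiftEdge (g + n) e)) half + z) (∑-cong (λ e → cong W (full e)) half)) (+-comm (∑ (λ e → W (shiftEdge (g + n) e)) half) _))
          (∑-cong (λ x → trans (cong W (flip x)) (sym-W _ _)) diameters)) (sym (shifted-split g)))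
        where
        full₁ : ∀ c → τ (g + n + n) c ≡ τ g c
        full₁ c = trans (cong (λ t → τ t c) (+-assoc g n n)) (τ-L+ g c)
        full : ∀ e → shiftEdge (g + n + n) e ≡ shiftEdge g e
        full (c , d) = cong₂ _,_ (full₁ c) (full₁ d)
        flip : ∀ x → shiftEdge (g + n) (pt x , τ n (pt x)) ≡ (τ g (τ n (pt x)) , τ g (pt x))
        flip x = cong₂ _,_ (sym (trans (τ-comm g n (pt x)) (τ-τ n g (pt x))))
                           (trans (τ-comm (g + n) n (pt x)) (trans (τ-τ n (g + n) (pt x)) (full₁ (pt x))))

      shifted-+kn : ∀ g k → shifted W (g + k * n) ≡ shifted W g
      shifted-+kn g zero = cong (shifted W) (+-identityʳ g)
      shifted-+kn g (suc k) = trans (cong (shifted W) (e g n (k * n))) (trans (shifted-+n (g + k * n)) (shifted-+kn g k))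
        where
        e : ∀ g n k → g + (n + k) ≡ g + k + n
        e g n k = solve (g ∷ n ∷ k ∷ [])

      shifted-% : ∀ g → shifted W (g % n) ≡ shifted W g
      shifted-% g = trans (sym (shifted-+kn (g % n) (g / n))) (cong (shifted W) (sym (m≡m%n+[m/n]*n g n)))

    edgeMult-shift : ∀ g a b → edgeMult (mapFactor (τ g) factor) a b ≡ shifted (hits a b) g
    edgeMult-shift g a b = trans (pairCount-∑ a b (factorEdges (mapFactor (τ g) factor))) (trans (cong (∑ (hits a b)) (factorEdges-map (τ g) factor)) (∑-map (hits a b) (both (τ g)) (factorEdges factor)))

    multiplicity : V → V → ℕ
    multiplicity a b = sum (map (λ C → edgeMult C a b) translates)

    -- The half and its translate by `n`, moved by `n` translations, form the full orbit of the half
    -- under the group, so the orbit counts apply edge by edge.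
    multiplicity-≡ : ∀ {a b} (a≢b : a ≢ b) → multiplicity a b ≡
      ∑ (λ δ → finite a * ι (τ δ a) b + finite b * ι (τ δ b) a) (range 1 n₀)
      + ∑ (λ s → ι (∞ (proj₁ s)) a * finite b + ι (∞ (proj₁ s)) b * finite a) spokes
      + length diameters * (finite a * ι (τ n a) b)
    multiplicity-≡ {a} {b} a≢b = trans (∑-sum (λ C → edgeMult C a b) translates) (trans (∑-map (λ C → edgeMult C a b) (λ g → mapFactor (τ g) factor) (range 0 n))
      (trans (∑-cong (λ g → trans (edgeMult-shift g a b) (shifted-split H (hits-flip a b) g)) (range 0 n))
      (trans (∑-+ (λ g → P g + P (g + n)) Q (range 0 n))
        (cong₂ _+_
          (trans (∑-+ P (λ g → P (g + n)) (range 0 n)) (trans (cong (λ z → ∑ P (range 0 n) + z) (sym (∑-range-+ P 0 n n)))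
            (trans (sym (∑-++ P (range 0 n) (range n n))) (trans (cong (∑ P) (range-++ 0 n refl))
            (trans (∑-swap (λ g e → H (shiftEdge g e)) (range 0 L) half) (trans (∑-++ (orbitCount a≢b) edges _)
              (cong₂ _+_ (trans (edgesCount class) (∑-↭ φ classes↭))
                         (trans (∑-map (orbitCount a≢b) (λ s → ∞ (proj₁ s) , pt (proj₂ s)) spokes) (∑-cong (λ s → fixedCount a≢b (proj₁ s) (proj₂ s)) spokes)))))))))
          (trans (∑-swap (λ g x → H (shiftEdge g (pt x , τ n (pt x)))) (range 0 n) diameters)
            (trans (∑-cong (diameterCount a≢b) diameters) (constant (finite a * ι (τ n a) b) diameters)))))))
      where
      H = hits a b
      P Q φ : ℕ → ℕ
      P g = ∑ (λ e → H (shiftEdge g e)) half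
      Q g = ∑ (λ x → H (shiftEdge g (pt x , τ n (pt x)))) diameters
      φ δ = finite a * ι (τ δ a) b + finite b * ι (τ δ b) a
      edgesCount : ∀ {es δs} → Pointwise Class es δs → ∑ (orbitCount a≢b) es ≡ ∑ φ δs
      edgesCount Pointwise.[] = refl
      edgesCount (c Pointwise.∷ cs) = cong₂ _+_ (classCount a≢b c) (edgesCount cs)
      constant : ∀ {A : Set} k (xs : List A) → ∑ (λ _ → k) xs ≡ length xs * k
      constant k [] = refl
      constant k (x ∷ xs) = cong (λ z → k + z) (constant k xs)

    -- The differences 1, ..., n - 1 miss the edge `{x, x + n}`; adding its indicator on the left
    -- avoids a truncated subtraction. With 0, 1 or 2 diameters this edge gets multiplicity 0, 1 or
    -- 2.
    point-point : ∀ x y → pt x ≢ pt y → multiplicity (pt x) (pt y) + ι (τ n (pt x)) (pt y) ≡ 1 + length diameters * ι (τ n (pt x)) (pt y)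
    point-point x y ne = trans (cong (_+ ι (τ n (pt x)) (pt y)) (multiplicity-≡ ne))
      (trans (cong₂ (λ s t → A + s + length diameters * t + ι (τ n (pt x)) (pt y)) no-spoke (trans (cong (_* ι (τ n (pt x)) (pt y)) (finite-pt x)) (*-identityˡ _)))
      (trans (e A (length diameters * ι (τ n (pt x)) (pt y)) (ι (τ n (pt x)) (pt y)))
        (cong (_+ length diameters * ι (τ n (pt x)) (pt y)) (differences ne (finite-pt x) (finite-pt y)))))
      where
      A = ∑ (λ δ → finite (pt x) * ι (τ δ (pt x)) (pt y) + finite (pt y) * ι (τ δ (pt y)) (pt x)) (range 1 n₀)
      e : ∀ a d i → a + 0 + d + i ≡ a + i + d
      e a d i = solve (a ∷ d ∷ i ∷ [])
      no-spoke : ∑ (λ s → ι (∞ (proj₁ s)) (pt x) * finite (pt y) + ι (∞ (proj₁ s)) (pt y) * finite (pt x)) spokes ≡ 0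
      no-spoke = trans (∑-cong (λ s → cong₂ (λ p q → p * finite (pt y) + q * finite (pt x)) (ι-∞-pt (proj₁ s) x) (ι-∞-pt (proj₁ s) y)) spokes) (∑-0 spokes)

    no-class : ∀ a b → finite a * finite b ≡ 0 → ∀ δ → finite a * ι (τ δ a) b + finite b * ι (τ δ b) a ≡ 0
    no-class a b q δ = go (view a) (view b) q
      where
      go : ∀ {a b} → View a → View b → finite a * finite b ≡ 0 → finite a * ι (τ δ a) b + finite b * ι (τ δ b) a ≡ 0
      go (point x _) (point y _) q with trans (sym q) (cong₂ _*_ (finite-pt x) (finite-pt y))
      ... | ()
      go (point x _) (fixed j) _ = cong₂ _+_ (trans (cong (finite (pt x) *_) (ι-pt-∞ δ x j)) (*-zeroʳ (finite (pt x))))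
                                             (cong (_* ι (τ δ (∞ j)) (pt x)) (finite-∞ j))
      go (fixed i) (point y _) _ = cong₂ _+_ (cong (_* ι (τ δ (∞ i)) (pt y)) (finite-∞ i))
                                             (trans (cong (finite (pt y) *_) (ι-pt-∞ δ y i)) (*-zeroʳ (finite (pt y))))
      go (fixed i) (fixed j) _ = cong₂ _+_ (cong (_* ι (τ δ (∞ i)) (∞ j)) (finite-∞ i)) (cong (_* ι (τ δ (∞ j)) (∞ i)) (finite-∞ j))

    fixed-point : ∀ i y → multiplicity (∞ i) (pt y) ≡ 1
    fixed-point i y = trans (multiplicity-≡ {∞ i} {pt y} (λ q → pt≢∞ {y} {i} (sym q))) (cong₂ _+_ (cong₂ _+_
        (trans (∑-cong (no-class (∞ i) (pt y) (cong (_* finite (pt y)) (finite-∞ i))) (range 1 n₀)) (∑-0 (range 1 n₀)))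
        (trans (∑-cong (λ s → trans (cong₂ (λ p q → ι (∞ (proj₁ s)) (∞ i) * p + ι (∞ (proj₁ s)) (pt y) * q) (finite-pt y) (finite-∞ i)) (trans (cong₂ _+_ (*-identityʳ (ι (∞ (proj₁ s)) (∞ i))) (*-zeroʳ (ι (∞ (proj₁ s)) (pt y)))) (+-identityʳ _))) spokes) (hub i)))
        (trans (cong (λ t → length diameters * (t * ι (τ n (∞ i)) (pt y))) (finite-∞ i)) (*-zeroʳ (length diameters))))

    point-fixed : ∀ x j → multiplicity (pt x) (∞ j) ≡ 1
    point-fixed x j = trans (multiplicity-≡ {pt x} {∞ j} (pt≢∞ {x} {j})) (cong₂ _+_ (cong₂ _+_
        (trans (∑-cong (no-class (pt x) (∞ j) (trans (cong (finite (pt x) *_) (finite-∞ j)) (*-zeroʳ (finite (pt x))))) (range 1 n₀)) (∑-0 (range 1 n₀)))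
        (trans (∑-cong (λ s → trans (cong₂ (λ p q → ι (∞ (proj₁ s)) (pt x) * p + ι (∞ (proj₁ s)) (∞ j) * q) (finite-∞ j) (finite-pt x)) (trans (cong₂ _+_ (*-zeroʳ (ι (∞ (proj₁ s)) (pt x))) (*-identityʳ (ι (∞ (proj₁ s)) (∞ j)))) refl)) spokes) (hub j)))
        (trans (cong (length diameters *_) (trans (cong (finite (pt x) *_) (ι-pt-∞ n x j)) (*-zeroʳ (finite (pt x))))) (*-zeroʳ (length diameters))))

    fixed-fixed : ∀ {i j} → ∞ i ≢ ∞ j → multiplicity (∞ i) (∞ j) ≡ 0
    fixed-fixed {i} {j} ne = trans (multiplicity-≡ ne) (cong₂ _+_ (cong₂ _+_
        (trans (∑-cong (no-class (∞ i) (∞ j) (cong (_* finite (∞ j)) (finite-∞ i))) (range 1 n₀)) (∑-0 (range 1 n₀)))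
        (trans (∑-cong (λ s → trans (cong₂ (λ p q → ι (∞ (proj₁ s)) (∞ i) * p + ι (∞ (proj₁ s)) (∞ j) * q) (finite-∞ j) (finite-∞ i)) (cong₂ _+_ (*-zeroʳ (ι (∞ (proj₁ s)) (∞ i))) (*-zeroʳ (ι (∞ (proj₁ s)) (∞ j))))) spokes) (∑-0 spokes)))
        (trans (cong (λ t → length diameters * (t * ι (τ n (∞ i)) (∞ j))) (finite-∞ i)) (*-zeroʳ (length diameters))))

    ∈-group : ∀ {P : (V → V) → Set} g → P (τ (g % L)) → Any P group
    ∈-group g p = Any.map (λ { refl → p }) (∈-map⁺ τ (∈-range 0 L (g % L) z≤n (m%n<n g L)))

    isPermGroup : IsPermGroup group
    isPermGroup = ∈-group 0 τ-0 , closed , inverse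
      where
      closed : ∀ {g h} → g ∈ group → h ∈ group → Any (λ k → ∀ x → k x ≡ g (h x)) group
      closed g∈ h∈ with ∈-map⁻ τ g∈ | ∈-map⁻ τ h∈
      ... | i , _ , refl | j , _ , refl = ∈-group (j + i) (λ x → trans (τ-% (j + i) x) (sym (τ-τ i j x)))
      inverse : ∀ {g} → g ∈ group → Any (λ k → ∀ x → k (g x) ≡ x) group
      inverse g∈ with ∈-map⁻ τ g∈
      ... | i , _ , refl = ∈-group (L ∸ i % L) (λ x → trans (τ-% (L ∸ i % L) (τ i x)) (trans (cong (τ (L ∸ i % L)) (sym (τ-% i x)))
              (τ-inverse (i % L) (L ∸ i % L) (m+[n∸m]≡n (<⇒≤ (m%n<n i L))) x)))

    isAutGroup : IsAutGroup translates group
    isAutGroup g∈ C∈ with ∈-map⁻ τ g∈ | ∈-map⁻ (λ g → mapFactor (τ g) factor) C∈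
    ... | i , _ , refl | j , _ , refl = Any.map (λ { refl → same }) (∈-map⁺ (λ g → mapFactor (τ g) factor) (∈-range 0 n ((j + i) % n) z≤n (m%n<n (j + i) n)))
      where
      compose : mapFactor (τ i) (mapFactor (τ j) factor) ≡ mapFactor (τ (j + i)) factor
      compose = trans (sym (map-∘ factor)) (map-cong (λ c → trans (sym (map-∘ c)) (map-cong (τ-τ i j) c)) factor)
      same : ∀ a b → edgeMult (mapFactor (τ i) (mapFactor (τ j) factor)) a b ≡ edgeMult (mapFactor (τ ((j + i) % n)) factor) a b
      same a b = trans (cong (λ C → edgeMult C a b) compose) (trans (edgeMult-shift (j + i) a b)
        (trans (sym (shifted-% (hits a b) (hits-flip a b) (j + i))) (sym (edgeMult-shift ((j + i) % n) a b))))

    fixed-∞ : ∀ j → FixedBy group (∞ j)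
    fixed-∞ j = All.map⁺ (All.universal (λ g → τ-∞ g j) (range 0 L))

    moved-pt : ∀ x → ¬ FixedBy group (pt x)
    moved-pt x fx = antipode≢ x (All.lookup fx (∈-map⁺ τ (∈-range 0 L n z≤n (m<m+n n (s≤s z≤n)))))

    fixedCount≡ : length (filter (fixedBy? group) (allFin (L + f))) ≡ f
    fixedCount≡ = trans (cong length (trans (cong (filter (fixedBy? group)) allVertices) (trans (filter-++ (fixedBy? group) (map pt (range 0 L)) _)
        (cong₂ _++_ (filter-none (fixedBy? group) (All.map⁺ (All.universal moved-pt (range 0 L))))
                    (filter-all (fixedBy? group) (All.map⁺ (All.universal fixed-∞ (allFin f))))))))
      (trans (length-map ∞ (allFin f)) (length-tabulate (λ i → i)))

    reach : ∀ a b → a < L → τ (b + (L ∸ a)) (pt a) ≡ pt b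
    reach a b a<L = trans (τ-pt (b + (L ∸ a)) a) (trans (cong pt (trans (e a b (L ∸ a)) (cong (λ z → b + z) (m+[n∸m]≡n (<⇒≤ a<L))))) (pt-+L b))
      where
      e : ∀ a b c → a + (b + c) ≡ b + (a + c)
      e a b c = solve (a ∷ b ∷ c ∷ [])

    sharplyTransitive : ∀ x y → ¬ FixedBy group x → ¬ FixedBy group y →
      Any (λ g → g x ≡ y) group × (∀ {g g'} → g ∈ group → g' ∈ group → g x ≡ y → g' x ≡ y → ∀ z → g z ≡ g' z)
    sharplyTransitive x y ¬x ¬y = go (view x) (view y) ¬x ¬y
      where
      go : ∀ {x y} → View x → View y → ¬ FixedBy group x → ¬ FixedBy group y →
        Any (λ g → g x ≡ y) group × (∀ {g g'} → g ∈ group → g' ∈ group → g x ≡ y → g' x ≡ y → ∀ z → g z ≡ g' z)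
      go (fixed j) _ ¬x _ = ⊥-elim (¬x (fixed-∞ j))
      go (point _ _) (fixed j) _ ¬y = ⊥-elim (¬y (fixed-∞ j))
      go (point a a<L) (point b b<L) _ _ = ∈-group (b + (L ∸ a)) (trans (τ-% (b + (L ∸ a)) (pt a)) (reach a b a<L)) , unique
        where
        unique : ∀ {g g'} → g ∈ group → g' ∈ group → g (pt a) ≡ pt b → g' (pt a) ≡ pt b → ∀ z → g z ≡ g' z
        unique g∈ g'∈ p q z with ∈-map⁻ τ g∈ | ∈-map⁻ τ g'∈
        ... | i , _ , refl | j , _ , refl = at (view z)
          where
          at : ∀ {z} → View z → τ i z ≡ τ j z
          at (fixed k) = trans (τ-∞ i k) (sym (τ-∞ j k))
          -- Translations commute, so two that agree at `pt a` agree at each of its translates.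
          at (point c _) = trans (cong (τ i) (sym (reach a c a<L))) (trans (τ-comm i k (pt a)) (trans (cong (τ k) (trans p (sym q)))
                             (trans (sym (τ-comm j k (pt a))) (cong (τ j) (reach a c a<L)))))
            where
            k = c + (L ∸ a)

    isPyramidal : IsFPyramidalGroup f translates group
    isPyramidal = isPermGroup , isAutGroup , fixedCount≡ , sharplyTransitive

    translatesCopies : All (IsCopyOf lens) translates
    translatesCopies = All.map⁺ (All.universal copy (range 0 n))
      where
      copy : ∀ g → IsCopyOf lens (mapFactor (τ g) factor)
      copy g = trans (sym (map-∘ factor)) (trans (map-cong (length-map (τ g)) factor) (proj₁ isCopy)) ,
        ↭-trans (↭-reflexive (concat-map factor)) (↭-trans (↭-map⁺ (τ g) (proj₂ isCopy)) (τ-allVertices g))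

indicator-ι : ∀ {v} (a b : Fin v) → indicator a b ≡ + ι a b
indicator-ι a b with a Fin.≟ b
... | yes _ = refl
... | no _ = refl

-- The three multigraphs

module _ {n₀ : ℕ} where

  -- One diameter covers the edges `{x, x + n}` once, like all others. `M` is taken to be the
  -- multiplicity itself, so the partition holds by definition and the work lies in `IsKσ`.
  oneRotational : ∀ {lens} (B : Counting.BaseFactor n₀ 1 lens) → length (Counting.BaseFactor.diameters B) ≡ 1 →
    HasPyramidalSolution (suc n₀ + suc n₀ + 1) lens (+ 0) 1
  oneRotational B one = M , inj₁ (refl , λ a b a≢b → cong (λ t → + t) (simple (view a) (view b) a≢b)) ,
    translates B , (translatesCopies B , λ _ _ _ → refl) , group B , isPyramidal B
    where
    open Counting n₀ 1
    M : V → V → ℤ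
    M a b = + multiplicity B a b
    simple : ∀ {a b} → View a → View b → a ≢ b → multiplicity B a b ≡ 1
    simple (point x _) (point y _) ne = +-cancelʳ-≡ (ι (τ n (pt x)) (pt y)) _ _
      (trans (point-point B x y ne) (cong suc (trans (cong (_* ι (τ n (pt x)) (pt y)) one) (*-identityˡ _))))
    simple (point x _) (fixed j) _ = point-fixed B x j
    simple (fixed i) (point y _) _ = fixed-point B i y
    simple (fixed Fin.zero) (fixed Fin.zero) ne = ⊥-elim (ne refl)

  -- Two diameters cover each `{x, x + n}` twice, and these pairs are the doubled 1-factor.
  regular : ∀ {lens} (B : Counting.BaseFactor n₀ 0 lens) → length (Counting.BaseFactor.diameters B) ≡ 2 →
    HasPyramidalSolution (suc n₀ + suc n₀ + 0) lens (+ 1) 0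
  regular B two = M , inj₂ ((λ ()) , τ n , (τ-inverse n n refl , λ x → free (view x)) , λ a b a≢b → double (view a) (view b) a≢b) ,
    translates B , (translatesCopies B , λ _ _ _ → refl) , group B , isPyramidal B
    where
    open Counting n₀ 0
    M : V → V → ℤ
    M a b = + multiplicity B a b
    free : ∀ {x} → View x → τ n x ≢ x
    free (point x _) = antipode≢ x
    double : ∀ {a b} → View a → View b → a ≢ b → M a b ≡ + 1 ℤ.+ + 1 ℤ.* indicator (τ n a) b
    double (point x _) (point y _) ne = trans (cong (λ t → + t) (+-cancelʳ-≡ i _ _ (trans (point-point B x y ne) (cong suc (trans (cong (_* i) two) (cong (λ t → i + t) (+-identityʳ i)))))))
      (cong (λ t → + 1 ℤ.+ t) (trans (sym (ℤ.*-identityˡ (+ i))) (cong (+ 1 ℤ.*_) (sym (indicator-ι (τ n (pt x)) (pt y))))))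
      where
      i = ι (τ n (pt x)) (pt y)

  -- The removed 1-factor consists of the pairs `{x, x + n}` and the edge between the two fixed
  -- points; no translate contains any of them.
  twoPyramidal : ∀ {lens} (B : Counting.BaseFactor n₀ 2 lens) → length (Counting.BaseFactor.diameters B) ≡ 0 →
    HasPyramidalSolution (suc n₀ + suc n₀ + 2) lens -[1+ 0 ] 2
  twoPyramidal B none = M , inj₂ ((λ ()) , μ , ((λ x → involutive (view x)) , λ x → free (view x)) , λ a b a≢b → punctured (view a) (view b) a≢b) ,
    translates B , (translatesCopies B , λ _ _ _ → refl) , group B , isPyramidal B
    where
    open Counting n₀ 2
    M : V → V → ℤ
    M a b = + multiplicity B a b
    mate : V → Fin L ⊎ Fin 2 → V
    mate x (inj₁ _) = τ n x
    mate _ (inj₂ j) = ∞ (Fin.opposite j)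
    μ : V → V
    μ x = mate x (splitAt L x)
    μ-pt : ∀ x → μ (pt x) ≡ τ n (pt x)
    μ-pt x = cong (mate (pt x)) (Fin.splitAt-↑ˡ L (x mod L) 2)
    μ-∞ : ∀ j → μ (∞ j) ≡ ∞ (Fin.opposite j)
    μ-∞ j = cong (mate (∞ j)) (Fin.splitAt-↑ʳ L 2 j)
    involutive : ∀ {x} → View x → μ (μ x) ≡ x
    involutive (point x _) = trans (cong μ (trans (μ-pt x) (τ-pt n x))) (trans (μ-pt (x + n)) (trans (cong (τ n) (sym (τ-pt n x))) (τ-inverse n n refl (pt x))))
    involutive (fixed j) = trans (cong μ (μ-∞ j)) (trans (μ-∞ (Fin.opposite j)) (cong ∞ (Fin.opposite-involutive j)))
    free : ∀ {x} → View x → μ x ≢ x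
    free (point x _) q = antipode≢ x (trans (sym (μ-pt x)) q)
    free (fixed j) q = apart j (Fin.↑ʳ-injective L _ _ (trans (sym (μ-∞ j)) q))
      where
      apart : ∀ j → Fin.opposite {2} j ≢ j
      apart Fin.zero ()
      apart (Fin.suc Fin.zero) ()
    step : ∀ m i → m + i ≡ 1 → + m ≡ + 1 ℤ.+ -[1+ 0 ] ℤ.* + i
    step zero (suc zero) _ = refl
    step (suc zero) zero _ = refl
    step zero zero ()
    step zero (suc (suc i)) ()
    step (suc zero) (suc i) ()
    step (suc (suc m)) i ()
    via : ∀ {a b} c → μ a ≡ c → multiplicity B a b + ι c b ≡ 1 → M a b ≡ + 1 ℤ.+ -[1+ 0 ] ℤ.* indicator (μ a) b
    via {a} {b} c refl e = trans (step _ _ e) (cong (λ t → + 1 ℤ.+ -[1+ 0 ] ℤ.* t) (sym (indicator-ι (μ a) b)))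
    punctured : ∀ {a b} → View a → View b → a ≢ b → M a b ≡ + 1 ℤ.+ -[1+ 0 ] ℤ.* indicator (μ a) b
    punctured (point x _) (point y _) ne = via (τ n (pt x)) (μ-pt x) (trans (point-point B x y ne) (cong (λ t → suc (t * ι (τ n (pt x)) (pt y))) none))
    punctured (point x _) (fixed j) _ = via (τ n (pt x)) (μ-pt x) (cong₂ _+_ (point-fixed B x j) (ι-pt-∞ n x j))
    punctured (fixed i) (point y _) _ = via (∞ (Fin.opposite i)) (μ-∞ i) (cong₂ _+_ (fixed-point B i y) (ι-∞-pt (Fin.opposite i) y))
    punctured (fixed i) (fixed j) ne = via (∞ (Fin.opposite i)) (μ-∞ i) (cong₂ _+_ (fixed-fixed B ne) (ι-≡ (cong ∞ (other i j (λ q → ne (cong ∞ q))))))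
      where
      other : ∀ i j → i ≢ j → Fin.opposite {2} i ≡ j
      other Fin.zero Fin.zero ne = ⊥-elim (ne refl)
      other Fin.zero (Fin.suc Fin.zero) _ = refl
      other (Fin.suc Fin.zero) Fin.zero _ = refl
      other (Fin.suc Fin.zero) (Fin.suc Fin.zero) ne = ⊥-elim (ne refl)

-- Doubling

links : ∀ {A : Set} → A → List A → List (A × A)
links x [] = []
links x (y ∷ ys) = (x , y) ∷ links y ys

endOf : ∀ {A : Set} → A → List A → A
endOf x [] = x
endOf x (y ∷ ys) = endOf y ys

module _ {A : Set} where
  links-++ : ∀ (x : A) ys z zs → links x (ys ++ z ∷ zs) ≡ links x (ys ++ [ z ]) ++ links z zs
  links-++ x [] z zs = refl
  links-++ x (y ∷ ys) z zs = cong ((x , y) ∷_) (links-++ y ys z zs)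

  links-map : ∀ {B : Set} (h : A → B) x ys → links (h x) (map h ys) ≡ map (both h) (links x ys)
  links-map h x [] = refl
  links-map h x (y ∷ ys) = cong ((h x , h y) ∷_) (links-map h y ys)

cycleEdges-links : ∀ {v} (x : Fin v) xs → cycleEdges (x ∷ xs) ≡ links x (xs ++ [ x ])
cycleEdges-links x xs = go x xs x
  where
  go : ∀ y ys z → zip (y ∷ ys) (ys ++ [ z ]) ≡ links y (ys ++ [ z ])
  go y [] z = refl
  go y (w ∷ ys) z = cong ((y , w) ∷_) (go w ys z)

map-range-+ : ∀ {A : Set} (h : ℕ → A) a b k → map (λ x → h (x + b)) (range a k) ≡ map h (range (a + b) k)
map-range-+ h a b zero = refl
map-range-+ h a b (suc k) = cong (h (a + b) ∷_) (map-range-+ h (suc a) b k)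

range-All : ∀ {P : ℕ → Set} a k → (∀ i → a ≤ i → i < a + k → P i) → All P (range a k)
range-All a zero p = All.[]
range-All a (suc k) p = p a ≤-refl (m<m+n a (s≤s z≤n)) All.∷ range-All (suc a) k (λ i a<i i< → p i (<⇒≤ a<i) (subst (i <_) (sym (+-suc a k)) i<))

-- The flag tells whether the cycle is doubled to a single cycle (true) or copied.
FlaggedCycle : Set
FlaggedCycle = Bool × Cycle

flagCycles : (bjs : List (Bool × ℕ)) (cs : List Cycle) →
  map (λ c → length (proj₂ (proj₂ c))) cs ≡ map (λ j → suc (j * 2)) (map proj₂ bjs) →
  ∃ λ fcs → map proj₂ fcs ≡ cs × map (λ fc → proj₁ fc , length (proj₂ (proj₂ (proj₂ fc)))) fcs ≡ map (λ bj → proj₁ bj , suc (proj₂ bj * 2)) bjs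
flagCycles [] [] _ = [] , refl , refl
flagCycles ((b , j) ∷ bjs) (c ∷ cs) e with flagCycles bjs cs (cong (drop 1) e)
... | fcs , e₁ , e₂ = (b , c) ∷ fcs , cong (c ∷_) e₁ , cong₂ _∷_ (cong (b ,_) (heads e)) e₂
  where
  heads : ∀ {x y : ℕ} {xs ys} → x ∷ xs ≡ y ∷ ys → x ≡ y
  heads refl = refl

-- In a doubled cycle it is always the first edge that changes the sheet.
swapped kept : FlaggedCycle → List ℕ
swapped (b , x , y , r) = if b then [ x gap y ] else []
kept (b , x , y , r) = (if b then [] else [ x gap y ]) ++ steps y (r ++ [ x ])

swapped-kept : ∀ fcs → concatMap swapped fcs ++ concatMap kept fcs ↭ concatMap cycleSteps (map proj₂ fcs)
swapped-kept [] = ↭-refl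
swapped-kept ((b , x , y , r) ∷ fcs) = ↭-trans
  (↭-solve 4 (λ s S k K → ((s ⊕ S) ⊕ (k ⊕ K)) ⊜ ((s ⊕ k) ⊕ (S ⊕ K))) ↭-refl (swapped (b , x , y , r)) (concatMap swapped fcs) (kept (b , x , y , r)) (concatMap kept fcs))
  (++⁺ (one b) (swapped-kept fcs))
  where
  one : ∀ b → swapped (b , x , y , r) ++ kept (b , x , y , r) ↭ cycleSteps (x , y , r)
  one true = ↭-refl
  one false = ↭-refl

cycleLengths : Bool × ℕ → List ℕ
cycleLengths (b , j) = if b then [ 2 * (3 + j * 2) ] else 3 + j * 2 ∷ 3 + j * 2 ∷ []

module Lifting (n₀ f : ℕ) where
  open Counting n₀ f

  offset : Bool → ℕ
  offset s = if s then n else 0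

  lift : Bool → ℤ → V
  lift s x = pt (ℤ.∣ x ∣ + offset s)

  Label : ℤ → Set
  Label x = ∃ λ a → a < n × x ≡ + a

  τ-lift : ∀ s x → τ n (lift s x) ≡ lift (not s) x
  τ-lift false x = trans (τ-pt n (ℤ.∣ x ∣ + 0)) (cong (λ t → pt (t + n)) (+-identityʳ ℤ.∣ x ∣))
  τ-lift true x = trans (τ-pt n (ℤ.∣ x ∣ + n)) (trans (cong pt (+-assoc ℤ.∣ x ∣ n n)) (trans (pt-+L ℤ.∣ x ∣) (cong pt (sym (+-identityʳ ℤ.∣ x ∣)))))

  Class-sym : ∀ {x y d} → Class (x , y) d → Class (y , x) d
  Class-sym (forward x d) = backward x d
  Class-sym (backward x d) = forward x d

  private
    sameSheet : ∀ s a d → Class (lift s (+ a) , lift s (+ (a + d))) d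
    sameSheet s a d = subst (λ t → Class (pt (a + offset s) , pt t) d) (e a (offset s) d) (forward (a + offset s) d)
      where
      e : ∀ a k d → a + k + d ≡ a + d + k
      e a k d = solve (a ∷ k ∷ d ∷ [])

    -- From `a + d + n` a further step `c = n - d` leads to `a + 2n`, that is, back to `a`.
    otherSheet : ∀ s a d c → d + c ≡ n → Class (lift s (+ a) , lift (not s) (+ (a + d))) c
    otherSheet false a d c e = subst (λ t → Class (t , pt (a + d + n)) c)
      (trans (cong pt (trans (h a d n c) (cong (λ t → a + (n + t)) e))) (trans (pt-+L a) (cong pt (sym (+-identityʳ a))))) (backward (a + d + n) c)
      where
      h : ∀ a d n c → a + d + n + c ≡ a + (n + (d + c))
      h a d n c = solve (a ∷ d ∷ n ∷ c ∷ [])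
    otherSheet true a d c e = subst₂ (λ t u → Class (pt t , pt u) c)
      (trans (+-assoc a d c) (cong (λ t → a + t) e)) (sym (+-identityʳ (a + d))) (backward (a + d) c)

    gap-+ : ∀ a d → (+ a) gap (+ (a + d)) ≡ d
    gap-+ a d = trans (gap-comm (+ a) (+ (a + d))) (+-gap (a + d) a d refl)

  stay : ∀ {x y} → Label x → Label y → ∀ s → Class (lift s x , lift s y) (x gap y)
  stay (a , _ , refl) (b , _ , refl) s with ≤-total a b
  ... | inj₁ a≤b with m≤n⇒∃[o]m+o≡n a≤b
  ...   | d , refl = subst (Class _) (sym (gap-+ a d)) (sameSheet s a d)
  stay (a , _ , refl) (b , _ , refl) s | inj₂ b≤a with m≤n⇒∃[o]m+o≡n b≤a
  ...   | d , refl = subst (Class _) (sym (trans (gap-comm (+ (b + d)) (+ b)) (gap-+ b d))) (Class-sym (sameSheet s b d))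

  cross : ∀ {x y} → Label x → Label y → ∀ s c → x gap y + c ≡ n → Class (lift s x , lift (not s) y) c
  cross (a , _ , refl) (b , _ , refl) s c e with ≤-total a b
  ... | inj₁ a≤b with m≤n⇒∃[o]m+o≡n a≤b
  ...   | d , refl = otherSheet s a d c (trans (cong (_+ c) (sym (gap-+ a d))) e)
  cross (a , _ , refl) (b , _ , refl) s c e | inj₂ b≤a with m≤n⇒∃[o]m+o≡n b≤a
  ...   | d , refl = Class-sym (subst (λ t → Class (lift (not s) (+ b) , lift t (+ (b + d))) c) (not-involutive s)
                       (otherSheet (not s) b d c (trans (cong (_+ c) (sym (trans (gap-comm (+ (b + d)) (+ b)) (gap-+ b d)))) e)))

  Lifted : ℤ → V → Set
  Lifted x z = ∃ λ s → z ≡ lift s x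

  Resolved : ℕ × ℕ → Set
  Resolved (d , c) = c ≡ d ⊎ d + c ≡ n

  -- Each edge stays on its sheet or leaves it as the prescribed class demands. A path need not
  -- close up, so the crossings can be placed freely.
  liftPath : ∀ s x ys ws → steps x ys ≡ map proj₁ ws → All Resolved ws → Label x → All Label ys →
    ∃ λ zs → Pointwise Lifted ys zs × Pointwise Class (links (lift s x) zs) (map proj₂ ws)
  liftPath s x [] [] _ _ _ _ = [] , Pointwise.[] , Pointwise.[]
  liftPath s x (y ∷ ys) ((d , c) ∷ ws) e (r All.∷ rs) lx (ly All.∷ lys) with ∷-injective e
  ... | refl , e′ = go r
    where
    go : Resolved (x gap y , c) → ∃ λ zs → Pointwise Lifted (y ∷ ys) zs × Pointwise Class (links (lift s x) zs) (c ∷ map proj₂ ws)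
    go (inj₁ refl) with liftPath s y ys ws e′ rs ly lys
    ... | zs , lz , cl = lift s y ∷ zs , (s , refl) Pointwise.∷ lz , stay lx ly s Pointwise.∷ cl
    go (inj₂ q) with liftPath (not s) y ys ws e′ rs ly lys
    ... | zs , lz , cl = lift (not s) y ∷ zs , (not s , refl) Pointwise.∷ lz , cross lx ly s c q Pointwise.∷ cl

  stayPath : ∀ s x ys → Label x → All Label ys → Pointwise Class (links (lift s x) (map (lift s) ys)) (steps x ys)
  stayPath s x [] _ _ = Pointwise.[]
  stayPath s x (y ∷ ys) lx (ly All.∷ lys) = stay lx ly s Pointwise.∷ stayPath s y ys ly lys

  -- The sheet on which a vertex lies does not matter, because translation by `n` supplies the other
  -- one.
  cover : ∀ {xs zs} → Pointwise Lifted xs zs → zs ++ map (τ n) zs ↭ map (lift false) xs ++ map (lift true) xs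
  cover Pointwise.[] = ↭-refl
  cover {x ∷ xs} {z ∷ zs} ((s , refl) Pointwise.∷ ps) = ↭-trans
    (↭-solve 4 (λ a b c d → ((a ⊕ b) ⊕ (c ⊕ d)) ⊜ ((a ⊕ c) ⊕ (b ⊕ d))) ↭-refl [ z ] zs [ τ n z ] (map (τ n) zs))
    (↭-trans (++⁺ (sheets s) (cover ps))
    (↭-solve 4 (λ a b c d → ((a ⊕ b) ⊕ (c ⊕ d)) ⊜ ((a ⊕ c) ⊕ (b ⊕ d))) ↭-refl [ lift false x ] [ lift true x ] (map (lift false) xs) (map (lift true) xs)))
    where
    sheets : ∀ s → lift s x ∷ τ n (lift s x) ∷ [] ↭ lift false x ∷ lift true x ∷ []
    sheets false = ↭-reflexive (cong (λ t → lift false x ∷ t ∷ []) (τ-lift false x))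
    sheets true = ↭-trans (↭-reflexive (cong (λ t → lift true x ∷ t ∷ []) (τ-lift true x))) (↭-swap _ _ ↭-refl)

  -- Only the first vertex is tied to sheet `false`. For `b = true` the first edge crosses and the
  -- last one stays on sheet `true`, so the walk arrives at the translate of its first vertex and
  -- closes only after its own translate has been appended.
  liftCycle : FlaggedCycle → List V
  liftCycle (b , x , y , r) = lift false x ∷ map (lift b) (y ∷ r)

  liftCycle-Lifted : ∀ fc → Pointwise Lifted (verts (proj₂ fc)) (liftCycle fc)
  liftCycle-Lifted (b , x , y , r) = (false , refl) Pointwise.∷ (b , refl) Pointwise.∷ go r
    where
    go : ∀ r → Pointwise Lifted r (map (lift b) r)
    go [] = Pointwise.[]
    go (z ∷ r) = (b , refl) Pointwise.∷ go r

  cycleLinks : FlaggedCycle → List (V × V)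
  cycleLinks (b , x , y , r) = links (lift false x) (map (lift b) (y ∷ r ++ [ x ]))

  cycleClasses : FlaggedCycle → List ℕ
  cycleClasses (b , x , y , r) = (if b then n ∸ x gap y else x gap y) ∷ steps y (r ++ [ x ])

  pieces : FlaggedCycle → Factor (L + f)
  pieces fc@(true , _) = [ liftCycle fc ++ map (τ n) (liftCycle fc) ]
  pieces fc@(false , _) = liftCycle fc ∷ map (τ n) (liftCycle fc) ∷ []

  cycleLinks-Class : ∀ fc → All Label (verts (proj₂ fc)) → All (_≤ n) (swapped fc) → Pointwise Class (cycleLinks fc) (cycleClasses fc)
  cycleLinks-Class (false , x , y , r) (lx All.∷ ly All.∷ lr) _ = stayPath false x (y ∷ r ++ [ x ]) lx (ly All.∷ All.++⁺ lr (lx All.∷ All.[]))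
  cycleLinks-Class (true , x , y , r) (lx All.∷ ly All.∷ lr) (d≤n All.∷ _) =
    cross lx ly false (n ∸ x gap y) (m+[n∸m]≡n d≤n) Pointwise.∷ stayPath true y (r ++ [ x ]) ly (All.++⁺ lr (lx All.∷ All.[]))

  pieces-edges : ∀ fc → concatMap cycleEdges (pieces fc) ≡ cycleLinks fc ++ map (shiftEdge n) (cycleLinks fc)
  pieces-edges fc@(false , x , y , r) = cong₂ _++_ e (trans (++-identityʳ (cycleEdges (map (τ n) (liftCycle fc))))
      (trans (cycleEdges-map (τ n) (liftCycle fc)) (cong (map (shiftEdge n)) e)))
    where
    e : cycleEdges (liftCycle fc) ≡ cycleLinks fc
    e = trans (cycleEdges-links (lift false x) (map (lift false) (y ∷ r))) (cong (links (lift false x)) (sym (map-++ (lift false) (y ∷ r) [ x ])))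
  pieces-edges fc@(true , x , y , r) = trans (++-identityʳ _) (trans (cycleEdges-links X (Y ++ map (τ n) (X ∷ Y)))
      (trans (cong (links X) (++-assoc Y (map (τ n) (X ∷ Y)) [ X ])) (trans (links-++ X Y (τ n X) (map (τ n) Y ++ [ X ]))
      (cong₂ _++_ e (trans (cong (λ t → links (τ n X) (map (τ n) Y ++ [ t ])) (sym (τ-inverse n n refl X)))
        (trans (cong (links (τ n X)) (sym (map-++ (τ n) Y [ τ n X ]))) (trans (links-map (τ n) X (Y ++ [ τ n X ])) (cong (map (shiftEdge n)) e))))))))
    where
    X = lift false x
    Y = map (lift true) (y ∷ r)
    e : links X (Y ++ [ τ n X ]) ≡ cycleLinks fc
    e = trans (cong (λ t → links X (Y ++ [ t ])) (τ-lift false x)) (cong (links X) (sym (map-++ (lift true) (y ∷ r) [ x ])))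

  pieces-lengths : ∀ fc j → length (proj₂ (proj₂ (proj₂ fc))) ≡ suc (j * 2) → map length (pieces fc) ≡ cycleLengths (proj₁ fc , j)
  pieces-lengths (false , x , y , r) j e = cong₂ (λ a b → a ∷ b ∷ []) h (trans (length-map (τ n) (lift false x ∷ map (lift false) (y ∷ r))) h)
    where
    h : suc (length (map (lift false) (y ∷ r))) ≡ 3 + j * 2
    h = cong suc (trans (length-map (lift false) (y ∷ r)) (cong suc e))
  pieces-lengths (true , x , y , r) j e = cong [_] (trans (length-++ C) (trans (cong (λ t → length C + t) (length-map (τ n) C)) (cong₂ _+_ h (trans h (sym (+-identityʳ _))))))
    where
    C = lift false x ∷ map (lift true) (y ∷ r)
    h : length C ≡ 3 + j * 2
    h = cong suc (trans (length-map (lift true) (y ∷ r)) (cong suc e))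

  pieces-verts : ∀ fcs → concat (concatMap pieces fcs) ↭ concatMap liftCycle fcs ++ map (τ n) (concatMap liftCycle fcs)
  pieces-verts [] = ↭-refl
  pieces-verts (fc ∷ fcs) = ↭-trans (↭-reflexive (sym (concat-++ (pieces fc) (concatMap pieces fcs))))
    (↭-trans (++⁺ (↭-reflexive (one fc)) (pieces-verts fcs))
    (↭-trans (↭-solve 4 (λ a b c d → ((a ⊕ b) ⊕ (c ⊕ d)) ⊜ ((a ⊕ c) ⊕ (b ⊕ d))) ↭-refl (liftCycle fc) (map (τ n) (liftCycle fc)) (concatMap liftCycle fcs) _)
    (↭-reflexive (cong ((liftCycle fc ++ concatMap liftCycle fcs) ++_) (sym (map-++ (τ n) (liftCycle fc) (concatMap liftCycle fcs)))))))
    where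
    one : ∀ fc → concat (pieces fc) ≡ liftCycle fc ++ map (τ n) (liftCycle fc)
    one (true , _) = ++-identityʳ _
    one fc@(false , _) = cong (liftCycle fc ++_) (++-identityʳ _)

  -- The long cycle follows the path, crosses over, and returns along the translate of the path.
  returnEdges : (W : V × V → ℕ) → (∀ c d → W (c , d) ≡ W (d , c)) → ∀ p ps M z →
    ∑ W (links p (ps ++ M ++ reverse (map (τ n) (p ∷ ps)) ++ [ z ]))
    ≡ ∑ W (links p ps) + ∑ W (links (endOf p ps) (M ++ [ τ n (endOf p ps) ])) + ∑ W (map (shiftEdge n) (links p ps)) + W (τ n p , z)
  returnEdges W sym-W p [] M z = trans (cong (∑ W) (links-++ p M (τ n p) [ z ])) (trans (∑-++ W (links p (M ++ [ τ n p ])) [ (τ n p , z) ])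
    (e (∑ W (links p (M ++ [ τ n p ]))) (W (τ n p , z))))
    where
    e : ∀ a b → a + (b + 0) ≡ 0 + a + 0 + b
    e a b = solve (a ∷ b ∷ [])
  returnEdges W sym-W p (q ∷ ps) M z = trans (cong (λ t → W (p , q) + ∑ W (links q t)) shape)
    (trans (cong (λ t → W (p , q) + t) (trans (cong (∑ W) (links-++ q (ps ++ M ++ reverse (map (τ n) (q ∷ ps))) (τ n p) [ z ]))
      (trans (∑-++ W (links q ((ps ++ M ++ reverse (map (τ n) (q ∷ ps))) ++ [ τ n p ])) [ (τ n p , z) ])
        (cong (λ t → t + (W (τ n p , z) + 0)) (trans (cong (λ t → ∑ W (links q t)) (trans (++-assoc ps (M ++ reverse (map (τ n) (q ∷ ps))) [ τ n p ]) (cong (ps ++_) (++-assoc M _ [ τ n p ]))))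
          (trans (returnEdges W sym-W q ps M (τ n p)) (cong (λ t → ∑ W (links q ps) + E + S + t) (sym-W (τ n q) (τ n p)))))))))
    (e (W (p , q)) (∑ W (links q ps)) E S (W (τ n p , τ n q)) (W (τ n p , z))))
    where
    E = ∑ W (links (endOf q ps) (M ++ [ τ n (endOf q ps) ]))
    S = ∑ W (map (shiftEdge n) (links q ps))
    shape : ps ++ M ++ reverse (map (τ n) (p ∷ q ∷ ps)) ++ [ z ] ≡ (ps ++ M ++ reverse (map (τ n) (q ∷ ps))) ++ τ n p ∷ [ z ]
    shape = trans (cong (λ t → ps ++ M ++ t ++ [ z ]) (unfold-reverse (τ n p) (map (τ n) (q ∷ ps))))
      (trans (cong (λ t → ps ++ M ++ t) (++-assoc (reverse (map (τ n) (q ∷ ps))) [ τ n p ] [ z ]))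
      (trans (cong (ps ++_) (sym (++-assoc M (reverse (map (τ n) (q ∷ ps))) (τ n p ∷ [ z ]))))
             (sym (++-assoc ps (M ++ reverse (map (τ n) (q ∷ ps))) (τ n p ∷ [ z ])))))
    e : ∀ a b c d x y → a + (b + c + d + x + (y + 0)) ≡ a + b + c + (x + d) + y
    e a b c d x y = solve (a ∷ b ∷ c ∷ d ∷ x ∷ y ∷ [])

length-range : ∀ a k → length (range a k) ≡ k
length-range a zero = refl
length-range a (suc k) = cong suc (length-range (suc a) k)

-- The base factor

module Assembly (n₀ f : ℕ) (bjs : List (Bool × ℕ)) (G : Graceful (map proj₂ bjs) (suc n₀)) where
  open Counting n₀ f
  open Lifting n₀ f
  open Graceful G

  private
    flagged = flagCycles bjs cycles lengths

  fcs : List FlaggedCycle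
  fcs = proj₁ flagged

  S K : List ℕ
  S = concatMap swapped fcs
  K = concatMap kept fcs

  N-1 : ∃ λ N′ → suc N′ ≡ N
  N-1 = go N inner↭
    where
    go : ∀ M {xs} → 0 ∷ xs ↭ range 0 M → ∃ λ N′ → suc N′ ≡ M
    go zero p with ↭-length p
    ... | ()
    go (suc M) _ = M , refl

  N′ : ℕ
  N′ = proj₁ N-1

  old↭ : inner ++ S ++ K ↭ range 1 N′
  old↭ = drop-∷ (↭-trans (++⁺ˡ (0 ∷ inner) (↭-trans (swapped-kept fcs) (↭-reflexive (cong (concatMap cycleSteps) (proj₁ (proj₂ flagged))))))
    (↭-trans inner↭ (↭-reflexive (cong (range 0) (sym (proj₂ N-1))))))

  -- As `n = 2N + c`, the differences from `N` to `n - 1` are the complements of 1, ..., N + c;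
  -- splitting at `N` isolates the complements of the small differences.
  new↭ : range N (N + c) ↭ map (n ∸_) (inner ++ S ++ K) ++ map (n ∸_) (range N (suc c))
  new↭ = ↭-trans (↭-reflexive (cong (λ t → range t (N + c)) (sym (proj₂ N-1))))
    (↭-trans (range-reverse N′ 1 (N + c))
    (↭-trans (↭-reflexive (cong (λ t → map (t ∸_) (range 1 (N + c))) (trans (+-suc N′ (N + c)) (trans (cong (_+ (N + c)) (proj₂ N-1)) n≡))))
    (↭-trans (↭-reflexive (cong (map (n ∸_)) (sym (trans (range-++ 1 N′ (sym (proj₂ N-1))) (cong (range 1) (trans (+-suc N′ c) (cong (_+ c) (proj₂ N-1))))))))
    (↭-trans (↭-reflexive (map-++ (n ∸_) (range 1 N′) (range N (suc c))))
             (++⁺ʳ _ (↭-map⁺ (n ∸_) (↭-sym old↭)))))))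

  -- The large path differences that are left alone: all except the complements of `S`.
  Y : List ℕ
  Y = map (n ∸_) inner ++ map (n ∸_) K ++ map (n ∸_) (range N (suc c))

  -- Pairs of a difference and the class its edge is to have. A path edge of difference `n - d`, for
  -- `d` in `S`, gets class `d` and so replaces the doubled cycle's edge that moves to class
  -- `n - d`.
  marked : List (ℕ × ℕ)
  marked = map (λ d → d , d) inner ++ map (λ d → n ∸ d , d) S ++ map (λ d → d , d) Y

  marked₁ : map proj₁ marked ↭ steps start path
  marked₁ = ↭-trans (↭-reflexive (trans (map-++ proj₁ (map (λ d → d , d) inner) _) (cong₂ _++_ (fix inner)
      (trans (map-++ proj₁ (map (λ d → n ∸ d , d) S) _) (cong₂ _++_ (sym (map-∘ S)) (fix Y))))))
    (↭-trans (↭-solve 5 (λ i s a k r → (i ⊕ (s ⊕ (a ⊕ (k ⊕ r)))) ⊜ (i ⊕ ((a ⊕ (s ⊕ k)) ⊕ r))) ↭-refl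
        inner (map (n ∸_) S) (map (n ∸_) inner) (map (n ∸_) K) (map (n ∸_) (range N (suc c))))
    (↭-trans (↭-reflexive (cong (λ t → inner ++ t ++ map (n ∸_) (range N (suc c))) (trans (cong (map (n ∸_) inner ++_) (sym (map-++ (n ∸_) S K))) (sym (map-++ (n ∸_) inner (S ++ K))))))
    (↭-trans (++⁺ˡ inner (↭-sym new↭)) (↭-sym steps↭))))
    where
    fix : ∀ (xs : List ℕ) → map proj₁ (map (λ d → d , d) xs) ≡ xs
    fix [] = refl
    fix (x ∷ xs) = cong (x ∷_) (fix xs)

  marked₂ : map proj₂ marked ≡ inner ++ S ++ Y
  marked₂ = trans (map-++ proj₂ (map (λ d → d , d) inner) _) (cong₂ _++_ (fix (λ d → d) inner)
      (trans (map-++ proj₂ (map (λ d → n ∸ d , d) S) _) (cong₂ _++_ (fix (n ∸_) S) (fix (λ d → d) Y))))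
    where
    fix : ∀ (g : ℕ → ℕ) (xs : List ℕ) → map proj₂ (map (λ d → g d , d) xs) ≡ xs
    fix g [] = refl
    fix g (x ∷ xs) = cong (x ∷_) (fix g xs)

  S≤n : All (_≤ n) S
  S≤n = All.++⁻ˡ S (All.++⁻ʳ inner (All-resp-↭ (↭-sym old↭) (range-All 1 N′ (λ i _ i< → ≤-trans (<⇒≤ i<) (subst (suc N′ ≤_) n≡ (subst (_≤ N + (N + c)) (sym (proj₂ N-1)) (m≤m+n N (N + c))))))))

  resolved : All Resolved marked
  resolved = All.++⁺ (same inner) (All.++⁺ (All.map⁺ (All.map (λ d≤n → inj₂ (m∸n+n≡m d≤n)) S≤n)) (same Y))
    where
    same : ∀ xs → All Resolved (map (λ d → d , d) xs)
    same xs = All.map⁺ (All.universal (λ _ → inj₁ refl) xs)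

  private
    arranged = ↭-map-inv proj₁ marked₁

  -- The pairs of `marked` in the order in which the path runs through them.
  ws : List (ℕ × ℕ)
  ws = proj₁ arranged

  cycleClasses↭ : ∀ fcs → concatMap cycleClasses fcs ↭ map (n ∸_) (concatMap swapped fcs) ++ concatMap kept fcs
  cycleClasses↭ [] = ↭-refl
  cycleClasses↭ ((b , x , y , r) ∷ fcs) = ↭-trans (++⁺ (↭-reflexive (one b)) (cycleClasses↭ fcs))
    (↭-trans (↭-solve 4 (λ s k T U → ((s ⊕ k) ⊕ (T ⊕ U)) ⊜ ((s ⊕ T) ⊕ (k ⊕ U))) ↭-refl
        (map (n ∸_) (swapped (b , x , y , r))) (kept (b , x , y , r)) (map (n ∸_) (concatMap swapped fcs)) (concatMap kept fcs))
      (++⁺ʳ _ (↭-reflexive (sym (map-++ (n ∸_) (swapped (b , x , y , r)) (concatMap swapped fcs))))))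
    where
    one : ∀ b → cycleClasses (b , x , y , r) ≡ map (n ∸_) (swapped (b , x , y , r)) ++ kept (b , x , y , r)
    one true = refl
    one false = refl

  -- Path and cycles have merely exchanged `S` with its complements, so the total is that of the
  -- graceful labelling.
  allClasses↭ : map proj₂ ws ++ concatMap cycleClasses fcs ↭ range 1 n₀
  allClasses↭ = ↭-trans (++⁺ (↭-trans (↭-map⁺ proj₂ (↭-sym (proj₂ (proj₂ arranged)))) (↭-reflexive marked₂)) (cycleClasses↭ fcs))
    (↭-trans (↭-solve 7 (λ i s a k r t u → ((i ⊕ (s ⊕ (a ⊕ (k ⊕ r)))) ⊕ (t ⊕ u)) ⊜ ((i ⊕ (s ⊕ u)) ⊕ ((a ⊕ (t ⊕ k)) ⊕ r))) ↭-refl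
        inner S (map (n ∸_) inner) (map (n ∸_) K) (map (n ∸_) (range N (suc c))) (map (n ∸_) S) K)
    (↭-trans (++⁺ old↭ (↭-trans (↭-reflexive (cong (_++ map (n ∸_) (range N (suc c))) (trans (cong (map (n ∸_) inner ++_) (sym (map-++ (n ∸_) S K))) (sym (map-++ (n ∸_) inner (S ++ K)))))) (↭-sym new↭)))
      (↭-reflexive (trans (range-++ 1 N′ (sym (proj₂ N-1))) (cong (range 1) (suc-injective (trans (cong (_+ (N + c)) (proj₂ N-1)) n≡)))))))

  flaggedVerts : List ℤ
  flaggedVerts = concatMap (λ fc → verts (proj₂ fc)) fcs

  labels↭ : start ∷ path ++ flaggedVerts ↭ map +_ (range 0 n)
  labels↭ = ↭-trans (↭-reflexive (cong (λ t → start ∷ path ++ t) (trans (sym (concatMap-map verts proj₂ fcs)) (cong (concatMap verts) (proj₁ (proj₂ flagged)))))) verts↭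

  labels : All Label (start ∷ path ++ flaggedVerts)
  labels = All-resp-↭ (↭-sym labels↭) (All.map⁺ (range-All 0 n (λ i _ i<n → i , i<n , refl)))

  lifted : ∃ λ zs → Pointwise Lifted path zs × Pointwise Class (links (lift false start) zs) (map proj₂ ws)
  lifted = liftPath false start path ws (proj₁ (proj₂ arranged)) (All-resp-↭ (proj₂ (proj₂ arranged)) resolved)
    (All.head labels) (All.++⁻ˡ path (All.tail labels))

  p : V
  p = lift false start

  zs : List V
  zs = proj₁ lifted

  P PL CL : _
  P = p ∷ zs
  PL = links p zs
  CL = concatMap cycleLinks fcs

  -- `Graceful` does not record the order of the path; it is what the cycles leave of the `n`
  -- labels.
  pathLength : suc (length path) + ∑ (λ bj → 3 + proj₂ bj * 2) bjs ≡ n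
  pathLength = trans (cong (λ t → suc (length path) + t) (trans (sym (∑-map (λ bm → 2 + proj₂ bm) (λ bj → proj₁ bj , suc (proj₂ bj * 2)) bjs))
      (trans (cong (∑ (λ bm → 2 + proj₂ bm)) (sym (proj₂ (proj₂ flagged)))) (trans (∑-map (λ bm → 2 + proj₂ bm) (λ fc → proj₁ fc , length (proj₂ (proj₂ (proj₂ fc)))) fcs) (count fcs)))))
    (trans (sym (length-++ (start ∷ path))) (trans (↭-length labels↭) (trans (length-map (λ t → + t) (range 0 n)) (length-range 0 n))))
    where
    count : ∀ (fcs : List FlaggedCycle) → ∑ (λ fc → 2 + length (proj₂ (proj₂ (proj₂ fc)))) fcs ≡ length (concatMap (λ fc → verts (proj₂ fc)) fcs)
    count [] = refl
    count (fc ∷ fcs) = trans (cong (λ t → 2 + length (proj₂ (proj₂ (proj₂ fc))) + t) (count fcs)) (sym (length-++ (verts (proj₂ fc))))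

  P-length : length P ≡ suc (length path)
  P-length = cong suc (sym (Pointwise.Pointwise-length (proj₁ (proj₂ lifted))))

  smallEdges : ∀ W fcs → ∑ W (concatMap cycleEdges (concatMap pieces fcs)) ≡ ∑ W (concatMap cycleLinks fcs) + ∑ W (map (shiftEdge n) (concatMap cycleLinks fcs))
  smallEdges W [] = refl
  smallEdges W (fc ∷ fcs) = trans (cong (∑ W) (concatMap-++ cycleEdges (pieces fc) (concatMap pieces fcs)))
    (trans (∑-++ W (concatMap cycleEdges (pieces fc)) _) (trans (cong₂ _+_ (trans (cong (∑ W) (pieces-edges fc)) (∑-++ W (cycleLinks fc) _)) (smallEdges W fcs))
    (trans (e (∑ W (cycleLinks fc)) (∑ W (map (shiftEdge n) (cycleLinks fc))) (∑ W (concatMap cycleLinks fcs)) (∑ W (map (shiftEdge n) (concatMap cycleLinks fcs))))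
      (sym (cong₂ _+_ (∑-++ W (cycleLinks fc) _) (trans (cong (∑ W) (map-++ (shiftEdge n) (cycleLinks fc) _)) (∑-++ W (map (shiftEdge n) (cycleLinks fc)) _)))))))
    where
    e : ∀ a b c d → a + b + (c + d) ≡ a + c + (b + d)
    e a b c d = solve (a ∷ b ∷ c ∷ d ∷ [])

  smallClass : ∀ fcs → All Label (concatMap (λ fc → verts (proj₂ fc)) fcs) → All (_≤ n) (concatMap swapped fcs) → Pointwise Class (concatMap cycleLinks fcs) (concatMap cycleClasses fcs)
  smallClass [] _ _ = Pointwise.[]
  smallClass (fc ∷ fcs) ls ss = Pointwise.++⁺ (cycleLinks-Class fc (All.++⁻ˡ (verts (proj₂ fc)) ls) (All.++⁻ˡ (swapped fc) ss))
    (smallClass fcs (All.++⁻ʳ (verts (proj₂ fc)) ls) (All.++⁻ʳ (swapped fc) ss))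

  smallLengths : ∀ fcs bjs → map (λ fc → proj₁ fc , length (proj₂ (proj₂ (proj₂ fc)))) fcs ≡ map (λ bj → proj₁ bj , suc (proj₂ bj * 2)) bjs →
    map length (concatMap pieces fcs) ≡ concatMap cycleLengths bjs
  smallLengths [] [] _ = refl
  smallLengths (fc ∷ fcs) ((b , j) ∷ bjs) e with ∷-injective e
  ... | e₁ , e₂ with cong proj₁ e₁
  ... | refl = trans (map-++ length (pieces fc) _) (cong₂ _++_ (pieces-lengths fc j (cong proj₂ e₁)) (smallLengths fcs bjs e₂))

  allLifted : Pointwise Lifted (start ∷ path ++ flaggedVerts) (P ++ concatMap liftCycle fcs)
  allLifted = (false , refl) Pointwise.∷ Pointwise.++⁺ (proj₁ (proj₂ lifted)) (go fcs)
    where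
    go : ∀ fcs → Pointwise Lifted (concatMap (λ fc → verts (proj₂ fc)) fcs) (concatMap liftCycle fcs)
    go [] = Pointwise.[]
    go (fc ∷ fcs) = Pointwise.++⁺ (liftCycle-Lifted fc) (go fcs)

  covered : (P ++ concatMap liftCycle fcs) ++ map (τ n) (P ++ concatMap liftCycle fcs) ↭ map pt (range 0 L)
  covered = ↭-trans (cover allLifted) (↭-trans (++⁺ (↭-map⁺ (lift false) labels↭) (↭-map⁺ (lift true) labels↭))
    (↭-reflexive (trans (cong₂ _++_ (trans (sym (map-∘ (range 0 n))) (map-cong (λ a → cong pt (+-identityʳ a)) (range 0 n)))
                                    (trans (sym (map-∘ (range 0 n))) (map-range-+ pt 0 n n)))
      (trans (sym (map-++ pt (range 0 n) (range n n))) (cong (map pt) (range-++ 0 n refl))))))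

  endPoint : ∃ λ y → endOf p zs ≡ pt y
  endPoint = go (proj₁ (proj₂ lifted)) (ℤ.∣ start ∣ + 0 , refl)
    where
    go : ∀ {xs zs q} → Pointwise Lifted xs zs → (∃ λ y → q ≡ pt y) → ∃ λ y → endOf q zs ≡ pt y
    go Pointwise.[] e = e
    go {x ∷ _} ((s , e) Pointwise.∷ ps) _ = go ps (ℤ.∣ x ∣ + offset s , e)

  -- The values of `σ` differ only in how the path and its translate are joined to the long cycle
  -- `big`; spokes and diameters are the joints.
  assemble : (big : List V) (spokes : List (Fin f × ℕ)) (diameters : List ℕ) →
    (let T = map (λ s → ∞ (proj₁ s) , pt (proj₂ s)) spokes in
    (∀ W → (∀ c d → W (c , d) ≡ W (d , c)) → ∑ W (cycleEdges big) ≡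
       ∑ W PL + ∑ W (map (shiftEdge n) PL) + (∑ W T + ∑ W (map (shiftEdge n) T)) + ∑ W (map (λ x → pt x , τ n (pt x)) diameters))) →
    big ↭ map ∞ (allFin f) ++ P ++ map (τ n) P →
    (∀ i → ∑ (λ s → ι (∞ (proj₁ s)) (∞ i)) spokes ≡ 1) →
    BaseFactor (suc (length path) + suc (length path) + f ∷ concatMap cycleLengths bjs)
  assemble big spokes diameters bigEdges bigVerts hub = record
    { factor = big ∷ concatMap pieces fcs
    ; edges = PL ++ CL
    ; classes = map proj₂ ws ++ concatMap cycleClasses fcs
    ; spokes = spokes
    ; diameters = diameters
    ; isCopy = cong₂ _∷_ bigLength (smallLengths fcs bjs (proj₂ (proj₂ flagged))) ,
        ↭-trans (++⁺ bigVerts (pieces-verts fcs))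
        (↭-trans (↭-solve 5 (λ h a b c d → ((h ⊕ (a ⊕ b)) ⊕ (c ⊕ d)) ⊜ (((a ⊕ c) ⊕ (b ⊕ d)) ⊕ h)) ↭-refl
            (map ∞ (allFin f)) P (map (τ n) P) (concatMap liftCycle fcs) (map (τ n) (concatMap liftCycle fcs)))
        (↭-trans (++⁺ʳ _ (↭-trans (↭-reflexive (cong ((P ++ concatMap liftCycle fcs) ++_) (sym (map-++ (τ n) P (concatMap liftCycle fcs))))) covered))
          (↭-reflexive (sym allVertices))))
    ; class = Pointwise.++⁺ (proj₂ (proj₂ lifted)) (smallClass fcs (All.++⁻ʳ (start ∷ path) labels) S≤n)
    ; classes↭ = allClasses↭
    ; hub = hub
    ; factorEdges≈ = λ W sym-W → trans (∑-++ W (cycleEdges big) _) (trans (cong₂ _+_ (bigEdges W sym-W) (smallEdges W fcs))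
        (trans (e (∑ W PL) (∑ W (map (shiftEdge n) PL)) (∑ W T) (∑ W (map (shiftEdge n) T)) (∑ W D) (∑ W CL) (∑ W (map (shiftEdge n) CL)))
          (sym (trans (∑-++ W ((PL ++ CL) ++ T) _) (cong₂ _+_ (split W PL CL T)
            (trans (∑-++ W (map (shiftEdge n) ((PL ++ CL) ++ T)) D) (cong (_+ ∑ W D)
              (trans (cong (∑ W) (trans (map-++ (shiftEdge n) (PL ++ CL) T) (cong (_++ map (shiftEdge n) T) (map-++ (shiftEdge n) PL CL))))
                (split W (map (shiftEdge n) PL) (map (shiftEdge n) CL) (map (shiftEdge n) T))))))))))
    }
    where
    T = map (λ s → ∞ (proj₁ s) , pt (proj₂ s)) spokes
    D = map (λ x → pt x , τ n (pt x)) diameters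
    split : ∀ (W : V × V → ℕ) xs ys zs → ∑ W ((xs ++ ys) ++ zs) ≡ ∑ W xs + ∑ W ys + ∑ W zs
    split W xs ys zs = trans (∑-++ W (xs ++ ys) zs) (cong (_+ ∑ W zs) (∑-++ W xs ys))
    e : ∀ a b c d x y z → a + b + (c + d) + x + (y + z) ≡ a + y + c + (b + z + d + x)
    e a b c d x y z = solve (a ∷ b ∷ c ∷ d ∷ x ∷ y ∷ z ∷ [])
    bigLength : length big ≡ suc (length path) + suc (length path) + f
    bigLength = trans (↭-length bigVerts) (trans (length-++ (map ∞ (allFin f))) (trans (cong₂ _+_ (trans (length-map ∞ (allFin f)) (length-tabulate (λ i → i)))
      (trans (length-++ P) (cong₂ _+_ P-length (trans (length-map (τ n) P) P-length)))) (+-comm f _)))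

  back : List V
  back = reverse (map (τ n) P)

  back↭ : back ↭ map (τ n) P
  back↭ = ↭-reverse (map (τ n) P)

module _ (n₀ : ℕ) (bjs : List (Bool × ℕ)) (G : Graceful (map proj₂ bjs) (suc n₀)) where
  private
    k = suc (length (Graceful.path G))

  -- Both joints are diameters, one at each end of the path.
  solutionRegular : HasPyramidalSolution (suc n₀ + suc n₀ + 0) (k + k + 0 ∷ concatMap cycleLengths bjs) (+ 1) 0
  solutionRegular = regular (assemble (P ++ back) [] (ℤ.∣ Graceful.start G ∣ + 0 ∷ proj₁ endPoint ∷ []) edges (++⁺ˡ P back↭) (λ ())) refl
    where
    open Counting n₀ 0
    open Lifting n₀ 0
    open Assembly n₀ 0 bjs G
    edges : ∀ W → (∀ c d → W (c , d) ≡ W (d , c)) → ∑ W (cycleEdges (P ++ back)) ≡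
      ∑ W PL + ∑ W (map (shiftEdge n) PL) + 0 + (W (p , τ n p) + (W (pt (proj₁ endPoint) , τ n (pt (proj₁ endPoint))) + 0))
    edges W sym-W = trans (cong (∑ W) (trans (cycleEdges-links p (zs ++ back)) (cong (links p) (++-assoc zs back [ p ]))))
      (trans (returnEdges W sym-W p zs [] p)
      (trans (cong₂ (λ l t → ∑ W PL + (W (l , τ n l) + 0) + ∑ W (map (shiftEdge n) PL) + t) (proj₂ endPoint) (sym-W (τ n p) p))
        (e (∑ W PL) (∑ W (map (shiftEdge n) PL)) _ (W (p , τ n p)))))
      where
      e : ∀ a b x y → a + (x + 0) + b + y ≡ a + b + 0 + (y + (x + 0))
      e a b x y = solve (a ∷ b ∷ x ∷ y ∷ [])

  -- The start of the path and its translate are joined through the fixed point, the other ends by a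
  -- diameter.
  solutionOneRotational : HasPyramidalSolution (suc n₀ + suc n₀ + 1) (k + k + 1 ∷ concatMap cycleLengths bjs) (+ 0) 1
  solutionOneRotational = oneRotational (assemble (∞₀ ∷ P ++ back) [ Fin.zero , ℤ.∣ Graceful.start G ∣ + 0 ] [ proj₁ endPoint ] edges
      (↭-prep ∞₀ (++⁺ˡ P back↭)) (λ { Fin.zero → cong (_+ 0) (ι-≡ {a = ∞₀} refl) })) refl
    where
    open Counting n₀ 1
    open Lifting n₀ 1
    open Assembly n₀ 1 bjs G
    ∞₀ : V
    ∞₀ = ∞ Fin.zero
    edges : ∀ W → (∀ c d → W (c , d) ≡ W (d , c)) → ∑ W (cycleEdges (∞₀ ∷ P ++ back)) ≡
      ∑ W PL + ∑ W (map (shiftEdge n) PL) + ((W (∞₀ , p) + 0) + (W (τ n ∞₀ , τ n p) + 0)) + (W (pt (proj₁ endPoint) , τ n (pt (proj₁ endPoint))) + 0)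
    edges W sym-W = trans (cong (∑ W) (trans (cycleEdges-links ∞₀ (P ++ back)) (cong (λ t → (∞₀ , p) ∷ links p t) (++-assoc zs back [ ∞₀ ]))))
      (trans (cong (λ t → W (∞₀ , p) + t) (trans (returnEdges W sym-W p zs [] ∞₀)
        (cong₂ (λ l t → ∑ W PL + (W (l , τ n l) + 0) + ∑ W (map (shiftEdge n) PL) + t) (proj₂ endPoint)
          (trans (sym-W (τ n p) ∞₀) (cong (λ t → W (t , τ n p)) (sym (τ-∞ n Fin.zero)))))))
        (e (∑ W PL) (∑ W (map (shiftEdge n) PL)) _ (W (∞₀ , p)) (W (τ n ∞₀ , τ n p))))
      where
      e : ∀ a b x y z → y + (a + (x + 0) + b + z) ≡ a + b + ((y + 0) + (z + 0)) + (x + 0)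
      e a b x y z = solve (a ∷ b ∷ x ∷ y ∷ z ∷ [])

  -- Each end is joined to its translate through a fixed point of its own.
  solutionTwoPyramidal : HasPyramidalSolution (suc n₀ + suc n₀ + 2) (k + k + 2 ∷ concatMap cycleLengths bjs) -[1+ 0 ] 2
  solutionTwoPyramidal = twoPyramidal (assemble (∞₀ ∷ P ++ ∞₁ ∷ back)
      ((Fin.zero , ℤ.∣ Graceful.start G ∣ + 0) ∷ (Fin.suc Fin.zero , proj₁ endPoint) ∷ []) [] edges
      (↭-prep ∞₀ (↭-trans (shift ∞₁ P back) (↭-prep ∞₁ (++⁺ˡ P back↭)))) hub) refl
    where
    open Counting n₀ 2
    open Lifting n₀ 2
    open Assembly n₀ 2 bjs G
    ∞₀ ∞₁ : V
    ∞₀ = ∞ Fin.zero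
    ∞₁ = ∞ (Fin.suc Fin.zero)
    hub : ∀ i → ι ∞₀ (∞ i) + (ι ∞₁ (∞ i) + 0) ≡ 1
    hub Fin.zero = cong₂ (λ a b → a + (b + 0)) (ι-≡ {a = ∞₀} refl) (ι-≢ {a = ∞₁} {∞₀} (λ q → Fin.0≢1+n (sym (Fin.↑ʳ-injective L _ _ q))))
    hub (Fin.suc Fin.zero) = cong₂ (λ a b → a + (b + 0)) (ι-≢ {a = ∞₀} {∞₁} (λ q → Fin.0≢1+n (Fin.↑ʳ-injective L _ _ q))) (ι-≡ {a = ∞₁} refl)
    edges : ∀ W → (∀ c d → W (c , d) ≡ W (d , c)) → ∑ W (cycleEdges (∞₀ ∷ P ++ ∞₁ ∷ back)) ≡
      ∑ W PL + ∑ W (map (shiftEdge n) PL) + ((W (∞₀ , p) + (W (∞₁ , pt (proj₁ endPoint)) + 0)) + (W (τ n ∞₀ , τ n p) + (W (τ n ∞₁ , τ n (pt (proj₁ endPoint))) + 0))) + 0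
    edges W sym-W = trans (cong (∑ W) (trans (cycleEdges-links ∞₀ (P ++ ∞₁ ∷ back)) (cong (λ t → (∞₀ , p) ∷ links p t) (++-assoc zs (∞₁ ∷ back) [ ∞₀ ]))))
      (trans (cong (λ t → W (∞₀ , p) + t) (trans (returnEdges W sym-W p zs [ ∞₁ ] ∞₀)
        (cong₂ (λ l t → ∑ W PL + l + ∑ W (map (shiftEdge n) PL) + t)
          (trans (cong (λ l → W (l , ∞₁) + (W (∞₁ , τ n l) + 0)) (proj₂ endPoint))
            (cong₂ (λ a b → a + (W (b , τ n (pt (proj₁ endPoint))) + 0)) (sym-W (pt (proj₁ endPoint)) ∞₁) (sym (τ-∞ n (Fin.suc Fin.zero)))))
          (trans (sym-W (τ n p) ∞₀) (cong (λ t → W (t , τ n p)) (sym (τ-∞ n Fin.zero)))))))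
        (e (∑ W PL) (∑ W (map (shiftEdge n) PL)) (W (∞₁ , pt (proj₁ endPoint))) (W (τ n ∞₁ , τ n (pt (proj₁ endPoint)))) (W (∞₀ , p)) (W (τ n ∞₀ , τ n p))))
      where
      e : ∀ a b u w y z → y + (a + (u + (w + 0)) + b + z) ≡ a + b + ((y + (u + 0)) + (z + (w + 0))) + 0
      e a b u w y z = solve (a ∷ b ∷ u ∷ w ∷ y ∷ z ∷ [])

-- The bound on h and the parity of h

splitMax : ∀ j js → ∃ λ J → ∃ λ rest → (rest ++ [ J ] ↭ j ∷ js) × All (_≤ J) rest
splitMax j [] = j , [] , ↭-refl , All.[]
splitMax j (k ∷ ks) with splitMax k ks
... | J , rest , p , le with ≤-total j J
... | inj₁ j≤J = J , j ∷ rest , ↭-prep j p , j≤J All.∷ le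
... | inj₂ J≤j = j , J ∷ rest , ↭-trans (++-comm (J ∷ rest) [ j ]) (↭-prep j (↭-trans (++-comm [ J ] rest) p)) , J≤j All.∷ All.map (λ q → ≤-trans q J≤j) le

-- The bound is asked for every member of the list, so that the caller need not know which one is
-- largest.
graceful : ∀ j js n → (∀ J → J ∈ j ∷ js → 7 ^ length js * (12 * suc J + 9) ≤ n) → Graceful (j ∷ js) n
graceful j js n bound with splitMax j js
... | J , rest , p , le = reorder p (finish layout n 1≤e N≤5e (≤-trans size (subst (λ t → 7 ^ t * (12 * suc J + 9) ≤ n) len (bound J (∈-resp-↭ p (last∈ rest))))))
  where
  open Grown (grown J rest le)
  last∈ : ∀ xs → J ∈ xs ++ [ J ]
  last∈ [] = Any.here refl
  last∈ (x ∷ xs) = Any.there (last∈ xs)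
  len : length js ≡ length rest
  len = suc-injective (trans (sym (↭-length p)) (trans (length-++ rest) (+-comm (length rest) 1)))
  1≤e : 1 ≤ e
  1≤e with M≤e
  ... | inj₁ q = ≤-trans (s≤s z≤n) q
  ... | inj₂ (q , _) = subst (1 ≤_) q (s≤s z≤n)

oddHalf : ∀ n → 3 ≤ n → n % 2 ≡ 1 → ∃ λ j → n ≡ 3 + j * 2
oddHalf n 3≤n odd≡ with evenOrOdd n
... | even k with trans (sym odd≡) (m*n%n≡0 k 2)
...   | ()
oddHalf _ (s≤s ()) _ | odd zero
oddHalf _ _ _ | odd (suc k) = k , refl

≤-max : ∀ {x} xs → x ∈ xs → x ≤ foldr _⊔_ 0 xs
≤-max (x ∷ xs) (Any.here refl) = m≤m⊔n x _
≤-max (x ∷ xs) (Any.there p) = ≤-trans (≤-max xs p) (m≤n⊔m x _)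

totalLength : List (Bool × ℕ) → ℕ
totalLength = ∑ (λ bj → 3 + proj₂ bj * 2)

sum-cycleLengths : ∀ bjs → sum (concatMap cycleLengths bjs) ≡ totalLength bjs + totalLength bjs
sum-cycleLengths [] = refl
sum-cycleLengths ((b , j) ∷ bjs) = trans (sum-++ (cycleLengths (b , j)) (concatMap cycleLengths bjs)) (trans (cong₂ _+_ (one b) (sum-cycleLengths bjs)) (e (3 + j * 2) (totalLength bjs)))
  where
  one : ∀ b → sum (cycleLengths (b , j)) ≡ (3 + j * 2) + (3 + j * 2)
  one true = trans (+-identityʳ _) (cong (λ t → 3 + j * 2 + t) (+-identityʳ (3 + j * 2)))
  one false = cong (λ t → 3 + j * 2 + t) (+-identityʳ (3 + j * 2))
  e : ∀ a t → a + a + (t + t) ≡ a + t + (a + t)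
  e a t = solve (a ∷ t ∷ [])

-- With k the order of the path, the long cycle has length h = 2k + f where f = 1 - σ.
solveFor : ∀ bj bjs k f → (∀ J → J ∈ map proj₂ (bj ∷ bjs) → 7 ^ length bjs * (12 * suc J + 9) ≤ k) → ∀ (σ : ℤ) →
  (f ≡ 0 × σ ≡ + 1) ⊎ (f ≡ 1 × σ ≡ + 0) ⊎ (f ≡ 2 × σ ≡ -[1+ 0 ]) →
  let T = k + k + f ∷ concatMap cycleLengths (bj ∷ bjs) in
  HasPyramidalSolution (sum T) T σ ∣ + 1 ℤ.- σ ∣
solveFor bj bjs k f bound σ cases = subst (λ v → HasPyramidalSolution v T σ ∣ + 1 ℤ.- σ ∣) (sym order) (go cases)
  where
  c = totalLength (bj ∷ bjs)
  T = k + k + f ∷ concatMap cycleLengths (bj ∷ bjs)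
  -- `c` reduces to a successor, so `suc (pred c)` is `c` by computation.
  n₀ = k + pred c
  n≡ : suc n₀ ≡ k + c
  n≡ = sym (+-suc k (pred c))
  G : Graceful (map proj₂ (bj ∷ bjs)) (suc n₀)
  G = graceful (proj₂ bj) (map proj₂ bjs) (suc n₀) (λ J J∈ → ≤-trans (subst (λ t → 7 ^ t * (12 * suc J + 9) ≤ k) (sym (length-map proj₂ bjs)) (bound J J∈))
        (≤-trans (m≤m+n k (pred c)) (n≤1+n n₀)))
  path≡ : suc (length (Graceful.path G)) ≡ k
  path≡ = +-cancelʳ-≡ c _ _ (trans (Assembly.pathLength n₀ 0 (bj ∷ bjs) G) n≡)
  order : sum T ≡ suc n₀ + suc n₀ + f
  order = trans (cong (λ t → k + k + f + t) (sum-cycleLengths (bj ∷ bjs))) (trans (e k f c) (cong (λ t → t + t + f) (sym n≡)))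
    where
    e : ∀ k f c → k + k + f + (c + c) ≡ k + c + (k + c) + f
    e k f c = solve (k ∷ f ∷ c ∷ [])
  go : (f ≡ 0 × σ ≡ + 1) ⊎ (f ≡ 1 × σ ≡ + 0) ⊎ (f ≡ 2 × σ ≡ -[1+ 0 ]) → HasPyramidalSolution (suc n₀ + suc n₀ + f) T σ ∣ + 1 ℤ.- σ ∣
  go (inj₁ (refl , refl)) = subst (λ k → HasPyramidalSolution (suc n₀ + suc n₀ + 0) (k + k + 0 ∷ concatMap cycleLengths (bj ∷ bjs)) (+ 1) 0) path≡ (solutionRegular n₀ (bj ∷ bjs) G)
  go (inj₂ (inj₁ (refl , refl))) = subst (λ k → HasPyramidalSolution (suc n₀ + suc n₀ + 1) (k + k + 1 ∷ concatMap cycleLengths (bj ∷ bjs)) (+ 0) 1) path≡ (solutionOneRotational n₀ (bj ∷ bjs) G)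
  go (inj₂ (inj₂ (refl , refl))) = subst (λ k → HasPyramidalSolution (suc n₀ + suc n₀ + 2) (k + k + 2 ∷ concatMap cycleLengths (bj ∷ bjs)) -[1+ 0 ] 2) path≡ (solutionTwoPyramidal n₀ (bj ∷ bjs) G)

-- The other cycles contribute the even number `S + S` to the order, so the condition on `σ` says
-- that `h` and `f = 1 - σ` have the same parity.
pathOrder : ∀ h S → 3 ≤ h → (σ : ℤ) → (σ ≡ -[1+ 0 ] ⊎ σ ≡ + 0 ⊎ σ ≡ + 1) → (+ 2) ∣ (+ (h + (S + S)) ℤ.- + 1 ℤ.- σ) →
  ∃ λ k → ∃ λ f → h ≡ k + k + f × f ≤ 2 × ((f ≡ 0 × σ ≡ + 1) ⊎ (f ≡ 1 × σ ≡ + 0) ⊎ (f ≡ 2 × σ ≡ -[1+ 0 ]))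
pathOrder h S 3≤h σ σ∈ div with evenOrOdd h
pathOrder _ S (s≤s ()) _ _ _ | odd zero
pathOrder _ S 3≤h _ (inj₂ (inj₁ refl)) _ | odd k = k , 1 , e k , s≤s z≤n , inj₂ (inj₁ (refl , refl))
  where
  e : ∀ k → suc (k * 2) ≡ k + k + 1
  e k = solve (k ∷ [])
-- With `h` in successor form the integer expression computes to a natural number, visibly odd.
pathOrder _ S 3≤h _ (inj₁ refl) (divides q eq) | odd (suc k) = ⊥-elim (*2≢odd q (suc k + S) (trans (sym eq) (e k S)))
  where
  e : ∀ k S → suc (suc (k * 2)) + (S + S) + 1 ≡ suc ((suc k + S) * 2)
  e k S = solve (k ∷ S ∷ [])
pathOrder _ S 3≤h _ (inj₂ (inj₂ refl)) (divides q eq) | odd (suc k) = ⊥-elim (*2≢odd q (k + S) (trans (sym eq) (e k S)))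
  where
  e : ∀ k S → suc (k * 2) + (S + S) ≡ suc ((k + S) * 2)
  e k S = solve (k ∷ S ∷ [])
pathOrder _ S () _ _ _ | even zero
pathOrder _ S 3≤h _ (inj₁ refl) _ | even (suc k) = k , 2 , e k , ≤-refl , inj₂ (inj₂ (refl , refl))
  where
  e : ∀ k → suc k * 2 ≡ k + k + 2
  e k = solve (k ∷ [])
pathOrder _ S 3≤h _ (inj₂ (inj₂ refl)) _ | even (suc k) = suc k , 0 , e k , z≤n , inj₁ (refl , refl)
  where
  e : ∀ k → suc k * 2 ≡ suc k + suc k + 0
  e k = solve (k ∷ [])
pathOrder _ S 3≤h _ (inj₂ (inj₁ refl)) (divides q eq) | even (suc k) = ⊥-elim (*2≢odd q (k + S) (trans (sym eq) (e k S)))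
  where
  e : ∀ k S → suc (k * 2) + (S + S) + 0 ≡ suc ((k + S) * 2)
  e k S = solve (k ∷ S ∷ [])

theorem6p2 : (h r s : ℕ) (ℓ : Fin s → ℕ) →
    1 ≤ s → r ≤ s → 3 ≤ h →
    (∀ i → ℓ i % 2 ≡ 1) →
    (∀ i → 3 ≤ ℓ i) →
    (∀ i j → toℕ i < toℕ j → toℕ j < r → ℓ i < ℓ j) →
    7 ^ (s ∸ 1) * (12 * maxℓ s ℓ + 6) < h →
    (σ : ℤ) → (σ ≡ -[1+ 0 ] ⊎ σ ≡ + 0 ⊎ σ ≡ + 1) →
    (+ 2) ∣ (+ sum (cycleType h r s ℓ) - + 1 - σ) →
    HasPyramidalSolution (sum (cycleType h r s ℓ)) (cycleType h r s ℓ) σ ∣ + 1 - σ ∣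
theorem6p2 h r (suc s) ℓ _ _ 3≤h ℓ-odd 3≤ℓ _ large σ σ∈ div = subst (λ T → HasPyramidalSolution (sum T) T σ ∣ + 1 ℤ.- σ ∣) (sym type≡)
  (main (pathOrder h (totalLength bjs) 3≤h σ σ∈ (subst (λ t → (+ 2) ∣ (+ t ℤ.- + 1 ℤ.- σ)) (trans (cong sum type≡) (cong (λ t → h + t) (sum-cycleLengths bjs))) div)))
  where
  half : Fin (suc s) → ℕ
  half i = proj₁ (oddHalf (ℓ i) (3≤ℓ i) (ℓ-odd i))
  ℓ≡ : ∀ i → ℓ i ≡ 3 + half i * 2
  ℓ≡ i = proj₂ (oddHalf (ℓ i) (3≤ℓ i) (ℓ-odd i))
  flag : Fin (suc s) → Bool × ℕ
  flag i = (toℕ i <ᵇ r) , half i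
  bjs : List (Bool × ℕ)
  bjs = map flag (allFin (suc s))
  type≡ : cycleType h r (suc s) ℓ ≡ h ∷ concatMap cycleLengths bjs
  type≡ = cong (h ∷_) (trans (concatMap-cong (λ i → cong (λ t → if toℕ i <ᵇ r then [ 2 * t ] else (t ∷ t ∷ [])) (ℓ≡ i)) (allFin (suc s)))
    (sym (concatMap-map cycleLengths flag (allFin (suc s)))))
  B : ℕ → ℕ
  B J = 7 ^ s * (12 * suc J + 9)
  enough : ∀ {k f} → h ≡ k + k + f → f ≤ 2 → ∀ J → J ∈ map proj₂ bjs → B J ≤ k
  enough {k} {f} h≡ f≤2 J J∈ with ∈-map⁻ proj₂ J∈
  ... | bj , bj∈ , refl with ∈-map⁻ flag bj∈
  -- `f ≤ 2` costs one unit of `k`, which the strict inequality on `h` gives back.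
  ... | i , _ , refl = s≤s⁻¹ (*-cancelʳ-< 2 (B (half i)) (suc k) (begin-strict
      B (half i) * 2 ≡⟨ e₁ (7 ^ s) (half i) ⟩
      7 ^ s * (12 * (3 + half i * 2) + 6) ≤⟨ *-monoʳ-≤ (7 ^ s) (+-monoˡ-≤ 6 (*-monoʳ-≤ 12 (subst (_≤ maxℓ (suc s) ℓ) (ℓ≡ i) (≤-max (map ℓ (allFin (suc s))) (∈-map⁺ ℓ (∈-allFin i)))))) ⟩
      7 ^ s * (12 * maxℓ (suc s) ℓ + 6) <⟨ large ⟩
      h ≡⟨ h≡ ⟩
      k + k + f ≤⟨ +-monoʳ-≤ (k + k) f≤2 ⟩
      k + k + 2 ≡⟨ e₂ k ⟩
      suc k * 2 ∎))
    where
    open ≤-Reasoning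
    e₁ : ∀ x j → x * (12 * suc j + 9) * 2 ≡ x * (12 * (3 + j * 2) + 6)
    e₁ x j = solve (x ∷ j ∷ [])
    e₂ : ∀ k → k + k + 2 ≡ suc k * 2
    e₂ k = solve (k ∷ [])
  main : (∃ λ k → ∃ λ f → h ≡ k + k + f × f ≤ 2 × ((f ≡ 0 × σ ≡ + 1) ⊎ (f ≡ 1 × σ ≡ + 0) ⊎ (f ≡ 2 × σ ≡ -[1+ 0 ]))) →
    HasPyramidalSolution (sum (h ∷ concatMap cycleLengths bjs)) (h ∷ concatMap cycleLengths bjs) σ ∣ + 1 ℤ.- σ ∣
  main (k , f , h≡ , f≤2 , cases) = subst (λ t → HasPyramidalSolution (sum (t ∷ concatMap cycleLengths bjs)) (t ∷ concatMap cycleLengths bjs) σ ∣ + 1 ℤ.- σ ∣) (sym h≡)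
    (solveFor (flag Fin.zero) (map flag (tabulate Fin.suc)) k f
      (λ J J∈ → subst (λ t → 7 ^ t * (12 * suc J + 9) ≤ k) (sym (trans (length-map flag (tabulate {n = s} Fin.suc)) (length-tabulate {n = s} Fin.suc))) (enough h≡ f≤2 J J∈)) σ cases)
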